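{- Let $X=[-1,1]\subset\mathbb{R}$ and $\mathcal{A}=\{\alpha_1,\ldots,\alpha_m\}\subset\mathbb{R}$ with $\alpha_1<\cdots<\alpha_m$, where $m\ge3$. The extremal rays of $C_X(\mathcal{A})$ are the following: (1) $\mathbb{R}_+\cdot\left(\exp(\alpha_2x)-\exp(\alpha_1-\alpha_2)\exp(\alpha_1x)\right)$, (2) $\mathbb{R}_+\cdot\left(\exp(\alpha_{m-1}x)-\exp(\alpha_{m-1}-\alpha_m)\exp(\alpha_mx)\right)$, (3) $\mathbb{R}_+\cdot\left(c_{i-1}\exp(\alpha_{i-1}x)+c_i\exp(\alpha_ix)+c_{i+1}\exp(\alpha_{i+1}x)\right)$ for $i\in\{2,\ldots,m-1\}$, with $$c_{i-1}>0,\quad c_{i+1}>0\quad\text{and}\quad c_i=-\left(\frac{c_{i-1}}{\lambda_{i-1}}\right)^{\lambda_{i-1}}\left(\frac{c_{i+1}}{\lambda_{i+1}}\right)^{\lambda_{i+1}},$$ where $$\lambda_{i-1}=\frac{\alpha_{i+1}-\alpha_i}{\alpha_{i+1}-\alpha_{i-1}},\quad \lambda_{i+1}=\frac{\alpha_i-\alpha_{i-1}}{\alpha_{i+1}-\alpha_{i-1}}\quad\text{and}\quad \alpha_{i-1}-\alpha_{i+1}\le\ln\frac{c_{i-1}\lambda_{i+1}}{c_{i+1}\lambda_{i-1}}\le\alpha_{i+1}-\alpha_{i-1}.$$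
   Context: For a non-empty convex set $X\subset\mathbb{R}^n$, a finite non-empty set $\mathcal{A}\subset\mathbb{R}^n$ and $\beta\in\mathcal{A}$, the $X$-AGE cone with respect to $\beta$ is $C_X(\mathcal{A},\beta)=\{f : f=\sum_{\alpha\in\mathcal{A}}c_\alpha\exp(\alpha^Tx)\text{ is non-negative on }X,\ c_\alpha\ge0\text{ for all }\alpha\in\mathcal{A}\setminus\{\beta\}\}$, where the $c_\alpha$ are real. The $X$-SAGE cone (conditional SAGE cone) supported on $\mathcal{A}$ is the Minkowski sum $C_X(\mathcal{A})=\sum_{\beta\in\mathcal{A}}C_X(\mathcal{A},\beta)$, a convex cone in the space of exponential sums $\sum_{\alpha\in\mathcal{A}}c_\alpha\exp(\alpha^Tx)$. -}

module Defs where

open import Algebra.Bundles using (CommutativeRing; Semiring)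
import Algebra.Definitions.RawSemiring as RawSemiringDefinitions
open import Data.Fin.Base using (Fin)
open import Data.Nat.Base using (ℕ; suc) renaming (_≤_ to _≤ℕ_)
open import Data.Product.Base using (_×_; ∃-syntax; Σ-syntax)
open import Data.Vec.Functional using (Vector)
open import Level using (0ℓ) renaming (suc to lsuc)
open import Relation.Binary.Core using (Rel)
open import Relation.Binary.PropositionalEquality.Core using (_≢_)
open import Relation.Binary.Structures using (IsTotalOrder)
import Relation.Binary.Construct.NonStrictToStrict as NonStrictToStrict
open import Relation.Nullary.Negation using (¬_)
open import Relation.Unary using (Pred; _∈_; _≐_; Satisfiable)

-- The real numbers are taken to be any Dedekind-complete ordered field (such a
-- field is unique up to isomorphism).  Equality is a setoid equality, because
-- the usual constructions of the reals are quotients.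
--
-- _⁻¹ and sup are total functions, specified only where they are meaningful:
-- on non-zero numbers, and on non-empty sets that are bounded above.

record CompleteOrderedField : Set (lsuc 0ℓ) where
  field
    commutativeRing : CommutativeRing 0ℓ 0ℓ

  open CommutativeRing commutativeRing public
    renaming (Carrier to ℝ; zero to *-zero)

  infix  4 _≤_
  infix  9 _⁻¹

  field
    _≤_          : Rel ℝ 0ℓ
    isTotalOrder : IsTotalOrder _≈_ _≤_
    +-monoˡ-≤    : ∀ {x y} z → x ≤ y → x + z ≤ y + z
    *-nonNeg     : ∀ {x y} → 0# ≤ x → 0# ≤ y → 0# ≤ x * y
    0≉1          : ¬ (0# ≈ 1#)
    _⁻¹          : ℝ → ℝ
    ⁻¹-inverseʳ  : ∀ {x} → ¬ (x ≈ 0#) → x * x ⁻¹ ≈ 1#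

  IsUpperBound : Pred ℝ 0ℓ → ℝ → Set
  IsUpperBound P u = ∀ {x} → P x → x ≤ u

  field
    sup       : Pred ℝ 0ℓ → ℝ
    sup-upper : ∀ {P} → Satisfiable P → Satisfiable (IsUpperBound P) →
                IsUpperBound P (sup P)
    sup-least : ∀ {P u} → Satisfiable P → IsUpperBound P u → sup P ≤ u

module Analysis (R : CompleteOrderedField) where

  open CompleteOrderedField R
  open NonStrictToStrict _≈_ _≤_ public using (_<_)
  open RawSemiringDefinitions (Semiring.rawSemiring semiring) public
    using (_^_; sum) renaming (_×_ to _·_)

  infix  4 _⟶_
  infixl 7 _/_
  infixr 8 _**_

  _/_ : ℝ → ℝ → ℝ
  x / y = x * y ⁻¹

  _⟶_ : (ℕ → ℝ) → ℝ → Set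
  a ⟶ l = ∀ ε → 0# < ε →
    ∃[ N ] ∀ n → N ≤ℕ n → (- ε < a n - l) × (a n - l < ε)

  -- A convergent sequence has exactly one limit, and the supremum of a
  -- one-element set is its element.
  lim : (ℕ → ℝ) → ℝ
  lim a = sup (a ⟶_)

  -- Euler's formula exp x = lim (1 + x / k) ^ k over k ≥ 1, where k = suc n.
  exp : ℝ → ℝ
  exp x = lim (λ n → (1# + x / (suc n · 1#)) ^ suc n)

  -- For y > 0 the set below has exactly one element; for y ≤ 0 it is empty and
  -- the value of ln y is unspecified.
  ln : ℝ → ℝ
  ln y = sup (λ x → exp x ≈ y)

  -- The real power x ** y is meaningful only for x > 0.
  _**_ : ℝ → ℝ → ℝ
  x ** y = exp (y * ln x)

  Icc : ℝ → ℝ → Pred ℝ 0ℓ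
  Icc a b x = a ≤ x × x ≤ b

  infix  4 _≗ᶠ_
  infixl 6 _+ᶠ_
  infixr 7 _∙ᶠ_

  _≗ᶠ_ : Rel (ℝ → ℝ) 0ℓ
  f ≗ᶠ g = ∀ x → f x ≈ g x

  _+ᶠ_ : (ℝ → ℝ) → (ℝ → ℝ) → (ℝ → ℝ)
  (f +ᶠ g) x = f x + g x

  _∙ᶠ_ : ℝ → (ℝ → ℝ) → (ℝ → ℝ)
  (t ∙ᶠ f) x = t * f x

  0ᶠ : ℝ → ℝ
  0ᶠ x = 0#

  -- A finite set of exponents is given by an enumeration α without
  -- repetitions, and an element of it by its index β.
  AGE : ∀ {m} → Pred ℝ 0ℓ → Vector ℝ m → Fin m → Pred (ℝ → ℝ) 0ℓ
  AGE {m} X α β f = Σ[ c ∈ Vector ℝ m ]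
    (f ≗ᶠ λ x → sum (λ i → c i * exp (α i * x))) ×
    (∀ x → x ∈ X → 0# ≤ f x) ×
    (∀ i → i ≢ β → 0# ≤ c i)

  SAGE : ∀ {m} → Pred ℝ 0ℓ → Vector ℝ m → Pred (ℝ → ℝ) 0ℓ
  SAGE {m} X α f = Σ[ g ∈ Vector (ℝ → ℝ) m ]
    (∀ β → g β ∈ AGE X α β) ×
    (f ≗ᶠ λ x → sum (λ β → g β x))

  -- The half-line ℝ₊ · f, including its apex 0.
  Ray : (ℝ → ℝ) → Pred (ℝ → ℝ) 0ℓ
  Ray f g = ∃[ t ] 0# ≤ t × g ≗ᶠ t ∙ᶠ f

  IsExtremalRay : Pred (ℝ → ℝ) 0ℓ → Pred (ℝ → ℝ) 0ℓ → Set
  IsExtremalRay K ρ =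
    (∃[ f ] f ∈ K × ¬ (f ≗ᶠ 0ᶠ) × ρ ≐ Ray f) ×
    (∀ g h → g ∈ K → h ∈ K → (g +ᶠ h) ∈ ρ → g ∈ ρ × h ∈ ρ)

{-# OPTIONS --safe #-}
-- An AGE function that generates an extremal ray must vanish at some z ∈ X, as
-- otherwise a multiple of its distinguished monomial could be split off, and no
-- monomial generates an extremal ray.  Centred at z, an AGE function with a zero
-- at z is a coefficient vector q with Σ q = 0, non-negative except at β, whose
-- moment Σ q α has the sign of a derivative: it is 0 at interior points, ≥ 0 at
-- z = - 1 and ≤ 0 at z = 1.  Such vectors split into vectors with two or three
-- entries; these split further unless the entries are consecutive, and
-- the two-entry ones also unless they sit at the end of the list of exponents.
--
-- Conversely, if a listed function is a sum of SAGE functions, then all the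
-- AGE summands vanish at its zero z.  Pairing their coefficient vectors with the
-- quadratic (x - a) (x - b), where a and b are the neighbours of the negative
-- exponent (or the two exponents of the function) and the value at the negative
-- exponent is replaced by 0, gives non-negative numbers with sum 0, and this
-- forces every summand to be a multiple of the given function.

module Submission where

open import Defs
open import Algebra.Bundles using (CommutativeRing)
import Algebra.Solver.Ring as RingSolver
open import Algebra.Solver.Ring.AlmostCommutativeRing using (fromCommutativeRing; _-Raw-AlmostCommutative⟶_)
open import Axiom.ExcludedMiddle using (ExcludedMiddle)
open import Data.Fin.Base using (Fin; zero; suc; inject₁; fromℕ; fromℕ<; toℕ) renaming (_<_ to _<ꟳ_)
open import Data.Fin.Properties using (_≟_; suc-injective; toℕ-injective; toℕ-inject₁; toℕ-fromℕ<; toℕ<n; ≤fromℕ; <-cmp)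
open import Data.Integer.Base as ℤ using (ℤ; +_; -[1+_])
import Data.Integer.Properties as ℤ
open import Data.Maybe.Base as Maybe using (Maybe)
open import Data.Nat.Base as ℕ using (ℕ; zero; suc)
open import Data.Nat.Base using () renaming (suc to sucℕ; _+_ to _+ℕ_)
import Data.Nat.Properties as ℕ
open import Data.Product.Base using (_×_; _,_; proj₁; proj₂; ∃-syntax)
open import Data.Sum.Base using (_⊎_; inj₁; inj₂)
open import Data.Vec.Functional using (Vector)
open import Function.Base using (_∘_)
open import Function.Bundles using (_⇔_; mk⇔)
open import Level using (0ℓ)
open import Relation.Binary.Definitions using (tri<; tri≈; tri>)
open import Relation.Binary.PropositionalEquality.Core as ≡ using (_≡_; _≢_)
open import Relation.Binary.Structures using (IsTotalOrder)
open import Relation.Nullary using (¬_; Dec; yes; no; contradiction)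
open import Relation.Nullary.Decidable using (dec⇒maybe)
open import Relation.Unary using (Pred; _∈_; _≐_; Satisfiable)

-- The sign conditions on the moment are both sufficient and necessary because of one reduction:
-- divided by its distinguished monomial, an AGE function keeps a constant as its only term of free
-- sign, so the quotient is convex and is controlled by its slope at a zero. As the coefficients
-- centred at a zero have total 0, this slope is the moment, whichever exponent is distinguished,
-- and AGE functions with different distinguished exponents can be compared. Since the exponential
-- is given as a limit in an abstract field, convexity enters through the tangent inequality
-- `exp-secant` and continuity through one-sided Lipschitz bounds.
--
-- The quadratic differs from the square of the distance to the distinguished exponent by a linear
-- function, which sees only moment and total. This is why its pairing has a sign. Its value at the
-- pivot must become 0 for the vectors distinguished there, whose entry may be negative; for all
-- others the entry is non-negative and the quadratic is at most 0 at the pivot, so the change never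
-- lowers the pairing.

-- A ring solver with integer coefficients.

module IntegerRingSolver (A : CommutativeRing 0ℓ 0ℓ) where
  open CommutativeRing A
  open import Algebra.Properties.Ring ring using (-0#≈0#; -‿distribˡ-*; -‿distribʳ-*; -‿+-comm; -‿involutive)
  open import Algebra.Properties.Semiring.Mult.TCOptimised semiring using (×-homo-+; ×1-homo-*; 1+×) renaming (_×_ to _·_)
  open import Relation.Binary.Reasoning.Setoid setoid

  ⟦_⟧ℤ : ℤ → Carrier
  ⟦ + n ⟧ℤ = n · 1#
  ⟦ -[1+ n ] ⟧ℤ = - (suc n · 1#)

  ⟦⟧-⊖ : ∀ m n → ⟦ m ℤ.⊖ n ⟧ℤ ≈ m · 1# - n · 1#
  ⟦⟧-⊖ m zero = sym (trans (+-congˡ -0#≈0#) (+-identityʳ _))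
  ⟦⟧-⊖ zero (suc n) = sym (+-identityˡ _)
  ⟦⟧-⊖ (suc m) (suc n) = begin
    ⟦ suc m ℤ.⊖ suc n ⟧ℤ             ≡⟨ ≡.cong ⟦_⟧ℤ (ℤ.[1+m]⊖[1+n]≡m⊖n m n) ⟩
    ⟦ m ℤ.⊖ n ⟧ℤ                     ≈⟨ ⟦⟧-⊖ m n ⟩
    m · 1# - n · 1#                  ≈⟨ +-congʳ (sym (+-identityˡ _)) ⟩
    (0# + m · 1#) - n · 1#           ≈⟨ +-congʳ (+-congʳ (sym (-‿inverseʳ 1#))) ⟩
    (1# - 1# + m · 1#) - n · 1#      ≈⟨ +-congʳ (trans (+-assoc _ _ _) (trans (+-congˡ (+-comm _ _)) (sym (+-assoc _ _ _)))) ⟩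
    (1# + m · 1# - 1#) - n · 1#      ≈⟨ +-assoc _ _ _ ⟩
    (1# + m · 1#) + (- 1# - n · 1#)  ≈⟨ +-congˡ (-‿+-comm _ _) ⟩
    (1# + m · 1#) - (1# + n · 1#)    ≈⟨ sym (+-cong (1+× m 1#) (-‿cong (1+× n 1#))) ⟩
    suc m · 1# - suc n · 1#          ∎

  ⟦⟧-- : ∀ i → ⟦ ℤ.- i ⟧ℤ ≈ - ⟦ i ⟧ℤ
  ⟦⟧-- (+ zero) = sym -0#≈0#
  ⟦⟧-- (+ suc n) = refl
  ⟦⟧-- -[1+ n ] = sym (-‿involutive _)

  ⟦⟧-+ : ∀ i j → ⟦ i ℤ.+ j ⟧ℤ ≈ ⟦ i ⟧ℤ + ⟦ j ⟧ℤ
  ⟦⟧-+ (+ m) (+ n) = ×-homo-+ 1# m n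
  ⟦⟧-+ (+ m) -[1+ n ] = ⟦⟧-⊖ m (suc n)
  ⟦⟧-+ -[1+ m ] (+ n) = trans (⟦⟧-⊖ n (suc m)) (+-comm _ _)
  ⟦⟧-+ -[1+ m ] -[1+ n ] = begin
    - (suc (suc (m ℕ.+ n)) · 1#)       ≡⟨ ≡.cong (λ k → - (k · 1#)) (≡.cong suc (≡.sym (ℕ.+-suc m n))) ⟩
    - ((suc m ℕ.+ suc n) · 1#)         ≈⟨ -‿cong (×-homo-+ 1# (suc m) (suc n)) ⟩
    - (suc m · 1# + suc n · 1#)        ≈⟨ sym (-‿+-comm _ _) ⟩
    - (suc m · 1#) - (suc n · 1#)      ∎

  ⟦⟧-*⁺ : ∀ m j → ⟦ + m ℤ.* j ⟧ℤ ≈ m · 1# * ⟦ j ⟧ℤ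
  ⟦⟧-*⁺ m (+ n) = begin
    ⟦ + m ℤ.* + n ⟧ℤ   ≡⟨ ≡.cong ⟦_⟧ℤ (≡.sym (ℤ.pos-* m n)) ⟩
    (m ℕ.* n) · 1#     ≈⟨ ×1-homo-* m n ⟩
    m · 1# * (n · 1#)  ∎
  ⟦⟧-*⁺ m -[1+ n ] = begin
    ⟦ + m ℤ.* -[1+ n ] ⟧ℤ       ≡⟨ ≡.cong ⟦_⟧ℤ (≡.sym (ℤ.neg-distribʳ-* (+ m) (+ suc n))) ⟩
    ⟦ ℤ.- (+ m ℤ.* + suc n) ⟧ℤ  ≈⟨ ⟦⟧-- (+ m ℤ.* + suc n) ⟩
    - ⟦ + m ℤ.* + suc n ⟧ℤ      ≈⟨ -‿cong (⟦⟧-*⁺ m (+ suc n)) ⟩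
    - (m · 1# * (suc n · 1#))   ≈⟨ -‿distribʳ-* _ _ ⟩
    m · 1# * - (suc n · 1#)     ∎

  ⟦⟧-* : ∀ i j → ⟦ i ℤ.* j ⟧ℤ ≈ ⟦ i ⟧ℤ * ⟦ j ⟧ℤ
  ⟦⟧-* (+ m) j = ⟦⟧-*⁺ m j
  ⟦⟧-* -[1+ m ] j = begin
    ⟦ -[1+ m ] ℤ.* j ⟧ℤ         ≡⟨ ≡.cong ⟦_⟧ℤ (≡.sym (ℤ.neg-distribˡ-* (+ suc m) j)) ⟩
    ⟦ ℤ.- (+ suc m ℤ.* j) ⟧ℤ    ≈⟨ ⟦⟧-- (+ suc m ℤ.* j) ⟩
    - ⟦ + suc m ℤ.* j ⟧ℤ        ≈⟨ -‿cong (⟦⟧-*⁺ (suc m) j) ⟩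
    - (suc m · 1# * ⟦ j ⟧ℤ)     ≈⟨ -‿distribˡ-* _ _ ⟩
    - (suc m · 1#) * ⟦ j ⟧ℤ     ∎

  ℤ⟶A : ℤ.+-*-rawRing -Raw-AlmostCommutative⟶ fromCommutativeRing A
  ℤ⟶A = record
    { ⟦_⟧ = ⟦_⟧ℤ ; +-homo = ⟦⟧-+ ; *-homo = ⟦⟧-* ; -‿homo = ⟦⟧-- ; 0-homo = refl ; 1-homo = refl }

  -- Normal forms are compared by their integer coefficients, where equality is decided by
  -- computation.
  ⟦⟧-≟ : ∀ i j → Maybe (⟦ i ⟧ℤ ≈ ⟦ j ⟧ℤ)
  ⟦⟧-≟ i j = Maybe.map (λ i≡j → reflexive (≡.cong ⟦_⟧ℤ i≡j)) (dec⇒maybe (i ℤ.≟ j))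

  open RingSolver ℤ.+-*-rawRing (fromCommutativeRing A) ℤ⟶A ⟦⟧-≟
    public using (solve; _:=_; _:+_; _:*_; _:-_; :-_; con)

-- Ordered field arithmetic.

module RealAnalysis (em : ExcludedMiddle 0ℓ) (R : CompleteOrderedField) where

  open CompleteOrderedField R
  open Analysis R
  open IntegerRingSolver commutativeRing
  open IsTotalOrder isTotalOrder public using (≤-respˡ-≈; ≤-respʳ-≈)
    renaming (refl to ≤-refl; reflexive to ≤-reflexive; trans to ≤-trans; antisym to ≤-antisym; total to ≤-total)
  open import Algebra.Properties.Semiring.Sum semiring public
    using (sum-cong-≋; ∑-distrib-+; ∑-comm; *-distribˡ-sum; sum-replicate-zero)

  <-resp-≈ : ∀ {x x′ y y′} → x ≈ x′ → y ≈ y′ → x < y → x′ < y′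
  <-resp-≈ x≈x′ y≈y′ (x≤y , x≉y) = ≤-respˡ-≈ x≈x′ (≤-respʳ-≈ y≈y′ x≤y) , λ x′≈y′ → x≉y (trans x≈x′ (trans x′≈y′ (sym y≈y′)))

  x-0≈x : ∀ {x} → x - 0# ≈ x
  x-0≈x {x} = solve 1 (λ x → x :- con (+ 0) := x) refl x

  -0≈0 : - 0# ≈ 0#
  -0≈0 = solve 0 (:- con (+ 0) := con (+ 0)) refl

  0≤-resp-≈ : ∀ {x y} → x ≈ y → 0# ≤ x → 0# ≤ y
  0≤-resp-≈ = ≤-respʳ-≈

  0<-resp-≈ : ∀ {x y} → x ≈ y → 0# < x → 0# < y
  0<-resp-≈ x≈y (0≤x , 0≉x) = ≤-respʳ-≈ x≈y 0≤x , λ 0≈y → 0≉x (trans 0≈y (sym x≈y))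

  ≤-intro : ∀ {x y d} → d ≈ y - x → 0# ≤ d → x ≤ y
  ≤-intro {x} {y} {d} d≈y-x 0≤d = ≤-respˡ-≈ (+-identityˡ x)
    (≤-respʳ-≈ (trans (+-congʳ d≈y-x) (solve 2 (λ x y → (y :- x) :+ x := y) refl x y)) (+-monoˡ-≤ x 0≤d))

  ≤-elim : ∀ {x y} → x ≤ y → 0# ≤ y - x
  ≤-elim {x} {y} x≤y = ≤-respˡ-≈ (-‿inverseʳ x) (+-monoˡ-≤ (- x) x≤y)

  <-intro : ∀ {x y d} → d ≈ y - x → 0# < d → x < y
  <-intro {x} {y} {d} d≈y-x (0≤d , 0≉d) =
    ≤-intro d≈y-x 0≤d , λ x≈y → 0≉d (sym (trans d≈y-x (trans (+-congʳ (sym x≈y)) (-‿inverseʳ x))))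

  <-elim : ∀ {x y} → x < y → 0# < y - x
  <-elim {x} {y} (x≤y , x≉y) = ≤-elim x≤y , λ 0≈y-x → x≉y
    (trans (sym (+-identityˡ x)) (trans (+-congʳ 0≈y-x) (solve 2 (λ x y → (y :- x) :+ x := y) refl x y)))

  <⇒≤ : ∀ {x y} → x < y → x ≤ y
  <⇒≤ = proj₁

  <⇒≱ : ∀ {x y} → x < y → ¬ (y ≤ x)
  <⇒≱ (x≤y , x≉y) y≤x = x≉y (≤-antisym x≤y y≤x)

  -- `≤-total` may return either side for equal arguments; deciding `x ≤ y` first makes the second
  -- alternative strict.
  ≤-<-connex : ∀ x y → x ≤ y ⊎ y < x
  ≤-<-connex x y with em {P = x ≤ y}
  ... | yes x≤y = inj₁ x≤y
  ... | no x≰y with ≤-total x y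
  ...   | inj₁ x≤y = contradiction x≤y x≰y
  ...   | inj₂ y≤x = inj₂ (y≤x , λ y≈x → x≰y (≤-reflexive (sym y≈x)))

  ≮⇒≥ : ∀ {x y} → ¬ (x < y) → y ≤ x
  ≮⇒≥ {x} {y} x≮y with ≤-<-connex y x
  ... | inj₁ y≤x = y≤x
  ... | inj₂ x<y = contradiction x<y x≮y

  -- Signs of sums, products and inverses

  0≤x+y : ∀ {x y} → 0# ≤ x → 0# ≤ y → 0# ≤ x + y
  0≤x+y {x} {y} 0≤x 0≤y = ≤-trans 0≤y (≤-intro (solve 2 (λ x y → x := (x :+ y) :- y) refl x y) 0≤x)

  0<x+y : ∀ {x y} → 0# < x → 0# ≤ y → 0# < x + y
  0<x+y {x} {y} (0≤x , 0≉x) 0≤y = 0≤x+y 0≤x 0≤y , λ 0≈x+y → 0≉x (≤-antisym 0≤x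
    (≤-intro (trans (solve 2 (λ x y → y := (x :+ y) :- x) refl x y) (+-congʳ (sym 0≈x+y))) 0≤y))

  <-≤-trans : ∀ {x y z} → x < y → y ≤ z → x < z
  <-≤-trans {x} {y} {z} x<y y≤z = <-intro (solve 3 (λ x y z → (y :- x) :+ (z :- y) := z :- x) refl x y z)
    (0<x+y (<-elim x<y) (≤-elim y≤z))

  ≤-<-trans : ∀ {x y z} → x ≤ y → y < z → x < z
  ≤-<-trans {x} {y} {z} x≤y y<z = <-intro (solve 3 (λ x y z → (z :- y) :+ (y :- x) := z :- x) refl x y z)
    (0<x+y (<-elim y<z) (≤-elim x≤y))

  0≤x*y : ∀ {x y} → 0# ≤ x → 0# ≤ y → 0# ≤ x * y
  0≤x*y = *-nonNeg

  0≤-x : ∀ {x} → x ≤ 0# → 0# ≤ - x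
  0≤-x {x} x≤0 = 0≤-resp-≈ (+-identityˡ _) (≤-elim x≤0)

  x≤0 : ∀ {x} → 0# ≤ - x → x ≤ 0#
  x≤0 = ≤-intro (sym (+-identityˡ _))

  0<-x : ∀ {x} → x < 0# → 0# < - x
  0<-x {x} x<0 = 0<-resp-≈ (+-identityˡ _) (<-elim x<0)

  0≤x*x : ∀ x → 0# ≤ x * x
  0≤x*x x with ≤-total 0# x
  ... | inj₁ 0≤x = 0≤x*y 0≤x 0≤x
  ... | inj₂ x≤0 = 0≤-resp-≈ (solve 1 (λ x → :- x :* :- x := x :* x) refl x) (0≤x*y (0≤-x x≤0) (0≤-x x≤0))

  0<1 : 0# < 1#
  0<1 = 0≤-resp-≈ (*-identityˡ 1#) (0≤x*x 1#) , 0≉1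

  0<⇒≉0 : ∀ {x} → 0# < x → ¬ (x ≈ 0#)
  0<⇒≉0 (_ , 0≉x) x≈0 = 0≉x (sym x≈0)

  ⁻¹-cancelˡ : ∀ {a} b → ¬ (a ≈ 0#) → a ⁻¹ * (a * b) ≈ b
  ⁻¹-cancelˡ {a} b a≉0 = trans (solve 3 (λ i a b → i :* (a :* b) := (a :* i) :* b) refl (a ⁻¹) a b)
    (trans (*-congʳ (⁻¹-inverseʳ a≉0)) (*-identityˡ b))

  *-cancelˡ-≈0 : ∀ {a b} → ¬ (a ≈ 0#) → a * b ≈ 0# → b ≈ 0#
  *-cancelˡ-≈0 {a} {b} a≉0 ab≈0 = trans (sym (⁻¹-cancelˡ b a≉0)) (trans (*-congˡ ab≈0) (zeroʳ _))

  x*y≉0 : ∀ {x y} → ¬ (x ≈ 0#) → ¬ (y ≈ 0#) → ¬ (x * y ≈ 0#)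
  x*y≉0 x≉0 y≉0 = y≉0 ∘ *-cancelˡ-≈0 x≉0

  0<x*y : ∀ {x y} → 0# < x → 0# < y → 0# < x * y
  0<x*y 0<x 0<y = 0≤x*y (<⇒≤ 0<x) (<⇒≤ 0<y) , λ 0≈xy → x*y≉0 (0<⇒≉0 0<x) (0<⇒≉0 0<y) (sym 0≈xy)

  0<x*x : ∀ {x} → ¬ (x ≈ 0#) → 0# < x * x
  0<x*x {x} x≉0 = 0≤x*x x , x*y≉0 x≉0 x≉0 ∘ sym

  0≤-cancelˡ : ∀ {a b} → 0# < a → 0# ≤ a * b → 0# ≤ b
  0≤-cancelˡ {a} {b} 0<a 0≤ab = ≮⇒≥ λ b<0 → <⇒≱ (0<x*y 0<a (0<-x b<0))
    (≤-intro (solve 2 (λ a b → a :* b := con (+ 0) :- a :* :- b) refl a b) 0≤ab)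

  0<⁻¹ : ∀ {x} → 0# < x → 0# < x ⁻¹
  0<⁻¹ {x} 0<x = 0≤-cancelˡ 0<x (0≤-resp-≈ (sym x*x⁻¹≈1) (<⇒≤ 0<1)) ,
    λ 0≈x⁻¹ → 0≉1 (trans (sym (zeroʳ x)) (trans (*-congˡ 0≈x⁻¹) x*x⁻¹≈1))
    where x*x⁻¹≈1 = ⁻¹-inverseʳ (0<⇒≉0 0<x)

  0<-cancelˡ : ∀ {a b} → 0# < a → 0# < a * b → 0# < b
  0<-cancelˡ {a} {b} 0<a 0<ab = 0<-resp-≈ (⁻¹-cancelˡ b (0<⇒≉0 0<a)) (0<x*y (0<⁻¹ 0<a) 0<ab)

  *-cancelˡ : ∀ {a b c} → ¬ (a ≈ 0#) → a * b ≈ a * c → b ≈ c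
  *-cancelˡ a≉0 ab≈ac = trans (sym (⁻¹-cancelˡ _ a≉0)) (trans (*-congˡ ab≈ac) (⁻¹-cancelˡ _ a≉0))

  -- `(d b)(d u) = d² (b u)`. Two quantities that point in the direction of `d` are multiplied
  -- without asking which direction this is; both end points of the interval are later treated at
  -- once in this way.
  sameSign : ∀ {d b u} → ¬ (d ≈ 0#) → 0# ≤ d * b → 0# ≤ d * u → 0# ≤ b * u
  sameSign {d} {b} {u} d≉0 0≤db 0≤du = 0≤-cancelˡ (0<x*x d≉0)
    (0≤-resp-≈ (solve 3 (λ d b u → (d :* b) :* (d :* u) := (d :* d) :* (b :* u)) refl d b u) (0≤x*y 0≤db 0≤du))

  -- The products `(B - c)(d + M)` and `(c + B)(M - d)` of slacks add up to `2 (B M - c d)`, which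
  -- avoids a distinction of the signs of `c` and `d`.
  *-bound : ∀ {B M c d} → - B ≤ c → c ≤ B → - M ≤ d → d ≤ M → c * d ≤ B * M
  *-bound {B} {M} {c} {d} -B≤c c≤B -M≤d d≤M =
    ≤-intro refl (0≤-cancelˡ (0<x+y 0<1 (<⇒≤ 0<1)) (0≤-resp-≈
      (solve 4 (λ B M c d → (B :- c) :* (d :- :- M) :+ (c :- :- B) :* (M :- d)
        := (con (+ 1) :+ con (+ 1)) :* (B :* M :- c :* d)) refl B M c d)
      (0≤x+y (0≤x*y (≤-elim c≤B) (≤-elim -M≤d)) (0≤x*y (≤-elim -B≤c) (≤-elim d≤M)))))

  absBound : ∀ c → ∃[ B ] 0# < B × - B ≤ c × c ≤ B
  absBound c with ≤-total 0# c
  ... | inj₁ 0≤c = 1# + c , 0<x+y 0<1 0≤c ,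
      ≤-intro (solve 1 (λ c → (con (+ 1) :+ c) :+ c := c :- :- (con (+ 1) :+ c)) refl c) (0≤x+y (0≤x+y (<⇒≤ 0<1) 0≤c) 0≤c) ,
      ≤-intro (solve 1 (λ c → con (+ 1) := (con (+ 1) :+ c) :- c) refl c) (<⇒≤ 0<1)
  ... | inj₂ c≤0 = 1# - c , 0<x+y 0<1 0≤-c ,
      ≤-intro (solve 1 (λ c → con (+ 1) := c :- :- (con (+ 1) :- c)) refl c) (<⇒≤ 0<1) ,
      ≤-intro (solve 1 (λ c → (con (+ 1) :+ :- c) :+ :- c := (con (+ 1) :- c) :- c) refl c) (0≤x+y (0≤x+y (<⇒≤ 0<1) 0≤-c) 0≤-c)
    where 0≤-c = 0≤-x c≤0

  -- The witness satisfies `1/ε = a/b + c/d`, so it lies below both `b/a` and `d/c` and can stand in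
  -- for their minimum.
  commonScale : ∀ {a b c d} → 0# < a → 0# < b → 0# < c → 0# < d → ∃[ ε ] 0# < ε × ε * a ≤ b × ε * c ≤ d
  commonScale {a} {b} {c} {d} 0<a 0<b 0<c 0<d =
    ε , 0<x*y 0<bd 0<e⁻¹ , ≤-intro eqb (<⇒≤ (0<x*y (0<x*y (0<x*y 0<b 0<b) 0<c) 0<e⁻¹)) , ≤-intro eqd (<⇒≤ (0<x*y (0<x*y (0<x*y 0<d 0<d) 0<a) 0<e⁻¹))
    where
    0<bd = 0<x*y 0<b 0<d
    e = b * c + d * a
    0<e : 0# < e
    0<e = 0<x+y (0<x*y 0<b 0<c) (<⇒≤ (0<x*y 0<d 0<a))
    0<e⁻¹ = 0<⁻¹ 0<e
    ε = b * d * e ⁻¹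
    e*e⁻¹ = ⁻¹-inverseʳ (0<⇒≉0 0<e)
    eqb : b * b * c * e ⁻¹ ≈ b - ε * a
    eqb = trans (solve 5 (λ a b c d i → b :* b :* c :* i := b :* ((b :* c :+ d :* a) :* i) :- b :* d :* i :* a) refl a b c d (e ⁻¹))
      (+-congʳ (trans (*-congˡ e*e⁻¹) (*-identityʳ b)))
    eqd : d * d * a * e ⁻¹ ≈ d - ε * c
    eqd = trans (solve 5 (λ a b c d i → d :* d :* a :* i := d :* ((b :* c :+ d :* a) :* i) :- b :* d :* i :* c) refl a b c d (e ⁻¹))
      (+-congʳ (trans (*-congˡ e*e⁻¹) (*-identityʳ d)))

  x+y≈0⇒x≈0 : ∀ {x y} → 0# ≤ x → 0# ≤ y → x + y ≈ 0# → x ≈ 0#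
  x+y≈0⇒x≈0 {x} {y} 0≤x 0≤y x+y≈0 = ≤-antisym
    (≤-intro (trans (solve 2 (λ x y → y := (x :+ y) :- x) refl x y) (+-congʳ x+y≈0)) 0≤y) 0≤x

  x+y≈0⇒y≈0 : ∀ {x y} → 0# ≤ x → 0# ≤ y → x + y ≈ 0# → y ≈ 0#
  x+y≈0⇒y≈0 0≤x 0≤y x+y≈0 = x+y≈0⇒x≈0 0≤y 0≤x (trans (+-comm _ _) x+y≈0)

  -- Finite sums; opaque, so that unification can read off the summand.

  opaque

    ∑ : ∀ {n} → Vector ℝ n → ℝ
    ∑ = sum

    ∑≈sum : ∀ {n} (v : Vector ℝ n) → ∑ v ≈ sum v
    ∑≈sum v = refl

    ∑-suc : ∀ {n} (v : Vector ℝ (suc n)) → ∑ v ≈ v zero + ∑ (v ∘ suc)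
    ∑-suc v = refl

    ∑-cong : ∀ {n} {u v : Vector ℝ n} → (∀ k → u k ≈ v k) → ∑ u ≈ ∑ v
    ∑-cong = sum-cong-≋

    ∑-+ : ∀ {n} (u v : Vector ℝ n) → ∑ (λ k → u k + v k) ≈ ∑ u + ∑ v
    ∑-+ = ∑-distrib-+

    ∑-*ˡ : ∀ {n} a (v : Vector ℝ n) → ∑ (λ k → a * v k) ≈ a * ∑ v
    ∑-*ˡ a v = sym (*-distribˡ-sum a v)

    ∑-swap : ∀ {m n} (v : Fin m → Vector ℝ n) → ∑ (λ i → ∑ (v i)) ≈ ∑ (λ j → ∑ (λ i → v i j))
    ∑-swap = ∑-comm

    0≤∑ : ∀ {n} (v : Vector ℝ n) → (∀ i → 0# ≤ v i) → 0# ≤ ∑ v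
    0≤∑ {zero} v 0≤v = ≤-refl
    0≤∑ {suc n} v 0≤v = 0≤x+y (0≤v zero) (0≤∑ (v ∘ suc) (0≤v ∘ suc))

    ∑-mono : ∀ {n} (u v : Vector ℝ n) → (∀ i → u i ≤ v i) → ∑ u ≤ ∑ v
    ∑-mono {zero} u v u≤v = ≤-refl
    ∑-mono {suc n} u v u≤v = ≤-intro (solve 4 (λ a b c d → (c :- a) :+ (d :- b) := (c :+ d) :- (a :+ b)) refl _ _ _ _)
      (0≤x+y (≤-elim (u≤v zero)) (≤-elim (∑-mono (u ∘ suc) (v ∘ suc) (u≤v ∘ suc))))

    ∑≈0⇒≈0 : ∀ {n} (v : Vector ℝ n) → (∀ i → 0# ≤ v i) → ∑ v ≈ 0# → ∀ i → v i ≈ 0#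
    ∑≈0⇒≈0 {suc n} v 0≤v v≈0 zero = x+y≈0⇒x≈0 (0≤v zero) (0≤∑ (v ∘ suc) (0≤v ∘ suc)) v≈0
    ∑≈0⇒≈0 {suc n} v 0≤v v≈0 (suc i) = ∑≈0⇒≈0 (v ∘ suc) (0≤v ∘ suc)
      (x+y≈0⇒y≈0 (0≤v zero) (0≤∑ (v ∘ suc) (0≤v ∘ suc)) v≈0) i

    ∑-zero : ∀ {n} (v : Vector ℝ n) → (∀ i → v i ≈ 0#) → ∑ v ≈ 0#
    ∑-zero {n} v v≈0 = trans (∑-cong v≈0) (sum-replicate-zero n)

    ∑-single : ∀ {n} (v : Vector ℝ n) k → (∀ i → ¬ (i ≡ k) → v i ≈ 0#) → ∑ v ≈ v k
    ∑-single v zero v≈0 = trans (+-congˡ (∑-zero (v ∘ suc) λ i → v≈0 (suc i) λ ())) (+-identityʳ _)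
    ∑-single v (suc k) v≈0 = trans (+-cong (v≈0 zero λ ()) (∑-single (v ∘ suc) k λ i i≢k → v≈0 (suc i) (i≢k ∘ suc-injective))) (+-identityˡ _)

  ∑-‿- : ∀ {n} (u v : Vector ℝ n) → ∑ (λ k → u k - v k) ≈ ∑ u - ∑ v
  ∑-‿- u v = trans (∑-+ u (λ k → - v k)) (+-congˡ (trans (∑-cong λ k → solve 1 (λ v → :- v := :- con (+ 1) :* v) refl (v k))
    (trans (∑-*ˡ (- 1#) v) (solve 1 (λ v → :- con (+ 1) :* v := :- v) refl (∑ v)))))

  ∑-*ʳ : ∀ {n} a (v : Vector ℝ n) → ∑ (λ k → v k * a) ≈ ∑ v * a
  ∑-*ʳ a v = trans (∑-cong λ k → *-comm (v k) a) (trans (∑-*ˡ a v) (*-comm a _))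

  open import Algebra.Properties.CommutativeSemiring.Exp commutativeSemiring public using (^-distrib-*; ^-congˡ)

  -- Limits of increasing sequences

  2# : ℝ
  2# = 1# + 1#

  0<2 : 0# < 2#
  0<2 = 0<x+y 0<1 (<⇒≤ 0<1)

  -1≤1 : - 1# ≤ 1#
  -1≤1 = ≤-intro (solve 0 (con (+ 1) :+ con (+ 1) := con (+ 1) :- :- con (+ 1)) refl) (<⇒≤ 0<2)

  half : ∀ {d} → 0# < d → ∃[ ε ] 0# < ε × ε + ε ≈ d
  half {d} 0<d = d * 2# ⁻¹ , 0<x*y 0<d (0<⁻¹ 0<2) ,
    trans (solve 2 (λ d h → d :* h :+ d :* h := d :* ((con (+ 1) :+ con (+ 1)) :* h)) refl d (2# ⁻¹))
      (trans (*-congˡ (⁻¹-inverseʳ (0<⇒≉0 0<2))) (*-identityʳ d))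

  ⟶-unique-≤ : ∀ {a l l′} → a ⟶ l → a ⟶ l′ → l ≤ l′
  ⟶-unique-≤ {a} {l} {l′} a⟶l a⟶l′ = ≮⇒≥ λ l′<l →
    let ε , 0<ε , ε+ε≈d = half (<-elim l′<l)
        N , near = a⟶l ε 0<ε
        N′ , near′ = a⟶l′ ε 0<ε
        n = N ℕ.⊔ N′
        -ε<x , _ = near n (ℕ.m≤m⊔n N N′)
        _ , x′<ε = near′ n (ℕ.m≤n⊔m N N′)
    in <⇒≱ (0<x+y (<-elim -ε<x) (<⇒≤ (<-elim x′<ε)))
         (≤-reflexive (trans (solve 4 (λ a l l′ ε → (a :- l) :- :- ε :+ (ε :- (a :- l′)) := (ε :+ ε) :- (l :- l′)) refl (a n) l l′ ε)
           (trans (+-congʳ ε+ε≈d) (-‿inverseʳ _))))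

  lim-unique : ∀ {a l} → a ⟶ l → lim a ≈ l
  lim-unique {a} {l} a⟶l = ≤-antisym
    (sup-least {P = a ⟶_} (l , a⟶l) λ a⟶l′ → ⟶-unique-≤ a⟶l′ a⟶l)
    (sup-upper {P = a ⟶_} (l , a⟶l) (l , λ a⟶l′ → ⟶-unique-≤ a⟶l′ a⟶l) a⟶l)

  -- Monotone convergence from index `N` on: Euler's sequence is only known to increase once its
  -- base is positive.
  module IncreasingLimit (a : ℕ → ℝ) (N : ℕ) (B : ℝ)
    (mono : ∀ {m n} → N ℕ.≤ m → m ℕ.≤ n → a m ≤ a n)
    (bounded : ∀ {n} → N ℕ.≤ n → a n ≤ B) where

    private
      Values : Pred ℝ 0ℓ
      Values y = ∃[ n ] N ℕ.≤ n × y ≈ a n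

      value : Satisfiable Values
      value = a N , N , ℕ.≤-refl , refl

      l : ℝ
      l = sup Values

      a≤l : ∀ {n} → N ℕ.≤ n → a n ≤ l
      a≤l {n} N≤n = sup-upper {Values} value (B , λ (n , N≤n , y≈) → ≤-respˡ-≈ (sym y≈) (bounded N≤n)) (n , N≤n , refl)

      a⟶l : a ⟶ l
      a⟶l ε 0<ε with em {P = ∃[ n ] N ℕ.≤ n × (- ε < a n - l)}
      ... | yes (n₀ , N≤n₀ , near) = n₀ , λ n n₀≤n →
          <-≤-trans near (≤-intro (solve 3 (λ a b l → a :- b := (a :- l) :- (b :- l)) refl (a n) (a n₀) l) (≤-elim (mono N≤n₀ n₀≤n))) ,
          <-intro (solve 3 (λ e l a → e :+ (l :- a) := e :- (a :- l)) refl ε l (a n)) (0<x+y 0<ε (≤-elim (a≤l (ℕ.≤-trans N≤n₀ n₀≤n))))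
      ... | no ¬near = contradiction
          (sup-least {Values} {l - ε} value λ (n , N≤n , y≈) → ≤-respˡ-≈ (sym y≈)
            (≤-intro (solve 3 (λ a l e → (:- e) :- (a :- l) := l :- e :- a) refl (a n) l ε) (≤-elim (≮⇒≥ λ near → ¬near (n , N≤n , near)))))
          (<⇒≱ (<-intro (solve 2 (λ l e → e := l :- (l :- e)) refl l ε) 0<ε))

    lim-upper : ∀ {n} → N ℕ.≤ n → a n ≤ lim a
    lim-upper N≤n = ≤-respʳ-≈ (sym (lim-unique a⟶l)) (a≤l N≤n)

    lim-least : ∀ {u} M → (∀ {n} → M ℕ.≤ n → a n ≤ u) → lim a ≤ u
    lim-least M a≤u = ≤-respˡ-≈ (sym (lim-unique a⟶l)) (sup-least {Values} value λ (n , N≤n , y≈) →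
      ≤-respˡ-≈ (sym y≈) (≤-trans (mono N≤n (ℕ.m≤m⊔n n M)) (a≤u (ℕ.m≤n⊔m n M))))

  ν : ℕ → ℝ
  ν n = suc n · 1#

  0≤n·1 : ∀ n → 0# ≤ n · 1#
  0≤n·1 zero = ≤-refl
  0≤n·1 (suc n) = 0≤x+y (<⇒≤ 0<1) (0≤n·1 n)

  0<ν : ∀ n → 0# < ν n
  0<ν n = 0<x+y 0<1 (0≤n·1 n)

  ν-mono : ∀ {m n} → m ℕ.≤ n → ν m ≤ ν n
  ν-mono {n = n} ℕ.z≤n = ≤-intro (solve 1 (λ x → x := (con (+ 1) :+ x) :- (con (+ 1) :+ con (+ 0))) refl _) (0≤n·1 n)
  ν-mono (ℕ.s≤s m≤n) = ≤-intro (solve 2 (λ x y → y :- x := (con (+ 1) :+ y) :- (con (+ 1) :+ x)) refl _ _) (≤-elim (ν-mono m≤n))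

  -- If the `ν n` were bounded, each `ν (suc n)` would be at most their supremum `s`, and `s - 1#`
  -- would be a smaller upper bound.
  archimedean : ∀ x → ∃[ N ] ∀ {n} → N ℕ.≤ n → x < ν n
  archimedean x with em {P = ∃[ n ] x < ν n}
  ... | yes (N , x<νN) = N , λ {n} N≤n → <-intro (solve 3 (λ a b c → (b :- a) :+ (c :- b) := c :- a) refl x (ν N) (ν n))
      (0<x+y (<-elim x<νN) (≤-elim (ν-mono N≤n)))
  ... | no ¬∃ = contradiction
      (sup-least {P} {s - 1#} (ν 0 , 0 , refl) λ {y} (n , y≈) → ≤-respˡ-≈ (sym y≈)
        (≤-intro (solve 2 (λ s n → s :- (con (+ 1) :+ n) := s :- con (+ 1) :- n) refl s (ν n)) (≤-elim (ν≤s (suc n)))))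
      (<⇒≱ (<-intro (solve 1 (λ s → con (+ 1) := s :- (s :- con (+ 1))) refl s) 0<1))
    where
    P : Pred ℝ 0ℓ
    P y = ∃[ n ] y ≈ ν n
    s = sup P
    ν≤s : ∀ n → ν n ≤ s
    ν≤s n = sup-upper {P} (ν 0 , 0 , refl) (x , λ {y} (n , y≈) → ≤-respˡ-≈ (sym y≈) (≮⇒≥ λ x<ν → ¬∃ (n , x<ν))) (n , refl)

  -- Powers

  0<^ : ∀ {x} n → 0# < x → 0# < x ^ n
  0<^ zero 0<x = 0<1
  0<^ (suc n) 0<x = 0<x*y 0<x (0<^ n 0<x)

  0≤^ : ∀ {x} n → 0# ≤ x → 0# ≤ x ^ n
  0≤^ zero 0≤x = <⇒≤ 0<1
  0≤^ (suc n) 0≤x = 0≤x*y 0≤x (0≤^ n 0≤x)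

  *-mono-≤ : ∀ {x y u v} → 0# ≤ x → x ≤ y → 0# ≤ u → u ≤ v → x * u ≤ y * v
  *-mono-≤ {x} {y} {u} {v} 0≤x x≤y 0≤u u≤v = ≤-intro
    (solve 4 (λ x y u v → (y :- x) :* v :+ x :* (v :- u) := y :* v :- x :* u) refl x y u v)
    (0≤x+y (0≤x*y (≤-elim x≤y) (≤-trans 0≤u u≤v)) (0≤x*y 0≤x (≤-elim u≤v)))

  ^-mono-≤ : ∀ {x y} n → 0# ≤ x → x ≤ y → x ^ n ≤ y ^ n
  ^-mono-≤ zero 0≤x x≤y = ≤-refl
  ^-mono-≤ (suc n) 0≤x x≤y = *-mono-≤ 0≤x x≤y (0≤^ n 0≤x) (^-mono-≤ n 0≤x x≤y)

  1^n≈1 : ∀ n → 1# ^ n ≈ 1#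
  1^n≈1 zero = refl
  1^n≈1 (suc n) = trans (*-identityˡ _) (1^n≈1 n)

  -- Convexity of powers by induction: `y` times the previous gap plus `ν n * p ^ n * (y - p)²` is
  -- the next gap. The tangent at 1 is Bernoulli's inequality.
  ^-tangent : ∀ n {y p} → 0# ≤ y → 0# ≤ p → 0# ≤ y ^ suc n - (p ^ suc n + ν n * p ^ n * (y - p))
  ^-tangent zero {y} {p} 0≤y 0≤p = ≤-reflexive
    (solve 2 (λ y p → con (+ 0) := y :* con (+ 1) :- (p :* con (+ 1) :+ (con (+ 1) :+ con (+ 0)) :* con (+ 1) :* (y :- p))) refl y p)
  ^-tangent (suc n) {y} {p} 0≤y 0≤p = 0≤-resp-≈
    (solve 5 (λ y p Y P ν → y :* (y :* Y :- (p :* P :+ ν :* P :* (y :- p))) :+ ν :* P :* ((y :- p) :* (y :- p))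
      := y :* (y :* Y) :- (p :* (p :* P) :+ (con (+ 1) :+ ν) :* (p :* P) :* (y :- p))) refl y p (y ^ n) (p ^ n) (ν n))
    (0≤x+y (0≤x*y 0≤y (^-tangent n 0≤y 0≤p)) (0≤x*y (0≤x*y (<⇒≤ (0<ν n)) (0≤^ n 0≤p)) (0≤x*x (y - p))))

  bernoulli : ∀ n {y} → 0# ≤ y → 1# + ν n * (y - 1#) ≤ y ^ suc n
  bernoulli n {y} 0≤y = ≤-intro (+-congˡ (-‿cong (+-cong (1^n≈1 (suc n)) (*-congʳ (trans (*-congˡ (1^n≈1 n)) (*-identityʳ _))))))
    (^-tangent n 0≤y (<⇒≤ 0<1))

  -- The compound interest sequence and its limit

  base : ℝ → ℕ → ℝ
  base x n = 1# + x / ν n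

  euler : ℝ → ℕ → ℝ
  euler x n = base x n ^ suc n

  ν*base : ∀ x n → ν n * base x n ≈ ν n + x
  ν*base x n = trans (solve 3 (λ ν x i → ν :* (con (+ 1) :+ x :* i) := ν :+ x :* (ν :* i)) refl (ν n) x (ν n ⁻¹))
    (+-congˡ (trans (*-congˡ (⁻¹-inverseʳ (0<⇒≉0 (0<ν n)))) (*-identityʳ x)))

  0<base : ∀ {x n} → - x < ν n → 0# < base x n
  0<base {x} {n} -x<ν = 0<-cancelˡ (0<ν n) (0<-resp-≈
    (trans (solve 2 (λ ν x → ν :- :- x := ν :+ x) refl (ν n) x) (sym (ν*base x n))) (<-elim -x<ν))

  -- Take the tangent to the power with exponent `n + 2` at `p = base x n` and evaluate it at
  -- `y = base x (suc n)`. As `ν (suc n) * (y - p) = 1 - p`, its value is `p ^ (n + 2) + p ^ (n + 1)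
  -- * (1 - p) = p ^ (n + 1)`, the previous term.
  euler-step : ∀ {x} n → - x < ν n → euler x n ≤ euler x (suc n)
  euler-step {x} n -x<ν = ≤-intro eq (^-tangent (suc n) (<⇒≤ (0<base {x} {suc n} (<-≤-trans -x<ν (ν-mono (ℕ.n≤1+n n))))) (<⇒≤ (0<base {x} {n} -x<ν)))
    where
    y = base x (suc n)
    p = base x n
    key : ν (suc n) * (y - p) ≈ 1# - p
    key = trans (solve 3 (λ ν y p → (con (+ 1) :+ ν) :* (y :- p) := (con (+ 1) :+ ν) :* y :- ν :* p :- p) refl (ν n) y p)
      (trans (+-congʳ (+-cong (ν*base x (suc n)) (-‿cong (ν*base x n))))
        (solve 3 (λ ν x p → (con (+ 1) :+ ν) :+ x :- (ν :+ x) :- p := con (+ 1) :- p) refl (ν n) x p))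
    eq : y ^ suc (suc n) - (p ^ suc (suc n) + ν (suc n) * p ^ suc n * (y - p)) ≈ y ^ suc (suc n) - p ^ suc n
    eq = +-congˡ (-‿cong (trans
      (solve 4 (λ P ν d p → p :* P :+ ν :* P :* d := p :* P :+ P :* (ν :* d)) refl (p ^ suc n) (ν (suc n)) (y - p) p)
      (trans (+-congˡ (*-congˡ key)) (solve 2 (λ P p → p :* P :+ P :* (con (+ 1) :- p) := P) refl (p ^ suc n) p))))

  euler-mono : ∀ {x m n} → - x < ν m → m ℕ.≤ n → euler x m ≤ euler x n
  euler-mono {x} {m} -x<ν m≤n = go (ℕ.≤⇒≤′ m≤n)
    where
    go : ∀ {n} → m ℕ.≤′ n → euler x m ≤ euler x n
    go ℕ.≤′-refl = ≤-refl
    go (ℕ.≤′-step {n = n} m≤′n) = ≤-trans (go m≤′n) (euler-step n (<-≤-trans -x<ν (ν-mono (ℕ.≤′⇒≤ m≤′n))))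

  1+x≤euler : ∀ {x n} → - x < ν n → 1# + x ≤ euler x n
  1+x≤euler {x} {n} -x<ν = ≤-respˡ-≈ (trans
    (solve 2 (λ ν b → con (+ 1) :+ ν :* (b :- con (+ 1)) := con (+ 1) :+ (ν :* b :- ν)) refl (ν n) (base x n))
    (+-congˡ (trans (+-congʳ (ν*base x n)) (solve 2 (λ ν x → ν :+ x :- ν := x) refl (ν n) x))))
    (bernoulli n (<⇒≤ (0<base {x} {n} -x<ν)))

  neg-neg : ∀ {x} → - (- x) ≈ x
  neg-neg {x} = solve 1 (λ x → :- (:- x) := x) refl x

  -- The product of the two bases is `1 - (x/ν)²`. Since the sequence for `- x` eventually
  -- increases, this bounds the sequence for `x` by the inverse of a fixed term `κ`.
  euler-*-neg≤1 : ∀ {x n} → - x < ν n → x < ν n → euler x n * euler (- x) n ≤ 1#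
  euler-*-neg≤1 {x} {n} -x<ν x<ν = ≤-respˡ-≈ (^-distrib-* (base x n) (base (- x) n) (suc n))
    (≤-respʳ-≈ (1^n≈1 (suc n)) (^-mono-≤ (suc n)
      (0≤x*y (<⇒≤ (0<base {x} {n} -x<ν)) (<⇒≤ (0<base { - x} {n} (<-resp-≈ (sym neg-neg) refl x<ν))))
      (≤-intro (solve 2 (λ x i → (x :* i) :* (x :* i) := con (+ 1) :- (con (+ 1) :+ x :* i) :* (con (+ 1) :+ :- x :* i)) refl x (ν n ⁻¹))
        (0≤x*x (x * ν n ⁻¹)))))

  module EulerLimit (x : ℝ) where
    private
      N = proj₁ (archimedean (- x)) ℕ.⊔ proj₁ (archimedean x)

      -x<ν : ∀ {n} → N ℕ.≤ n → - x < ν n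
      -x<ν N≤n = proj₂ (archimedean (- x)) (ℕ.≤-trans (ℕ.m≤m⊔n _ _) N≤n)

      x<ν : ∀ {n} → N ℕ.≤ n → x < ν n
      x<ν N≤n = proj₂ (archimedean x) (ℕ.≤-trans (ℕ.m≤n⊔m _ _) N≤n)

      κ = euler (- x) N

      0<κ : 0# < κ
      0<κ = 0<^ (suc N) (0<base { - x} {N} (<-resp-≈ (sym neg-neg) refl (x<ν ℕ.≤-refl)))

      bounded : ∀ {n} → N ℕ.≤ n → euler x n ≤ κ ⁻¹
      bounded {n} N≤n = ≤-intro (trans (solve 3 (λ i k e → i :* (con (+ 1) :- e :* k) := i :- i :* (k :* e)) refl (κ ⁻¹) κ (euler x n))
        (+-congˡ (-‿cong (⁻¹-cancelˡ (euler x n) (0<⇒≉0 0<κ)))))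
        (0≤x*y (<⇒≤ (0<⁻¹ 0<κ)) (≤-elim (≤-trans
          (*-mono-≤ (0≤^ (suc n) (<⇒≤ (0<base {x} {n} (-x<ν N≤n)))) ≤-refl (<⇒≤ 0<κ)
            (euler-mono { - x} (<-resp-≈ (sym neg-neg) refl (x<ν ℕ.≤-refl)) N≤n))
          (euler-*-neg≤1 {x} {n} (-x<ν N≤n) (x<ν N≤n)))))

      open IncreasingLimit (euler x) N (κ ⁻¹) (λ N≤m → euler-mono (-x<ν N≤m)) bounded

    euler≤exp : ∀ n → - x < ν n → euler x n ≤ exp x
    euler≤exp n -x<νn = ≤-trans (euler-mono -x<νn (ℕ.m≤m⊔n n N)) (lim-upper (ℕ.m≤n⊔m n N))

    exp-least : ∀ {u} M → (∀ n → M ℕ.≤ n → - x < ν n → euler x n ≤ u) → exp x ≤ u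
    exp-least M euler≤u = lim-least (M ℕ.⊔ N) λ {n} h → euler≤u n (ℕ.m⊔n≤o⇒m≤o M N h) (-x<ν (ℕ.m⊔n≤o⇒n≤o M N h))

    large : ℕ
    large = N

    -x<ν-large : ∀ {n} → large ℕ.≤ n → - x < ν n
    -x<ν-large = -x<ν

  open EulerLimit using (euler≤exp; exp-least; large; -x<ν-large)

  0<euler : ∀ {x n} → - x < ν n → 0# < euler x n
  0<euler {x} {n} -x<ν = 0<^ (suc n) (0<base {x} {n} -x<ν)

  0<exp : ∀ x → 0# < exp x
  0<exp x = <-≤-trans (0<euler {x} {large x} (-x<ν-large x ℕ.≤-refl)) (euler≤exp x (large x) (-x<ν-large x ℕ.≤-refl))

  exp≉0 : ∀ x → ¬ (exp x ≈ 0#)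
  exp≉0 x = 0<⇒≉0 (0<exp x)

  1+x≤exp : ∀ x → 1# + x ≤ exp x
  1+x≤exp x = ≤-trans (1+x≤euler {x} {large x} (-x<ν-large x ℕ.≤-refl)) (euler≤exp x (large x) (-x<ν-large x ℕ.≤-refl))

  exp-mono-resp : ∀ {x y} → x ≈ y → exp x ≤ exp y
  exp-mono-resp {x} {y} x≈y = exp-least x 0 λ n _ -x<ν →
    ≤-respˡ-≈ (^-congˡ (suc n) (+-congˡ (*-congʳ (sym x≈y)))) (euler≤exp y n (<-resp-≈ (-‿cong x≈y) refl -x<ν))

  exp-cong : ∀ {x y} → x ≈ y → exp x ≈ exp y
  exp-cong x≈y = ≤-antisym (exp-mono-resp x≈y) (exp-mono-resp (sym x≈y))

  *-≤-cancel : ∀ {a b u} → 0# < a → b ≤ a ⁻¹ * u → a * b ≤ u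
  *-≤-cancel {a} {b} {u} 0<a b≤ = ≤-intro
    (trans (solve 4 (λ a b i u → a :* (i :* u :- b) := (a :* i) :* u :- a :* b) refl a b (a ⁻¹) u)
      (+-congʳ (trans (*-congʳ (⁻¹-inverseʳ (0<⇒≉0 0<a))) (*-identityˡ u))))
    (0≤x*y (<⇒≤ 0<a) (≤-elim b≤))

  ≤-⁻¹* : ∀ {a b u} → 0# < a → a * b ≤ u → b ≤ a ⁻¹ * u
  ≤-⁻¹* {a} {b} {u} 0<a ab≤u = ≤-intro
    (trans (solve 4 (λ a b i u → i :* (u :- a :* b) := i :* u :- i :* (a :* b)) refl a b (a ⁻¹) u)
      (+-congˡ (-‿cong (⁻¹-cancelˡ b (0<⇒≉0 0<a)))))
    (0≤x*y (<⇒≤ (0<⁻¹ 0<a)) (≤-elim ab≤u))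

  -- The two limits are taken one after the other, dividing by the other positive factor. The second
  -- index is kept at least as large as the first, so that monotonicity reduces the bound to equal
  -- indices.
  exp*exp-least : ∀ x y {u} M → (∀ n → M ℕ.≤ n → - x < ν n → - y < ν n → euler x n * euler y n ≤ u) → exp x * exp y ≤ u
  exp*exp-least x y {u} M euler≤u = ≤-respˡ-≈ (*-comm _ _) (*-≤-cancel (0<exp y) (exp-least x M λ n M≤n -x<ν →
    ≤-⁻¹* (0<exp y) (≤-respˡ-≈ (*-comm _ _) (*-≤-cancel (0<euler {x} {n} -x<ν) (exp-least y n λ m n≤m -y<ν →
      ≤-⁻¹* (0<euler {x} {n} -x<ν) (≤-trans
        (*-mono-≤ (<⇒≤ (0<euler {x} {n} -x<ν)) (euler-mono {x} {n} {m} -x<ν n≤m) (<⇒≤ (0<euler {y} {m} -y<ν)) ≤-refl)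
        (euler≤u m (ℕ.≤-trans M≤n n≤m) (<-≤-trans -x<ν (ν-mono n≤m)) -y<ν)))))))

  -- The product of the two sequences is `(1 - x²/ν²) ^ ν`, which is at most 1 and, by Bernoulli, at
  -- least `1 - x²/ν`. If the limit fell short of 1 by `d`, any `ν > x²/d` would give a
  -- contradiction.
  exp*exp-neg : ∀ x → exp x * exp (- x) ≈ 1#
  exp*exp-neg x = ≤-antisym
    (exp*exp-least x (- x) 0 λ n _ -x<ν x<ν → euler-*-neg≤1 {x} {n} -x<ν (<-resp-≈ neg-neg refl x<ν))
    (≮⇒≥ λ E<1 →
      let d = 1# - exp x * exp (- x)
          0<d = <-elim E<1
          N , ν> = archimedean (x * x / d)
          n = N ℕ.⊔ (large x ℕ.⊔ large (- x))
          -x<ν = -x<ν-large x (ℕ.≤-trans (ℕ.m≤m⊔n (large x) (large (- x))) (ℕ.m≤n⊔m N _))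
          x<ν = -x<ν-large (- x) (ℕ.≤-trans (ℕ.m≤n⊔m (large x) (large (- x))) (ℕ.m≤n⊔m N _))
          i = ν n ⁻¹
          ν*i = ⁻¹-inverseʳ (0<⇒≉0 (0<ν n))
          0≤bb = 0≤x*y (<⇒≤ (0<base {x} {n} -x<ν)) (<⇒≤ (0<base { - x} {n} x<ν))
          bern : 1# + ν n * (base x n * base (- x) n - 1#) ≤ exp x * exp (- x)
          bern = ≤-trans (≤-respʳ-≈ (^-distrib-* (base x n) (base (- x) n) (suc n)) (bernoulli n 0≤bb))
            (*-mono-≤ (<⇒≤ (0<euler {x} {n} -x<ν)) (euler≤exp x n -x<ν) (<⇒≤ (0<euler { - x} {n} x<ν)) (euler≤exp (- x) n x<ν))
          simplified : 1# + ν n * (base x n * base (- x) n - 1#) ≈ 1# - x * x * i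
          simplified = trans
            (solve 3 (λ x i ν → con (+ 1) :+ ν :* ((con (+ 1) :+ x :* i) :* (con (+ 1) :+ :- x :* i) :- con (+ 1)) := con (+ 1) :- (ν :* i) :* (x :* x :* i)) refl x i (ν n))
            (+-congˡ (-‿cong (trans (*-congʳ ν*i) (*-identityˡ _))))
          x²<dν : 0# < d * ν n - x * x
          x²<dν = 0<-resp-≈ (trans (solve 4 (λ d ν e j → d :* (ν :- e :* j) := d :* ν :- (d :* j) :* e) refl d (ν n) (x * x) (d ⁻¹))
            (+-congˡ (-‿cong (trans (*-congʳ (⁻¹-inverseʳ (0<⇒≉0 0<d))) (*-identityˡ _)))))
            (0<x*y 0<d (<-elim (ν> {n} (ℕ.m≤m⊔n N _))))
      in <⇒≱ (<-intro (trans (solve 5 (λ d ν e i p → i :* (d :* ν :- e) := (ν :* i) :* d :- e :* i) refl d (ν n) (x * x) i 1#)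
              (trans (+-congʳ (trans (*-congʳ ν*i) (*-identityˡ _)))
                (solve 2 (λ E s → (con (+ 1) :- E) :- s := (con (+ 1) :- s) :- E) refl (exp x * exp (- x)) (x * x * i))))
            (0<x*y (0<⁻¹ (0<ν n)) x²<dν))
          (≤-respˡ-≈ simplified bern))

  -- The gap `d` between `x + y` and `z` absorbs the mixed term: `(1 + x/ν)(1 + y/ν) ≤ 1 + z/ν` as
  -- soon as `x y / d < ν`.
  exp*exp≤exp : ∀ {x y z} → x + y < z → exp x * exp y ≤ exp z
  exp*exp≤exp {x} {y} {z} x+y<z = exp*exp-least x y (N ℕ.⊔ large z) λ n M≤n -x<ν -y<ν →
    let i = ν n ⁻¹
        ν*i = ⁻¹-inverseʳ (0<⇒≉0 (0<ν n))
        0<gap : 0# < d * ν n - x * y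
        0<gap = 0<-resp-≈ (trans (solve 4 (λ d ν e j → d :* (ν :- e :* j) := d :* ν :- (d :* j) :* e) refl d (ν n) (x * y) (d ⁻¹))
            (+-congˡ (-‿cong (trans (*-congʳ (⁻¹-inverseʳ (0<⇒≉0 0<d))) (*-identityˡ _)))))
            (0<x*y 0<d (<-elim (ν> {n} (ℕ.≤-trans (ℕ.m≤m⊔n N _) M≤n))))
    in ≤-trans
      (≤-respˡ-≈ (^-distrib-* (base x n) (base y n) (suc n)) (^-mono-≤ (suc n)
        (0≤x*y (<⇒≤ (0<base {x} {n} -x<ν)) (<⇒≤ (0<base {y} {n} -y<ν)))
        (≤-intro (trans (solve 5 (λ x y z i ν → i :* i :* ((z :- (x :+ y)) :* ν :- x :* y)
                    := (ν :* i) :* (z :- (x :+ y)) :* i :- x :* y :* i :* i) refl x y z i (ν n))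
            (trans (+-congʳ (*-congʳ (trans (*-congʳ ν*i) (*-identityˡ _))))
              (solve 4 (λ x y z i → (z :- (x :+ y)) :* i :- x :* y :* i :* i := (con (+ 1) :+ z :* i) :- (con (+ 1) :+ x :* i) :* (con (+ 1) :+ y :* i)) refl x y z i)))
          (0≤x*y (0≤x*x i) (<⇒≤ 0<gap)))))
      (euler≤exp z n (-x<ν-large z (ℕ.≤-trans (ℕ.m≤n⊔m N _) M≤n)))
    where
    d = z - (x + y)
    0<d = <-elim x+y<z
    N = proj₁ (archimedean (x * y / d))
    ν> = proj₂ (archimedean (x * y / d))

  exp*exp≤exp-+ : ∀ x y → exp x * exp y ≤ exp (x + y)
  exp*exp≤exp-+ x y = ≮⇒≥ λ E<A →
    let E = exp (x + y)
        A = exp x * exp y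
        0<A = 0<x*y (0<exp x) (0<exp y)
        -- Moving up by `ε` and then down by `2 ε` uses the strict version twice and gives
        -- `A (1 - 2 ε) ≤ E`. This contradicts `3 ε A ≤ A - E`; the bound `2 ε ≤ 1` keeps the factor
        -- `1 - 2 ε` non-negative.
        ε , 0<ε , ε2≤1 , ε3A≤A-E = commonScale 0<2 0<1 (0<x+y (0<x+y 0<A (<⇒≤ 0<A)) (<⇒≤ 0<A)) (<-elim E<A)
        w = x + y + ε
        A≤expw : A ≤ exp w
        A≤expw = exp*exp≤exp (<-intro (solve 3 (λ x y e → e := x :+ y :+ e :- (x :+ y)) refl x y ε) 0<ε)
        step : exp w * exp (- (ε + ε)) ≤ E
        step = exp*exp≤exp (<-intro (solve 3 (λ x y e → e := x :+ y :- (x :+ y :+ e :- (e :+ e))) refl x y ε) 0<ε)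
        A[1-2ε]≤E : A * (1# - (ε + ε)) ≤ E
        A[1-2ε]≤E = ≤-trans (≤-respˡ-≈ (*-comm _ _) (≤-respʳ-≈ (*-comm _ _) (*-mono-≤
          (≤-respʳ-≈ (solve 1 (λ e → con (+ 1) :- e :* (con (+ 1) :+ con (+ 1)) := con (+ 1) :- (e :+ e)) refl ε) (≤-elim ε2≤1))
          (1+x≤exp (- (ε + ε))) (<⇒≤ 0<A) A≤expw))) step
    in <⇒≱ (0<x+y (0<x*y 0<ε 0<A) (0≤x+y (≤-elim ε3A≤A-E) (≤-elim A[1-2ε]≤E)))
         (≤-reflexive (solve 3 (λ e A E → e :* A :+ (A :- E :- e :* (A :+ A :+ A) :+ (E :- A :* (con (+ 1) :- (e :+ e)))) := con (+ 0)) refl ε A E))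

  -- The missing half is the known half for `x + y` and `- y`, multiplied by `exp y`.
  exp-+ : ∀ x y → exp (x + y) ≈ exp x * exp y
  exp-+ x y = ≤-antisym
    (≤-respˡ-≈ (trans (solve 3 (λ e p m → m :* (e :* p) := e :* (m :* p)) refl (exp (x + y)) (exp (- y)) (exp y))
        (trans (*-congˡ (exp*exp-neg y)) (*-identityʳ _)))
      (≤-respʳ-≈ (*-comm _ _) (*-mono-≤ (<⇒≤ (0<exp y)) ≤-refl (<⇒≤ (0<x*y (0<exp (x + y)) (0<exp (- y))))
        (≤-respʳ-≈ (exp-cong (solve 2 (λ x y → x :+ y :- y := x) refl x y)) (exp*exp≤exp-+ (x + y) (- y))))))
    (exp*exp≤exp-+ x y)

  exp-0 : exp 0# ≈ 1#
  exp-0 = *-cancelˡ (exp≉0 0#) (trans (sym (exp-+ 0# 0#)) (trans (exp-cong (+-identityˡ 0#)) (sym (*-identityʳ _))))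

  exp-≈0 : ∀ {x} → x ≈ 0# → exp x ≈ 1#
  exp-≈0 x≈0 = trans (exp-cong x≈0) exp-0

  -- The tangent at `x` lies below the graph: this is `1 + (y - x) ≤ exp (y - x)` scaled by `exp x`.
  -- It replaces differentiation in everything that follows.
  exp-secant : ∀ x y → exp x - exp y ≤ exp x * (x - y)
  exp-secant x y = ≤-intro
    (trans (solve 4 (λ e y x d → e :* (d :- (con (+ 1) :+ (y :- x))) := e :* (x :- y) :- (e :- e :* d)) refl (exp x) y x (exp (y - x)))
      (+-congˡ (-‿cong (+-congˡ (-‿cong (trans (sym (exp-+ x (y - x))) (exp-cong (solve 2 (λ x y → x :+ (y :- x) := y) refl x y))))))))
    (0≤x*y (<⇒≤ (0<exp x)) (≤-elim (1+x≤exp (y - x))))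

  exp-mono-< : ∀ {x y} → x < y → exp x < exp y
  exp-mono-< {x} {y} x<y = <-≤-trans
    (<-intro (solve 3 (λ e x y → e :* (y :- x) := e :- e :* (x :- y) :- e) refl (exp x) x y) (0<x*y (0<exp x) (<-elim x<y)))
    (≤-intro (solve 3 (λ e f d → d :- (e :- f) := f :- (e :- d)) refl (exp x) (exp y) (exp x * (x - y))) (≤-elim (exp-secant x y)))

  exp-mono-≤ : ∀ {x y} → x ≤ y → exp x ≤ exp y
  exp-mono-≤ {x} {y} x≤y with em {P = x ≈ y}
  ... | yes x≈y = ≤-reflexive (exp-cong x≈y)
  ... | no x≉y = <⇒≤ (exp-mono-< (x≤y , x≉y))

  exp-cancel-≤ : ∀ {x y} → exp x ≤ exp y → x ≤ y
  exp-cancel-≤ ex≤ey = ≮⇒≥ λ y<x → <⇒≱ (exp-mono-< y<x) ex≤ey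

  exp-injective : ∀ {x y} → exp x ≈ exp y → x ≈ y
  exp-injective ex≈ey = ≤-antisym (exp-cancel-≤ (≤-reflexive ex≈ey)) (exp-cancel-≤ (≤-reflexive (sym ex≈ey)))

  -- Intermediate values

  module IntermediateValue (F : ℝ → ℝ) {a b L : ℝ} (a≤b : a ≤ b) (0<L : 0# < L)
    (rise : ∀ {x y} → a ≤ x → x ≤ y → y ≤ b → F y - F x ≤ L * (y - x))
    (Fa≤0 : F a ≤ 0#) (0≤Fb : 0# ≤ F b) where

    private
      P : Pred ℝ 0ℓ
      P x = a ≤ x × x ≤ b × F x ≤ 0#

      P-a : Satisfiable P
      P-a = a , ≤-refl , a≤b , Fa≤0

      s : ℝ
      s = sup P

      ≤s : ∀ {x} → P x → x ≤ s
      ≤s = sup-upper {P} P-a (b , λ (_ , x≤b , _) → x≤b)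

      a≤s : a ≤ s
      a≤s = ≤s (proj₂ P-a)

      s≤b : s ≤ b
      s≤b = sup-least {P} P-a λ (_ , x≤b , _) → x≤b

      i : ℝ
      i = L ⁻¹
      L*i = ⁻¹-inverseʳ (0<⇒≉0 0<L)

      0≤Fs : 0# ≤ F s
      -- `F` climbs at rate at most `L`, so it is still at most 0 at `s - F s / L`, and it cannot
      -- reach `F b ≥ 0` earlier; this point of `P` exceeds the supremum.
      0≤Fs = ≮⇒≥ λ Fs<0 →
        let x = s + - F s * i
            0<δ = 0<x*y (0<-x Fs<0) (0<⁻¹ 0<L)
            s≤x : s ≤ x
            s≤x = ≤-intro (solve 2 (λ s d → d := s :+ d :- s) refl s (- F s * i)) (<⇒≤ 0<δ)
            x≤b : x ≤ b
            x≤b = ≤-intro (trans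
                (solve 6 (λ i L b s f g → i :* ((L :* (b :- s) :- (g :- f)) :+ g) := (L :* i) :* (b :- s) :+ f :* i) refl i L b s (F s) (F b))
                (trans (+-congʳ (trans (*-congʳ L*i) (*-identityˡ _))) (solve 4 (λ b s f i → (b :- s) :+ f :* i := b :- (s :+ :- f :* i)) refl b s (F s) i)))
              (0≤x*y (<⇒≤ (0<⁻¹ 0<L)) (0≤x+y (≤-elim (rise a≤s s≤b ≤-refl)) 0≤Fb))
            Fx≤0 : F x ≤ 0#
            Fx≤0 = ≤-intro (trans
                (solve 5 (λ L i f g s → L :* (s :+ :- f :* i :- s) :- (g :- f) := (L :* i) :* (:- f) :+ f :- g) refl L i (F s) (F x) s)
                (trans (+-congʳ (+-congʳ (trans (*-congʳ L*i) (*-identityˡ _)))) (solve 2 (λ f g → :- f :+ f :- g := con (+ 0) :- g) refl (F s) (F x))))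
              (≤-elim (rise a≤s s≤x x≤b))
        in <⇒≱ (<-intro (solve 2 (λ s d → d := s :+ d :- s) refl s (- F s * i)) 0<δ) (≤s (≤-trans a≤s s≤x , x≤b , Fx≤0))

      Fs≤0 : F s ≤ 0#
      -- To reach `F s` from a value at most 0 takes at least a distance `F s / L`, so `s - F s / L`
      -- already bounds `P`.
      Fs≤0 = ≮⇒≥ λ 0<Fs → <⇒≱
        (<-intro (solve 2 (λ s d → d := s :- (s :- d)) refl s (F s * i)) (0<x*y 0<Fs (0<⁻¹ 0<L)))
        (sup-least {P} P-a λ {x} Px@(a≤x , x≤b , Fx≤0) → ≤-intro (trans
            (solve 6 (λ i L x s f g → i :* ((L :* (s :- x) :- (f :- g)) :+ (:- g)) := (L :* i) :* (s :- x) :- f :* i) refl i L x s (F s) (F x))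
            (trans (+-congʳ (trans (*-congʳ L*i) (*-identityˡ _))) (solve 3 (λ x s d → (s :- x) :- d := s :- d :- x) refl x s (F s * i))))
          (0≤x*y (<⇒≤ (0<⁻¹ 0<L)) (0≤x+y (≤-elim (rise a≤x (≤s Px) s≤b)) (0≤-x Fx≤0))))

    root : ∃[ x ] a ≤ x × x ≤ b × F x ≈ 0#
    root = s , a≤s , s≤b , ≤-antisym Fs≤0 0≤Fs

  -- Continuity takes the form of a bound on the rate of increase, which is what `exp-secant` and
  -- `D-rise` provide.
  intermediateValue : ∀ (F : ℝ → ℝ) {a b L} → a ≤ b → 0# < L →
    (∀ {x y} → a ≤ x → x ≤ y → y ≤ b → F y - F x ≤ L * (y - x)) →
    F a ≤ 0# → 0# ≤ F b → ∃[ x ] a ≤ x × x ≤ b × F x ≈ 0#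
  intermediateValue F a≤b 0<L rise Fa≤0 0≤Fb = IntermediateValue.root F a≤b 0<L rise Fa≤0 0≤Fb

  -- Logarithms

  x-y≈0⇒x≈y : ∀ {x y} → x - y ≈ 0# → x ≈ y
  x-y≈0⇒x≈y {x} {y} x-y≈0 = trans (solve 2 (λ e y → e := e :- y :+ y) refl x y) (trans (+-congʳ x-y≈0) (+-identityˡ y))

  -- With `t = y ⁻¹`, the bound `1 + t ≤ exp t` gives `exp (- t) * (1 + t) ≤ 1 = y t`. So `- y ⁻¹`
  -- is a lower bracket for solving `exp x ≈ y`; the upper bracket is `y` itself.
  exp-⁻¹≤ : ∀ {y} → 0# < y → exp (- y ⁻¹) ≤ y
  exp-⁻¹≤ {y} 0<y = ≤-intro refl (0≤-cancelˡ 0<t (0≤-resp-≈ (solve 3 (λ e t y → (y :* t :- e :* (con (+ 1) :+ t)) :+ e := t :* (y :- e)) refl e t y)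
    (0≤x+y (≤-elim e[1+t]≤yt) (<⇒≤ (0<exp (- t))))))
    where
    t = y ⁻¹
    e = exp (- t)
    0<t : 0# < t
    0<t = 0<⁻¹ 0<y
    e[1+t]≤yt : e * (1# + t) ≤ y * t
    e[1+t]≤yt = ≤-respʳ-≈ (trans (*-comm e (exp t)) (trans (exp*exp-neg t) (sym (⁻¹-inverseʳ (0<⇒≉0 0<y)))))
      (*-mono-≤ (<⇒≤ (0<exp (- t))) ≤-refl (0≤x+y (<⇒≤ 0<1) (<⇒≤ 0<t)) (1+x≤exp t))

  x≤exp : ∀ x → x ≤ exp x
  x≤exp x = ≤-trans (≤-intro (solve 1 (λ y → con (+ 1) := con (+ 1) :+ y :- y) refl x) (<⇒≤ 0<1)) (1+x≤exp x)

  exp-surjective : ∀ {y} → 0# < y → ∃[ x ] exp x ≈ y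
  exp-surjective {y} 0<y = proj₁ root , x-y≈0⇒x≈y (proj₂ (proj₂ (proj₂ root)))
    where
    F : ℝ → ℝ
    F x = exp x - y
    F-rise : ∀ {x x′} → - y ⁻¹ ≤ x → x ≤ x′ → x′ ≤ y → F x′ - F x ≤ exp y * (x′ - x)
    F-rise {x} {x′} _ x≤x′ x′≤y = ≤-trans
      (≤-respˡ-≈ (solve 3 (λ e f y → e :- f := e :- y :- (f :- y)) refl (exp x′) (exp x) y) (exp-secant x′ x))
      (*-mono-≤ (<⇒≤ (0<exp x′)) (exp-mono-≤ x′≤y) (≤-elim x≤x′) ≤-refl)
    -t≤y : - y ⁻¹ ≤ y
    -t≤y = ≤-intro (solve 2 (λ y t → y :+ t := y :- :- t) refl y (y ⁻¹)) (0≤x+y (<⇒≤ 0<y) (<⇒≤ (0<⁻¹ 0<y)))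
    F≤0 : F (- y ⁻¹) ≤ 0#
    F≤0 = x≤0 (0≤-resp-≈ (solve 2 (λ e y → y :- e := :- (e :- y)) refl (exp (- y ⁻¹)) y) (≤-elim (exp-⁻¹≤ 0<y)))
    root : ∃[ x ] - y ⁻¹ ≤ x × x ≤ y × F x ≈ 0#
    root = intermediateValue F -t≤y (0<exp y) F-rise F≤0 (≤-elim (x≤exp y))

  ln-unique : ∀ {x y} → exp x ≈ y → ln y ≈ x
  ln-unique {x} {y} ex≈y = ≤-antisym
    (sup-least {P = λ x → exp x ≈ y} (x , ex≈y) unique)
    (sup-upper {P = λ x → exp x ≈ y} (x , ex≈y) (x , unique) ex≈y)
    where
    unique : ∀ {x′} → exp x′ ≈ y → x′ ≤ x
    unique ex′≈y = ≤-reflexive (exp-injective (trans ex′≈y (sym ex≈y)))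

  exp-ln : ∀ {y} → 0# < y → exp (ln y) ≈ y
  exp-ln {y} 0<y = trans (exp-cong (ln-unique (proj₂ preimage))) (proj₂ preimage)
    where preimage = exp-surjective 0<y

  -- Finite sums of exponentials

  δ : ∀ {n} → Fin n → Vector ℝ n
  δ i k with i ≟ k
  ... | yes _ = 1#
  ... | no _ = 0#

  δ-same : ∀ {n} (i : Fin n) → δ i i ≈ 1#
  δ-same i with i ≟ i
  ... | yes _ = refl
  ... | no i≢i = contradiction ≡.refl i≢i

  δ-diff : ∀ {n} {i k : Fin n} → i ≢ k → δ i k ≈ 0#
  δ-diff {i = i} {k} i≢k with i ≟ k
  ... | yes i≡k = contradiction i≡k i≢k
  ... | no _ = refl

  ∑-δ : ∀ {n} (i : Fin n) (v : Vector ℝ n) → ∑ (λ k → δ i k * v k) ≈ v i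
  ∑-δ i v = trans (∑-single (λ k → δ i k * v k) i λ k k≢i → trans (*-congʳ (δ-diff (k≢i ∘ ≡.sym))) (zeroˡ _))
    (trans (*-congʳ (δ-same i)) (*-identityˡ _))

  -- If `f = F 0#` were negative, then at `s = - f / (L - f)` the bound on the rise would give
  -- `F s ≤ f + L s = - f² / (L - f) < 0`. The denominator `L - f` instead of `L` keeps `s` below 1.
  rightLimit-0≤ : ∀ (F : ℝ → ℝ) {L} → 0# < L → (∀ {s} → 0# < s → s ≤ 1# → 0# ≤ F s) →
    (∀ {s} → 0# ≤ s → s ≤ 1# → F s - F 0# ≤ L * s) → 0# ≤ F 0#
  rightLimit-0≤ F {L} 0<L 0≤F rise = ≮⇒≥ contra
    where
    f = F 0#
    contra : ¬ (f < 0#)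
    contra f<0 = <⇒≱ (0<x+y (0<x*y (0<x*y (0<-x f<0) (0<-x f<0)) 0<i) (0≤x+y (≤-elim Fs-f≤Ls) 0≤Fs))
      (≤-reflexive (trans
        (solve 5 (λ f L i e F → :- f :* :- f :* i :+ (L :* (:- f :* i) :- (F :- f) :+ F) := f :- f :* ((L :- f) :* i)) refl f L i e (F s))
        (trans (+-congˡ (-‿cong (trans (*-congˡ e*i) (*-identityʳ f)))) (-‿inverseʳ f))))
      where
      e = L - f
      i = e ⁻¹
      s = - f * i
      0<e : 0# < e
      0<e = 0<x+y 0<L (<⇒≤ (0<-x f<0))
      0<i = 0<⁻¹ 0<e
      e*i = ⁻¹-inverseʳ (0<⇒≉0 0<e)
      0<s : 0# < s
      0<s = 0<x*y (0<-x f<0) 0<i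
      s≤1 : s ≤ 1#
      s≤1 = ≤-intro (trans (solve 3 (λ f L i → L :* i := (L :- f) :* i :- :- f :* i) refl f L i) (+-congʳ e*i)) (<⇒≤ (0<x*y 0<L 0<i))
      0≤Fs = 0≤F 0<s s≤1
      Fs-f≤Ls = rise (<⇒≤ 0<s) s≤1

  -- The shape of an exponential sum divided by its distinguished monomial: a coefficient of unknown
  -- sign may occur only with exponent 0. Hence `G` is convex, and `D` is its derivative.
  module ConvexSum {m} (q b : Vector ℝ m) (nonneg : ∀ k → 0# ≤ q k ⊎ b k ≈ 0#) where

    G : ℝ → ℝ
    G t = ∑ (λ k → q k * exp (b k * t))

    D : ℝ → ℝ
    D t = ∑ (λ k → q k * b k * exp (b k * t))

    G-secant : ∀ s t → G s - G t ≤ D s * (s - t)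
    G-secant s t = ≤-respˡ-≈ (∑-‿- _ _) (≤-respʳ-≈ (∑-*ʳ (s - t) _)
      (∑-mono _ _ λ k → term k (nonneg k)))
      where
      term : ∀ k → 0# ≤ q k ⊎ b k ≈ 0# → q k * exp (b k * s) - q k * exp (b k * t) ≤ q k * b k * exp (b k * s) * (s - t)
      term k (inj₁ 0≤q) = ≤-intro
        (solve 6 (λ q b e f s t → q :* (e :* (b :* s :- b :* t) :- (e :- f)) := q :* b :* e :* (s :- t) :- (q :* e :- q :* f)) refl
          (q k) (b k) (exp (b k * s)) (exp (b k * t)) s t)
        (0≤x*y 0≤q (≤-elim (exp-secant (b k * s) (b k * t))))
      term k (inj₂ b≈0) = ≤-reflexive (trans
        (trans (+-congˡ (-‿cong (*-congˡ (trans (exp-≈0 (trans (*-congʳ b≈0) (zeroˡ t))) (sym (exp-≈0 (trans (*-congʳ b≈0) (zeroˡ s)))))))) (-‿inverseʳ _))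
        (sym (trans (*-congʳ (*-congʳ (trans (*-congˡ b≈0) (zeroʳ _)))) (trans (*-congʳ (zeroˡ _)) (zeroˡ _)))))

    private
      bound : ∀ k → ∃[ B ] 0# < B × - B ≤ b k × b k ≤ B
      bound k = absBound (b k)

      B : Vector ℝ m
      B k = proj₁ (bound k)

      -- An upper bound for the derivative `q b² exp (b t)` of a term of `D` when `t` lies between
      -- -1 and 1; a constant term contributes nothing.
      weight : ∀ k → 0# ≤ q k ⊎ b k ≈ 0# → ℝ
      weight k (inj₁ _) = q k * (b k * b k) * exp (B k)
      weight k (inj₂ _) = 0#

      0≤weight : ∀ k c → 0# ≤ weight k c
      0≤weight k (inj₁ 0≤q) = 0≤x*y (0≤x*y 0≤q (0≤x*x (b k))) (<⇒≤ (0<exp (B k)))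
      0≤weight k (inj₂ _) = ≤-refl

      exp≤expB : ∀ k {t} → - 1# ≤ t → t ≤ 1# → exp (b k * t) ≤ exp (B k)
      exp≤expB k -1≤t t≤1 = exp-mono-≤ (≤-respʳ-≈ (*-identityʳ _)
        (*-bound (proj₁ (proj₂ (proj₂ (bound k)))) (proj₂ (proj₂ (proj₂ (bound k)))) -1≤t t≤1))

      -- The secant inequality is multiplied by the absolute value of `b k`; its tangent point has
      -- to be `t` for `b k ≥ 0` and `s` for `b k ≤ 0` to give an upper bound.
      scaledGap : ∀ k {s t} → - 1# ≤ s → s ≤ t → t ≤ 1# → b k * (exp (b k * t) - exp (b k * s)) ≤ b k * b k * exp (B k) * (t - s)
      scaledGap k {s} {t} -1≤s s≤t t≤1 = cases (≤-total 0# (b k))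
        where
        e = exp (b k * s)
        f = exp (b k * t)
        -1≤t = ≤-trans -1≤s s≤t
        s≤1 = ≤-trans s≤t t≤1
        cases : 0# ≤ b k ⊎ b k ≤ 0# → b k * (f - e) ≤ b k * b k * exp (B k) * (t - s)
        cases (inj₁ 0≤b) = ≤-intro
          (solve 6 (λ b s t e f E → b :* (f :* (b :* t :- b :* s) :- (f :- e)) :+ b :* b :* ((E :- f) :* (t :- s)) := b :* b :* E :* (t :- s) :- b :* (f :- e)) refl
            (b k) s t e f (exp (B k)))
          (0≤x+y (0≤x*y 0≤b (≤-elim (exp-secant (b k * t) (b k * s))))
            (0≤x*y (0≤x*x (b k)) (0≤x*y (≤-elim (exp≤expB k -1≤t t≤1)) (≤-elim s≤t))))
        cases (inj₂ b≤0) = ≤-intro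
          (solve 6 (λ b s t e f E → :- b :* (e :* (b :* s :- b :* t) :- (e :- f)) :+ b :* b :* ((E :- e) :* (t :- s)) := b :* b :* E :* (t :- s) :- b :* (f :- e)) refl
            (b k) s t e f (exp (B k)))
          (0≤x+y (0≤x*y (0≤-x b≤0) (≤-elim (exp-secant (b k * s) (b k * t))))
            (0≤x*y (0≤x*x (b k)) (0≤x*y (≤-elim (exp≤expB k -1≤s s≤1)) (≤-elim s≤t))))

      term-rise : ∀ k c {s t} → - 1# ≤ s → s ≤ t → t ≤ 1# →
        q k * b k * exp (b k * t) - q k * b k * exp (b k * s) ≤ weight k c * (t - s)
      term-rise k (inj₁ 0≤q) {s} {t} -1≤s s≤t t≤1 = ≤-intro
        (solve 6 (λ q b e f E d → q :* (b :* b :* E :* d :- b :* (f :- e)) := q :* (b :* b) :* E :* d :- (q :* b :* f :- q :* b :* e)) refl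
          (q k) (b k) (exp (b k * s)) (exp (b k * t)) (exp (B k)) (t - s))
        (0≤x*y 0≤q (≤-elim (scaledGap k -1≤s s≤t t≤1)))
      term-rise k (inj₂ b≈0) {s} {t} _ _ _ = ≤-reflexive
        (trans (solve 4 (λ q b e f → q :* b :* f :- q :* b :* e := b :* (q :* (f :- e))) refl (q k) (b k) (exp (b k * s)) (exp (b k * t)))
          (trans (*-congʳ b≈0) (trans (zeroˡ _) (sym (zeroˡ _)))))

    -- The summand `1#` keeps the bound positive when all weights vanish, because it is divided by
    -- later.
    L : ℝ
    L = 1# + ∑ (λ k → weight k (nonneg k))

    0<L : 0# < L
    0<L = 0<x+y 0<1 (0≤∑ _ λ k → 0≤weight k (nonneg k))

    D-rise : ∀ {s t} → - 1# ≤ s → s ≤ t → t ≤ 1# → D t - D s ≤ L * (t - s)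
    D-rise {s} {t} -1≤s s≤t t≤1 = ≤-trans
      (≤-respˡ-≈ (∑-‿- _ _) (∑-mono _ _ λ k → term-rise k (nonneg k) -1≤s s≤t t≤1))
      (≤-intro (trans (solve 2 (λ d w → d := (con (+ 1) :+ w) :* d :- w :* d) refl (t - s) (∑ (λ k → weight k (nonneg k))))
        (+-congˡ (-‿cong (sym (∑-*ʳ (t - s) _))))) (≤-elim s≤t))

    -- For `0 < s` convexity gives `s * D s ≥ G s - G 0# ≥ 0`, hence `D s ≥ 0`; the sign passes to
    -- `s = 0` by `rightLimit-0≤`.
    D-0≤ : 0# ≤ G 0# → G 0# ≤ 0# → (∀ {s} → 0# ≤ s → s ≤ 1# → 0# ≤ G s) → 0# ≤ D 0#
    D-0≤ 0≤G0 G0≤0 0≤G = rightLimit-0≤ D 0<L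
      (λ {s} 0<s s≤1 → 0≤-cancelˡ 0<s (0≤-resp-≈
        (solve 4 (λ g h d s → h :+ (d :* (s :- con (+ 0)) :- (h :- g)) :+ :- g := s :* d) refl (G 0#) (G s) (D s) s)
        (0≤x+y (0≤x+y (0≤G (<⇒≤ 0<s) s≤1) (≤-elim (G-secant s 0#))) (0≤-x G0≤0))))
      (λ {s} 0≤s s≤1 → ≤-respʳ-≈ (*-congˡ x-0≈x)
        (D-rise (≤-trans (x≤0 (0≤-resp-≈ (sym neg-neg) (<⇒≤ 0<1))) ≤-refl) 0≤s s≤1))

  -- Linear independence of exponentials

  exponentials-independent : ∀ {m} (α : Vector ℝ m) → (∀ i j → i ≢ j → ¬ (α i ≈ α j)) →
    ∀ (c : Vector ℝ m) → (∀ x → ∑ (λ k → c k * exp (α k * x)) ≈ 0#) → ∀ k → c k ≈ 0#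
  exponentials-independent {suc m} α distinct c vanishes = λ { zero → c₀≈0 ; (suc k) → c₊≈0 k }
    where
    e : Vector ℝ (suc m)
    e k = exp (α k)
    -- These are the coefficients of `f (x + 1) - exp (α zero) * f x`, where `f` is the given sum:
    -- the term with exponent `α zero` drops out, the others are multiplied by non-zero numbers, and
    -- induction applies.
    c′ : Vector ℝ m
    c′ k = c (suc k) * (e (suc k) - e zero)
    term : ∀ x k → c k * exp (α k * (x + 1#)) - e zero * (c k * exp (α k * x)) ≈ c k * (e k - e zero) * exp (α k * x)
    term x k = trans (+-congʳ (*-congˡ (trans (exp-cong (solve 2 (λ a x → a :* (x :+ con (+ 1)) := a :+ a :* x) refl (α k) x)) (exp-+ (α k) (α k * x)))))
      (solve 4 (λ c d a b → c :* (a :* b) :- d :* (c :* b) := c :* (a :- d) :* b) refl (c k) (e zero) (e k) (exp (α k * x)))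
    vanishes′ : ∀ x → ∑ (λ k → c′ k * exp (α (suc k) * x)) ≈ 0#
    vanishes′ x = trans (sym (trans (∑-suc (λ k → c k * (e k - e zero) * exp (α k * x)))
        (trans (+-congʳ (trans (*-congʳ (trans (*-congˡ (-‿inverseʳ _)) (zeroʳ _))) (zeroˡ _))) (+-identityˡ _))))
      (trans (∑-cong (λ k → sym (term x k))) (trans (∑-‿- _ _)
        (trans (+-cong (vanishes (x + 1#)) (-‿cong (trans (∑-*ˡ (e zero) _) (trans (*-congˡ (vanishes x)) (zeroʳ _))))) (-‿inverseʳ 0#))))
    c₊≈0 : ∀ k → c (suc k) ≈ 0#
    c₊≈0 k = *-cancelˡ-≈0 (λ gap≈0 → distinct (suc k) zero (λ ()) (exp-injective (x-y≈0⇒x≈y gap≈0)))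
      (trans (*-comm _ _) (exponentials-independent (α ∘ suc) (λ i j i≢j → distinct (suc i) (suc j) (i≢j ∘ suc-injective)) c′ vanishes′ k))
    c₀≈0 : c zero ≈ 0#
    c₀≈0 = *-cancelˡ-≈0 (exp≉0 (α zero * 0#)) (trans (*-comm _ _) (trans (sym (+-identityʳ _)) (trans
      (sym (trans (∑-suc (λ k → c k * exp (α k * 0#))) (+-congˡ (∑-zero _ λ k → trans (*-congʳ (c₊≈0 k)) (zeroˡ _))))) (vanishes 0#))))

  -- Exponential sums centred at a point

  module Exponents {m} (α : Vector ℝ m) where

    X : Pred ℝ 0ℓ
    X = Icc (- 1#) 1#

    -- With coefficients taken relative to `z`, the value at `z` is `∑ q` and the derivative there
    -- is `moment q`, so that contact at `z` becomes a linear condition on `q`.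
    expSum : Vector ℝ m → ℝ → ℝ → ℝ
    expSum q z x = ∑ (λ k → q k * exp (α k * (x - z)))

    moment : Vector ℝ m → ℝ
    moment q = ∑ (λ k → q k * α k)

    expSum-cong : ∀ {q q′} z x → (∀ k → q k ≈ q′ k) → expSum q z x ≈ expSum q′ z x
    expSum-cong z x q≈q′ = ∑-cong λ k → *-congʳ (q≈q′ k)

    expSum-+ : ∀ (q q′ : Vector ℝ m) z x → expSum (λ k → q k + q′ k) z x ≈ expSum q z x + expSum q′ z x
    expSum-+ q q′ z x = trans (∑-cong λ k → distribʳ _ (q k) (q′ k)) (∑-+ _ _)

    expSum-* : ∀ t (q : Vector ℝ m) z x → expSum (λ k → t * q k) z x ≈ t * expSum q z x
    expSum-* t q z x = trans (∑-cong λ k → *-assoc t (q k) _) (∑-*ˡ t _)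

    expSum-recentre : ∀ (q : Vector ℝ m) w z x → expSum (λ k → q k * exp (α k * (z - w))) z x ≈ expSum q w x
    expSum-recentre q w z x = ∑-cong λ k → trans (*-assoc (q k) _ _) (*-congˡ (trans (sym (exp-+ _ _))
      (exp-cong (solve 4 (λ a w z x → a :* (z :- w) :+ a :* (x :- z) := a :* (x :- w)) refl (α k) w z x))))

    expSum-centre : ∀ q z → expSum q z z ≈ ∑ q
    expSum-centre q z = ∑-cong λ k → trans (*-congˡ (exp-≈0 (trans (*-congˡ (-‿inverseʳ z)) (zeroʳ _)))) (*-identityʳ _)

    expSum-at-0 : ∀ q x → expSum q 0# x ≈ sum (λ k → q k * exp (α k * x))
    expSum-at-0 q x = trans (∑-cong λ k → *-congˡ (exp-cong (*-congˡ x-0≈x))) (∑≈sum _)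

    expSum-factor : ∀ β q z x → expSum q z x ≈ exp (α β * (x - z)) * ∑ (λ k → q k * exp ((α k - α β) * (x - z)))
    expSum-factor β q z x = trans (∑-cong λ k → trans
        (*-congˡ (trans (exp-cong (solve 3 (λ a b t → a :* t := b :* t :+ (a :- b) :* t) refl (α k) (α β) (x - z))) (exp-+ _ _)))
        (solve 3 (λ q e f → q :* (e :* f) := e :* (q :* f)) refl (q k) (exp (α β * (x - z))) (exp ((α k - α β) * (x - z)))))
      (∑-*ˡ _ _)

    -- For vectors with total 0 the moment is thus the same about every exponent.
    centralMoment : ∀ a q → ∑ (λ k → q k * (α k - a)) ≈ moment q - ∑ q * a
    centralMoment a q = trans (∑-cong λ k → solve 3 (λ q x a → q :* (x :- a) := q :* x :- q :* a) refl (q k) (α k) a)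
      (trans (∑-‿- _ _) (+-congˡ (-‿cong (∑-*ʳ a q))))

    -- The AGE and SAGE cones

    AGE-elim : ∀ {β f} → f ∈ AGE X α β → ∀ z → ∃[ q ] (f ≗ᶠ expSum q z) × (∀ k → k ≢ β → 0# ≤ q k)
    AGE-elim (c , f≗c , _ , 0≤c) z =
      (λ k → c k * exp (α k * (z - 0#))) ,
      (λ x → trans (f≗c x) (sym (trans (expSum-recentre c 0# z x) (expSum-at-0 c x)))) ,
      λ k k≢β → 0≤x*y (0≤c k k≢β) (<⇒≤ (0<exp _))

    AGE-nonneg : ∀ {β f} → f ∈ AGE X α β → ∀ {x} → x ∈ X → 0# ≤ f x
    AGE-nonneg (_ , _ , 0≤f , _) x∈X = 0≤f _ x∈X

    AGE-intro : ∀ {β f} q z → f ≗ᶠ expSum q z → (∀ {x} → x ∈ X → 0# ≤ f x) → (∀ k → k ≢ β → 0# ≤ q k) → f ∈ AGE X α β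
    AGE-intro q z f≗q 0≤f 0≤q =
      (λ k → q k * exp (α k * (0# - z))) ,
      (λ x → trans (f≗q x) (sym (trans (sym (expSum-at-0 _ x)) (expSum-recentre q z 0# x)))) ,
      (λ x x∈X → 0≤f x∈X) ,
      λ k k≢β → 0≤x*y (0≤q k k≢β) (<⇒≤ (0<exp _))

    AGE-resp : ∀ {β f g} → f ≗ᶠ g → f ∈ AGE X α β → g ∈ AGE X α β
    AGE-resp f≗g (c , f≗c , 0≤f , 0≤c) = c , (λ x → trans (sym (f≗g x)) (f≗c x)) , (λ x x∈X → 0≤-resp-≈ (f≗g x) (0≤f x x∈X)) , 0≤c

    AGE-0 : ∀ {β f} → f ≗ᶠ 0ᶠ → f ∈ AGE X α β
    AGE-0 {f = f} f≗0 = AGE-intro (λ _ → 0#) 0# (λ x → trans (f≗0 x) (sym (∑-zero _ λ k → zeroˡ _)))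
      (λ {x} _ → ≤-reflexive (sym (f≗0 x))) λ _ _ → ≤-refl

    -- A vector of zeros and ones selects summands; leaving out a single one is how an AGE summand
    -- is separated from the rest.
    SAGE-part : ∀ {f} (f∈K : f ∈ SAGE X α) (t : Vector ℝ m) → (∀ k → t k ≈ 0# ⊎ t k ≈ 1#) →
      (λ x → ∑ (λ k → t k * proj₁ f∈K k x)) ∈ SAGE X α
    SAGE-part (g , g∈AGE , _) t 0or1 = (λ k x → t k * g k x) , (λ k → part k (0or1 k)) , λ x → ∑≈sum _
      where
      part : ∀ k → t k ≈ 0# ⊎ t k ≈ 1# → (λ x → t k * g k x) ∈ AGE X α k
      part k (inj₁ t≈0) = AGE-0 λ x → trans (*-congʳ t≈0) (zeroˡ _)
      part k (inj₂ t≈1) = AGE-resp (λ x → sym (trans (*-congʳ t≈1) (*-identityˡ _))) (g∈AGE k)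

    AGE⊆SAGE : ∀ {β f} → f ∈ AGE X α β → f ∈ SAGE X α
    AGE⊆SAGE {β} {f} f∈AGE = (λ k x → δ β k * f x) , part , λ x → trans (sym (∑-δ β λ _ → f x)) (∑≈sum _)
      where
      part : ∀ k → (λ x → δ β k * f x) ∈ AGE X α k
      part k with β ≟ k
      ... | yes ≡.refl = AGE-resp (λ x → sym (*-identityˡ _)) f∈AGE
      ... | no _ = AGE-0 λ x → zeroˡ _

    -- Vectors q for which the sum centred at z vanishes at z and is an AGE function
    -- with respect to β because of its slope at z

    record Admissible (z : ℝ) (β : Fin m) (q : Vector ℝ m) : Set where
      field
        total≈0 : ∑ q ≈ 0#
        nonneg  : ∀ k → k ≢ β → 0# ≤ q k
        slope   : ∀ {x} → x ∈ X → 0# ≤ moment q * (x - z)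

    open Admissible public

    nonneg-or-centre : ∀ β (q : Vector ℝ m) → (∀ k → k ≢ β → 0# ≤ q k) → ∀ k → 0# ≤ q k ⊎ α k - α β ≈ 0#
    nonneg-or-centre β q 0≤q k with k ≟ β
    ... | yes ≡.refl = inj₂ (-‿inverseʳ _)
    ... | no k≢β = inj₁ (0≤q k k≢β)

    -- After division by the monomial of `β` the sum is convex with value 0 and slope `moment q` at
    -- `z`, so it lies above `moment q * (x - z)`, which is non-negative on `X`.
    Admissible⇒AGE : ∀ {z β q} → Admissible z β q → expSum q z ∈ AGE X α β
    Admissible⇒AGE {z} {β} {q} adm = AGE-intro q z (λ _ → refl) 0≤expSum (nonneg adm)
      where
      open ConvexSum q (λ k → α k - α β) (nonneg-or-centre β q (nonneg adm))
      G0≈0 : G 0# ≈ 0#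
      G0≈0 = trans (∑-cong λ k → trans (*-congˡ (exp-≈0 (zeroʳ _))) (*-identityʳ _)) (total≈0 adm)
      D0≈ : D 0# ≈ moment q
      D0≈ = trans (∑-cong λ k → trans (*-congˡ (exp-≈0 (zeroʳ _))) (*-identityʳ _)) (trans (centralMoment (α β) q)
        (trans (+-congˡ (-‿cong (trans (*-congʳ (total≈0 adm)) (zeroˡ _)))) x-0≈x))
      0≤G : ∀ {x} → x ∈ X → 0# ≤ G (x - z)
      0≤G {x} x∈X = 0≤-resp-≈
        (trans (solve 4 (λ d t g h → (d :* (con (+ 0) :- t) :- (g :- h)) :+ d :* t := h :- g) refl (D 0#) (x - z) (G 0#) (G (x - z)))
          (trans (+-congˡ (-‿cong G0≈0)) x-0≈x))
        (0≤x+y (≤-elim (G-secant 0# (x - z))) (0≤-resp-≈ (*-congʳ (sym D0≈)) (slope adm x∈X)))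
      0≤expSum : ∀ {x} → x ∈ X → 0# ≤ expSum q z x
      0≤expSum {x} x∈X = 0≤-resp-≈ (sym (expSum-factor β q z x)) (0≤x*y (<⇒≤ (0<exp _)) (0≤G x∈X))

    X-convex : ∀ {x z s} → x ∈ X → z ∈ X → 0# ≤ s → s ≤ 1# → z + s * (x - z) ∈ X
    X-convex {x} {z} {s} (-1≤x , x≤1) (-1≤z , z≤1) 0≤s s≤1 =
      ≤-intro (solve 3 (λ x z s → s :* (x :- :- con (+ 1)) :+ (con (+ 1) :- s) :* (z :- :- con (+ 1)) := z :+ s :* (x :- z) :- :- con (+ 1)) refl x z s)
        (0≤x+y (0≤x*y 0≤s (≤-elim -1≤x)) (0≤x*y (≤-elim s≤1) (≤-elim -1≤z))) ,
      ≤-intro (solve 3 (λ x z s → s :* (con (+ 1) :- x) :+ (con (+ 1) :- s) :* (con (+ 1) :- z) := con (+ 1) :- (z :+ s :* (x :- z))) refl x z s)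
        (0≤x+y (0≤x*y 0≤s (≤-elim x≤1)) (0≤x*y (≤-elim s≤1) (≤-elim z≤1)))

    -- Along the segment from `z` to `x`, parametrised by `s` from 0 to 1, the quotient by the
    -- monomial of `β` starts at 0 and stays non-negative. Its one-sided derivative at `s = 0` is
    -- `moment q * (x - z)`.
    contact⇒Admissible : ∀ {z β q} → z ∈ X → (∀ k → k ≢ β → 0# ≤ q k) → (∀ {x} → x ∈ X → 0# ≤ expSum q z x) →
      expSum q z z ≈ 0# → Admissible z β q
    contact⇒Admissible {z} {β} {q} z∈X 0≤q 0≤f f≈0 = record { total≈0 = ∑q≈0 ; nonneg = 0≤q ; slope = 0≤slope }
      where
      ∑q≈0 : ∑ q ≈ 0#
      ∑q≈0 = trans (sym (expSum-centre q z)) f≈0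
      0≤slope : ∀ {x} → x ∈ X → 0# ≤ moment q * (x - z)
      0≤slope {x} x∈X = 0≤-resp-≈ D0≈ (D-0≤ (≤-reflexive (sym G0≈0)) (≤-reflexive G0≈0) 0≤G)
        where
        b : Vector ℝ m
        b k = (α k - α β) * (x - z)
        b-ok : ∀ k → 0# ≤ q k ⊎ α k - α β ≈ 0# → 0# ≤ q k ⊎ b k ≈ 0#
        b-ok k (inj₁ 0≤qk) = inj₁ 0≤qk
        b-ok k (inj₂ ≈0) = inj₂ (trans (*-congʳ ≈0) (zeroˡ _))
        open ConvexSum q b (λ k → b-ok k (nonneg-or-centre β q 0≤q k))
        G0≈0 : G 0# ≈ 0#
        G0≈0 = trans (∑-cong λ k → trans (*-congˡ (exp-≈0 (zeroʳ _))) (*-identityʳ _)) ∑q≈0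
        D0≈ : D 0# ≈ moment q * (x - z)
        D0≈ = trans (∑-cong λ k → trans (*-congˡ (exp-≈0 (zeroʳ _))) (trans (*-identityʳ _) (sym (*-assoc _ _ _))))
          (trans (∑-*ʳ (x - z) _) (*-congʳ (trans (centralMoment (α β) q)
            (trans (+-congˡ (-‿cong (trans (*-congʳ ∑q≈0) (zeroˡ _)))) x-0≈x))))
        0≤G : ∀ {s} → 0# ≤ s → s ≤ 1# → 0# ≤ G s
        0≤G {s} 0≤s s≤1 = 0≤-cancelˡ (0<exp (α β * (y - z)))
          (0≤-resp-≈ (trans (expSum-factor β q z y) (*-congˡ (∑-cong λ k → *-congˡ (exp-cong
              (solve 4 (λ a z s x → a :* (z :+ s :* (x :- z) :- z) := a :* (x :- z) :* s) refl (α k - α β) z s x)))))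
            (0≤f (X-convex x∈X z∈X 0≤s s≤1)))
          where y = z + s * (x - z)

    -- The derivative of f (x) exp (- β x) changes sign at z, or z is an end point.
    minimiser : ∀ {β f} → f ∈ AGE X α β → ∃[ z ] ∃[ q ] z ∈ X × (f ≗ᶠ expSum q z) × (∀ k → k ≢ β → 0# ≤ q k) ×
      (∀ {x} → x ∈ X → 0# ≤ (moment q - ∑ q * α β) * (x - z))
    minimiser {β} {f} f∈AGE = z , q , z∈X , (λ x → trans (proj₁ (proj₂ elim) x) (sym (expSum-recentre c 0# z x))) ,
      (λ k k≢β → 0≤x*y (0≤c k k≢β) (<⇒≤ (0<exp _))) ,
      λ {x} x∈X → 0≤-resp-≈ (trans (sym (*-assoc _ _ _)) (*-congʳ D≈)) (0≤x*y (<⇒≤ (0<exp (α β * z))) (0≤D x∈X))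
      where
      elim = AGE-elim f∈AGE 0#
      c = proj₁ elim
      0≤c = proj₂ (proj₂ elim)
      open ConvexSum c (λ k → α k - α β) (nonneg-or-centre β c 0≤c)
      Critical : ℝ → Set
      Critical z = z ∈ X × (∀ {x} → x ∈ X → 0# ≤ D z * (x - z))
      critical : ∃[ z ] Critical z
      critical with ≤-total 0# (D (- 1#)) | ≤-total (D 1#) 0#
      ... | inj₁ 0≤D | _ = - 1# , (≤-refl , -1≤1) , λ (-1≤x , _) → 0≤x*y 0≤D (≤-elim -1≤x)
      ... | inj₂ _ | inj₁ D≤0 = 1# , (-1≤1 , ≤-refl) , λ {x} (_ , x≤1) →
          0≤-resp-≈ (solve 3 (λ d x y → :- d :* (y :- x) := d :* (x :- y)) refl (D 1#) x 1#) (0≤x*y (0≤-x D≤0) (≤-elim x≤1))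
      ... | inj₂ D≤0 | inj₂ 0≤D =
          let z , -1≤z , z≤1 , D≈0 = intermediateValue D -1≤1 0<L (λ -1≤s s≤t t≤1 → D-rise -1≤s s≤t t≤1) D≤0 0≤D
          in z , (-1≤z , z≤1) , λ {x} _ → ≤-reflexive (sym (trans (*-congʳ D≈0) (zeroˡ _)))
      z = proj₁ critical
      z∈X = proj₁ (proj₂ critical)
      0≤D : ∀ {x} → x ∈ X → 0# ≤ D z * (x - z)
      0≤D = proj₂ (proj₂ critical)
      q : Vector ℝ m
      q k = c k * exp (α k * (z - 0#))
      D≈ : exp (α β * z) * D z ≈ moment q - ∑ q * α β
      D≈ = trans (sym (∑-*ˡ _ _)) (trans (∑-cong λ k → trans
          (solve 4 (λ e c b f → e :* (c :* b :* f) := c :* (e :* f) :* b) refl (exp (α β * z)) (c k) (α k - α β) (exp ((α k - α β) * z)))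
          (*-congʳ (*-congˡ (trans (sym (exp-+ _ _)) (exp-cong (solve 3 (λ a b z → b :* z :+ (a :- b) :* z := a :* (z :- con (+ 0))) refl (α k) (α β) z))))))
        (centralMoment (α β) q))

  -- Coefficient vectors for distinct exponents.

  module DistinctExponents {m} (α : Vector ℝ m) (distinct : ∀ i j → i ≢ j → ¬ (α i ≈ α j)) where
    open Exponents α

    K : Pred (ℝ → ℝ) 0ℓ
    K = SAGE X α

    expSum-injective : ∀ (q q′ : Vector ℝ m) z → (∀ x → expSum q z x ≈ expSum q′ z x) → ∀ k → q k ≈ q′ k
    expSum-injective q q′ z q≗q′ k = x-y≈0⇒x≈y (*-cancelˡ-≈0 (exp≉0 _) (trans (*-comm _ _)
      (exponentials-independent α distinct c vanishes k)))
      where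
      c : Vector ℝ m
      c k = (q k - q′ k) * exp (α k * (0# - z))
      vanishes : ∀ x → ∑ (λ k → c k * exp (α k * x)) ≈ 0#
      vanishes x = trans (∑-cong λ k → trans (*-assoc _ _ _) (trans (*-congˡ (trans (sym (exp-+ _ _))
          (exp-cong (solve 3 (λ a x z → a :* (con (+ 0) :- z) :+ a :* x := a :* (x :- z)) refl (α k) x z))))
          (solve 3 (λ q p e → (q :- p) :* e := q :* e :- p :* e) refl (q k) (q′ k) (exp (α k * (x - z))))))
        (trans (∑-‿- _ _) (trans (+-congʳ (q≗q′ x)) (-‿inverseʳ _)))

    -- Vectors with at most three entries

    tri : ℝ → Fin m → ℝ → Fin m → Fin m → Vector ℝ m
    tri a i b j β k = a * δ i k + b * δ j k - (a + b) * δ β k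

    pair : Fin m → Fin m → Vector ℝ m
    pair j β k = δ j k - δ β k

    ∑-tri : ∀ a i b j β (u : Vector ℝ m) → ∑ (λ k → tri a i b j β k * u k) ≈ a * u i + b * u j - (a + b) * u β
    ∑-tri a i b j β u = trans (∑-cong λ k → solve 6 (λ a b x y z u → (a :* x :+ b :* y :- (a :+ b) :* z) :* u
        := a :* (x :* u) :+ b :* (y :* u) :- (a :+ b) :* (z :* u)) refl a b (δ i k) (δ j k) (δ β k) (u k))
      (trans (∑-‿- _ _) (+-cong (trans (∑-+ _ _) (+-cong (scaled a i) (scaled b j))) (-‿cong (scaled (a + b) β))))
      where
      scaled : ∀ c i → ∑ (λ k → c * (δ i k * u k)) ≈ c * u i
      scaled c i = trans (∑-*ˡ c _) (*-congˡ (∑-δ i u))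

    ∑-pair : ∀ j β (u : Vector ℝ m) → ∑ (λ k → pair j β k * u k) ≈ u j - u β
    ∑-pair j β u = trans (∑-cong λ k → solve 3 (λ x y u → (x :- y) :* u := x :* u :- y :* u) refl (δ j k) (δ β k) (u k))
      (trans (∑-‿- _ _) (+-cong (∑-δ j u) (-‿cong (∑-δ β u))))

    ∑-via-1 : ∀ (q : Vector ℝ m) {s} → ∑ (λ k → q k * 1#) ≈ s → ∑ q ≈ s
    ∑-via-1 q = trans (∑-cong λ k → sym (*-identityʳ (q k)))

    0≤δ : ∀ (i k : Fin m) → 0# ≤ δ i k
    0≤δ i k with i ≟ k
    ... | yes _ = <⇒≤ 0<1
    ... | no _ = ≤-refl

    tri-moment : ∀ a i b j β → moment (tri a i b j β) ≈ a * (α i - α β) + b * (α j - α β)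
    tri-moment a i b j β = trans (∑-tri a i b j β α)
      (solve 5 (λ a b x y z → a :* x :+ b :* y :- (a :+ b) :* z := a :* (x :- z) :+ b :* (y :- z)) refl a b (α i) (α j) (α β))

    tri-off : ∀ a i b j β k → k ≢ β → tri a i b j β k ≈ a * δ i k + b * δ j k
    tri-off a i b j β k k≢β = trans (+-congˡ (-‿cong (trans (*-congˡ (δ-diff (k≢β ∘ ≡.sym))) (zeroʳ _))))
      x-0≈x

    pair-off : ∀ j β k → k ≢ β → pair j β k ≈ δ j k
    pair-off j β k k≢β = trans (+-congˡ (-‿cong (δ-diff (k≢β ∘ ≡.sym)))) x-0≈x

    tri-admissible : ∀ {a b} i j β z → 0# ≤ a → 0# ≤ b →
      (∀ {x} → x ∈ X → 0# ≤ (a * (α i - α β) + b * (α j - α β)) * (x - z)) → Admissible z β (tri a i b j β)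
    tri-admissible {a} {b} i j β z 0≤a 0≤b 0≤slope = record
      { total≈0 = ∑-via-1 (tri a i b j β) (trans (∑-tri a i b j β (λ _ → 1#))
          (solve 2 (λ a b → a :* con (+ 1) :+ b :* con (+ 1) :- (a :+ b) :* con (+ 1) := con (+ 0)) refl a b))
      ; nonneg = λ k k≢β → 0≤-resp-≈ (sym (tri-off a i b j β k k≢β)) (0≤x+y (0≤x*y 0≤a (0≤δ i k)) (0≤x*y 0≤b (0≤δ j k)))
      ; slope = λ x∈X → 0≤-resp-≈ (*-congʳ (sym (tri-moment a i b j β))) (0≤slope x∈X)
      }

    -- With moment 0 the slope condition holds at every centre. The weights `α j - α β` and
    -- `α β - α i` always balance.
    balanced-admissible : ∀ {a b} i j β z → 0# ≤ a → 0# ≤ b → a * (α i - α β) + b * (α j - α β) ≈ 0# → Admissible z β (tri a i b j β)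
    balanced-admissible i j β z 0≤a 0≤b ≈0 = tri-admissible i j β z 0≤a 0≤b
      λ _ → ≤-reflexive (sym (trans (*-congʳ ≈0) (zeroˡ _)))

    pair-admissible : ∀ j β z → (∀ {x} → x ∈ X → 0# ≤ (α j - α β) * (x - z)) → Admissible z β (pair j β)
    pair-admissible j β z 0≤slope = record
      { total≈0 = ∑-via-1 (pair j β) (trans (∑-pair j β (λ _ → 1#)) (-‿inverseʳ 1#))
      ; nonneg = λ k k≢β → 0≤-resp-≈ (sym (pair-off j β k k≢β)) (0≤δ j k)
      ; slope = λ x∈X → 0≤-resp-≈ (*-congʳ (sym (∑-pair j β α))) (0≤slope x∈X)
      }

    Admissible⇒K : ∀ {z β q} → Admissible z β q → expSum q z ∈ K
    Admissible⇒K adm = AGE⊆SAGE (Admissible⇒AGE adm)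

    δ⇒AGE : ∀ β t z → 0# ≤ t → expSum (λ k → t * δ β k) z ∈ AGE X α β
    δ⇒AGE β t z 0≤t = AGE-intro (λ k → t * δ β k) z (λ _ → refl)
      (λ _ → 0≤∑ _ λ k → 0≤x*y (0≤x*y 0≤t (0≤δ β k)) (<⇒≤ (0<exp _)))
      λ k _ → 0≤x*y 0≤t (0≤δ β k)

    Ray-cong : ∀ {f g s} → 0# < s → f ≗ᶠ (s ∙ᶠ g) → Ray f ≐ Ray g
    Ray-cong {f} {g} {s} 0<s f≗sg =
      (λ (t , 0≤t , h≗tf) → t * s , 0≤x*y 0≤t (<⇒≤ 0<s) , λ x → trans (h≗tf x) (trans (*-congˡ (f≗sg x)) (sym (*-assoc _ _ _)))) ,
      (λ (t , 0≤t , h≗tg) → t * s ⁻¹ , 0≤x*y 0≤t (<⇒≤ (0<⁻¹ 0<s)) , λ x → trans (h≗tg x) (trans (*-congˡ (sym (trans (*-congˡ (f≗sg x)) (⁻¹-cancelˡ (g x) (0<⇒≉0 0<s)))))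
        (sym (*-assoc _ _ _))))

    ≐-trans : ∀ {P Q S : Pred (ℝ → ℝ) 0ℓ} → P ≐ Q → Q ≐ S → P ≐ S
    ≐-trans (P⊆Q , Q⊆P) (Q⊆S , S⊆Q) = (λ p → Q⊆S (P⊆Q p)) , λ s → Q⊆P (S⊆Q s)

    ≐-sym : ∀ {P Q : Pred (ℝ → ℝ) 0ℓ} → P ≐ Q → Q ≐ P
    ≐-sym (P⊆Q , Q⊆P) = Q⊆P , P⊆Q

    -- Splitting elements of an extremal ray.

    module ExtremalRay (ρ : Pred (ℝ → ℝ) 0ℓ) (extremal : IsExtremalRay K ρ) where
      private
        f = proj₁ (proj₁ extremal)
        f∈K = proj₁ (proj₂ (proj₁ extremal))
        f≢0 = proj₁ (proj₂ (proj₂ (proj₁ extremal)))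
        ρ≐f = proj₂ (proj₂ (proj₂ (proj₁ extremal)))

      ρ-scale : ∀ {u v t} → v ∈ ρ → 0# ≤ t → u ≗ᶠ (t ∙ᶠ v) → u ∈ ρ
      ρ-scale {t = t} v∈ρ 0≤t u≗tv =
        let s , 0≤s , v≗sf = proj₁ ρ≐f v∈ρ
        in proj₂ ρ≐f (t * s , 0≤x*y 0≤t 0≤s , λ x → trans (u≗tv x) (trans (*-congˡ (v≗sf x)) (sym (*-assoc _ _ _))))

      ρ-resp : ∀ {u v} → v ∈ ρ → u ≗ᶠ v → u ∈ ρ
      ρ-resp v∈ρ u≗v = ρ-scale v∈ρ (<⇒≤ 0<1) λ x → trans (u≗v x) (sym (*-identityˡ _))

      ρ-split : ∀ {u w v} → u ∈ K → w ∈ K → v ∈ ρ → v ≗ᶠ (u +ᶠ w) → u ∈ ρ × w ∈ ρ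
      ρ-split u∈K w∈K v∈ρ v≗u+w = proj₂ extremal _ _ u∈K w∈K (ρ-resp v∈ρ λ x → sym (v≗u+w x))

      ρ-generated : ∀ {v} → v ∈ ρ → ¬ (v ≗ᶠ 0ᶠ) → ρ ≐ Ray v
      ρ-generated {v} v∈ρ v≢0 =
        let s , 0≤s , v≗sf = proj₁ ρ≐f v∈ρ
            0<s : 0# < s
            0<s = 0≤s , λ 0≈s → v≢0 λ x → trans (v≗sf x) (trans (*-congʳ (sym 0≈s)) (zeroˡ _))
        in ≐-trans ρ≐f (≐-sym (Ray-cong 0<s v≗sf))

      -- All vectors that generate ρ are proportional, so they have the same zeros.
      ρ-support : ∀ {u w : Vector ℝ m} {z k l} → expSum u z ∈ ρ → expSum w z ∈ ρ → ¬ (u k ≈ 0#) → u l ≈ 0# → w l ≈ 0#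
      ρ-support {u} {w} {z} {k} {l} u∈ρ w∈ρ uk≉0 ul≈0 =
        let s , _ , u≗sf = proj₁ ρ≐f u∈ρ
            t , _ , w≗tf = proj₁ ρ≐f w∈ρ
            su≈tw : ∀ k → s * w k ≈ t * u k
            su≈tw = expSum-injective (λ k → s * w k) (λ k → t * u k) z λ x → trans (expSum-* s w z x) (trans (*-congˡ (w≗tf x))
              (trans (solve 3 (λ s t f → s :* (t :* f) := t :* (s :* f)) refl s t (f x)) (sym (trans (expSum-* t u z x) (*-congˡ (u≗sf x))))))
            s≉0 : ¬ (s ≈ 0#)
            s≉0 s≈0 = uk≉0 (expSum-injective u (λ _ → 0#) z (λ x → trans (u≗sf x) (trans (*-congʳ s≈0) (trans (zeroˡ _) (sym (∑-zero _ λ _ → zeroˡ _))))) k)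
        in *-cancelˡ-≈0 s≉0 (trans (su≈tw l) (trans (*-congˡ ul≈0) (zeroʳ _)))

      -- The device that refutes non-neighbouring exponents: both parts of a splitting lie on the
      -- ray, so they are proportional, and a non-zero `u` that vanishes at `l` forces `w` to vanish
      -- there too.
      ρ-unsplittable : ∀ {v u w : Vector ℝ m} {z c k l} → expSum v z ∈ ρ → 0# ≤ c → (∀ i → c * v i ≈ u i + w i) →
        expSum u z ∈ K → expSum w z ∈ K → ¬ (u k ≈ 0#) → u l ≈ 0# → ¬ (¬ (w l ≈ 0#))
      ρ-unsplittable {v} {u} {w} {z} {c} v∈ρ 0≤c cv≈u+w u∈K w∈K uk≉0 ul≈0 wl≉0 =
        let u∈ρ , w∈ρ = ρ-split u∈K w∈K (ρ-scale {u = expSum (λ k → c * v k) z} v∈ρ 0≤c (λ x → expSum-* c v z x))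
              λ x → trans (expSum-cong z x cv≈u+w) (expSum-+ u w z x)
        in wl≉0 (ρ-support u∈ρ w∈ρ uk≉0 ul≈0)

  -- Otherwise the entries of `- v` would be non-negative with sum at most 0, and all of them would
  -- vanish.
  exists-positive : ∀ {n} (v : Vector ℝ n) → 0# ≤ ∑ v → ¬ (∀ k → v k ≈ 0#) → ∃[ k ] 0# < v k
  exists-positive v 0≤∑v v≢0 with em {P = ∃[ k ] 0# < v k}
  ... | yes positive = positive
  ... | no ¬positive = contradiction (λ k → trans (sym neg-neg) (trans (-‿cong (-v≈0 k)) -0≈0)) v≢0
    where
    0≤-v : ∀ k → 0# ≤ - v k
    0≤-v k = 0≤-x (≮⇒≥ λ 0<v → ¬positive (k , 0<v))
    ∑-v : ∑ (λ k → - v k) ≈ - ∑ v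
    ∑-v = trans (∑-cong λ k → solve 1 (λ v → :- v := :- con (+ 1) :* v) refl (v k))
      (trans (∑-*ˡ (- 1#) v) (solve 1 (λ v → :- con (+ 1) :* v := :- v) refl (∑ v)))
    -v≈0 : ∀ k → - v k ≈ 0#
    -v≈0 = ∑≈0⇒≈0 (λ k → - v k) 0≤-v (≤-antisym (≤-respˡ-≈ (sym ∑-v) (x≤0 (0≤-resp-≈ (sym neg-neg) 0≤∑v))) (0≤∑ _ 0≤-v))

  positive-factors : ∀ {x y} → 0# ≤ x → 0# < x * y → 0# < x × 0# < y
  positive-factors {x} {y} 0≤x 0<xy = 0<x , 0<-cancelˡ 0<x 0<xy
    where
    0<x : 0# < x
    0<x = 0≤x , λ 0≈x → proj₂ 0<xy (sym (trans (*-congʳ (sym 0≈x)) (zeroˡ y)))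

  -- Entries and differences of admissible vectors.

  module AdmissibleVectors {m} (α : Vector ℝ m) (distinct : ∀ i j → i ≢ j → ¬ (α i ≈ α j)) where
    open Exponents α
    open DistinctExponents α distinct

    α<⇒≢ : ∀ {i j} → α i < α j → i ≢ j
    α<⇒≢ (_ , αi≉αj) ≡.refl = αi≉αj refl

    δ-diff′ : ∀ {n} {i k : Fin n} → k ≢ i → δ i k ≈ 0#
    δ-diff′ k≢i = δ-diff (k≢i ∘ ≡.sym)

    tri-at : ∀ a i b j β k {x y w} → δ i k ≈ x → δ j k ≈ y → δ β k ≈ w → tri a i b j β k ≈ a * x + b * y - (a + b) * w
    tri-at a i b j β k δi≈x δj≈y δβ≈w = +-cong (+-cong (*-congˡ δi≈x) (*-congˡ δj≈y)) (-‿cong (*-congˡ δβ≈w))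

    tri-left : ∀ a i b j β → i ≢ j → i ≢ β → tri a i b j β i ≈ a
    tri-left a i b j β i≢j i≢β = trans (tri-at a i b j β i (δ-same i) (δ-diff′ i≢j) (δ-diff′ i≢β))
      (solve 2 (λ a b → a :* con (+ 1) :+ b :* con (+ 0) :- (a :+ b) :* con (+ 0) := a) refl a b)

    tri-right : ∀ a i b j β → i ≢ j → j ≢ β → tri a i b j β j ≈ b
    tri-right a i b j β i≢j j≢β = trans (tri-at a i b j β j (δ-diff i≢j) (δ-same j) (δ-diff′ j≢β))
      (solve 2 (λ a b → a :* con (+ 0) :+ b :* con (+ 1) :- (a :+ b) :* con (+ 0) := b) refl a b)

    tri-other : ∀ a i b j β k → k ≢ i → k ≢ j → k ≢ β → tri a i b j β k ≈ 0#
    tri-other a i b j β k k≢i k≢j k≢β = trans (tri-at a i b j β k (δ-diff′ k≢i) (δ-diff′ k≢j) (δ-diff′ k≢β))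
      (solve 2 (λ a b → a :* con (+ 0) :+ b :* con (+ 0) :- (a :+ b) :* con (+ 0) := con (+ 0)) refl a b)

    pair-left : ∀ j β → j ≢ β → pair j β j ≈ 1#
    pair-left j β j≢β = trans (pair-off j β j j≢β) (δ-same j)

    pair-right : ∀ j β → j ≢ β → pair j β β ≈ - 1#
    pair-right j β j≢β = trans (+-cong (δ-diff j≢β) (-‿cong (δ-same β))) (+-identityˡ _)

    pair-other : ∀ j β k → k ≢ j → k ≢ β → pair j β k ≈ 0#
    pair-other j β k k≢j k≢β = trans (pair-off j β k k≢β) (δ-diff′ k≢j)

    ≉-resp : ∀ {x y} → x ≈ y → ¬ (y ≈ 0#) → ¬ (x ≈ 0#)
    ≉-resp x≈y y≉0 x≈0 = y≉0 (trans (sym x≈y) x≈0)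

    1≉0 : ¬ (1# ≈ 0#)
    1≉0 = 0<⇒≉0 0<1

    -1≉0 : ¬ (- 1# ≈ 0#)
    -1≉0 -1≈0 = 1≉0 (trans (sym neg-neg) (trans (-‿cong -1≈0) -0≈0))

    Admissible-scale : ∀ {z β q t} → 0# ≤ t → Admissible z β q → Admissible z β (λ k → t * q k)
    Admissible-scale {z} {β} {q} {t} 0≤t adm = record
      { total≈0 = trans (∑-*ˡ t q) (trans (*-congˡ (total≈0 adm)) (zeroʳ t))
      ; nonneg = λ k k≢β → 0≤x*y 0≤t (nonneg adm k k≢β)
      ; slope = λ {x} x∈X → 0≤-resp-≈ (trans (sym (*-assoc _ _ _)) (*-congʳ (sym (moment-* t q)))) (0≤x*y 0≤t (slope adm x∈X))
      }
      where
      moment-* : ∀ t (q : Vector ℝ m) → moment (λ k → t * q k) ≈ t * moment q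
      moment-* t q = trans (∑-cong λ k → *-assoc t (q k) (α k)) (∑-*ˡ t _)

    Admissible-minus : ∀ {z β q T ε} → Admissible z β q → Admissible z β T → (∀ k → k ≢ β → 0# ≤ q k - ε * T k) →
      (∀ {x} → x ∈ X → 0# ≤ (moment q - ε * moment T) * (x - z)) → Admissible z β (λ k → q k - ε * T k)
    Admissible-minus {z} {β} {q} {T} {ε} q-adm T-adm 0≤q-εT 0≤slope = record
      { total≈0 = trans (∑-‿- q _) (trans (+-cong (total≈0 q-adm) (-‿cong (trans (∑-*ˡ ε T) (trans (*-congˡ (total≈0 T-adm)) (zeroʳ ε))))) (-‿inverseʳ 0#))
      ; nonneg = 0≤q-εT
      ; slope = λ x∈X → 0≤-resp-≈ (*-congʳ (sym (trans (∑-cong λ k → solve 4 (λ q e t a → (q :- e :* t) :* a := q :* a :- e :* (t :* a)) refl (q k) ε (T k) (α k))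
          (trans (∑-‿- _ _) (+-congˡ (-‿cong (∑-*ˡ ε _))))))) (0≤slope x∈X)
      }

    supported-at : ∀ {β} {q : Vector ℝ m} → ∑ q ≈ 0# → (∀ k → k ≢ β → q k ≈ 0#) → ∀ k → q k ≈ 0#
    supported-at {β} {q} ∑q≈0 off k with k ≟ β
    ... | yes ≡.refl = trans (sym (∑-single q β off)) ∑q≈0
    ... | no k≢β = off k k≢β

    Admissible-nonzero : ∀ {z β q} → Admissible z β q → ¬ (∀ k → q k ≈ 0#) → ∃[ k ] k ≢ β × ¬ (q k ≈ 0#)
    Admissible-nonzero {z} {β} {q} adm q≢0 with em {P = ∃[ k ] k ≢ β × ¬ (q k ≈ 0#)}
    ... | yes found = found
    ... | no none = contradiction (supported-at (total≈0 adm) off) q≢0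
      where
      off : ∀ k → k ≢ β → q k ≈ 0#
      off k k≢β with em {P = q k ≈ 0#}
      ... | yes qk≈0 = qk≈0
      ... | no qk≉0 = contradiction (k , k≢β , qk≉0) none

    nonzero⇒≢0ᶠ : ∀ {q : Vector ℝ m} {z k} → ¬ (q k ≈ 0#) → ¬ (expSum q z ≗ᶠ 0ᶠ)
    nonzero⇒≢0ᶠ {q} {z} {k} qk≉0 q≗0 = qk≉0 (expSum-injective q (λ _ → 0#) z
      (λ x → trans (q≗0 x) (sym (∑-zero _ λ _ → zeroˡ _))) k)

  -- The shape of the generators of extremal rays.

  module ExtremalForm {m} (α : Vector ℝ m) (distinct : ∀ i j → i ≢ j → ¬ (α i ≈ α j))
    (another : ∀ (β : Fin m) → ∃[ j ] j ≢ β) where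
    open Exponents α
    open DistinctExponents α distinct
    open AdmissibleVectors α distinct

    record InteriorForm (ρ : Pred (ℝ → ℝ) 0ℓ) : Set where
      field
        z         : ℝ
        z∈X       : z ∈ X
        i β j     : Fin m
        αi<αβ     : α i < α β
        αβ<αj     : α β < α j
        noneLeft  : ∀ l → α i < α l → ¬ (α l < α β)
        noneRight : ∀ l → α β < α l → ¬ (α l < α j)
        generated : ρ ≐ Ray (expSum (tri (α j - α β) i (α β - α i) j β) z)

    -- `D` records the direction of the slope: if positive it forces `z = - 1`, if negative `z = 1`.
    -- With order relations expressed as signs of `D` times a difference, one argument covers both
    -- ends.
    record EndForm (ρ : Pred (ℝ → ℝ) 0ℓ) : Set where
      field
        z D         : ℝ
        z∈X         : z ∈ X
        0≤D[x-z]    : ∀ {x} → x ∈ X → 0# ≤ D * (x - z)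
        β j         : Fin m
        0<D[αj-αβ]  : 0# < D * (α j - α β)
        noneBelow   : ∀ i → ¬ (0# < D * (α β - α i))
        noneBetween : ∀ l → 0# < D * (α l - α β) → ¬ (0# < D * (α j - α l))
        generated   : ρ ≐ Ray (expSum (pair j β) z)

    module Classify (ρ : Pred (ℝ → ℝ) 0ℓ) (extremal : IsExtremalRay K ρ) where
      open ExtremalRay ρ extremal

      -- Pick any other exponent `j` and centre at the end point `y` of `X` where the quotient of
      -- the monomials of `β` and `j` is least. There `δ β = δ j + pair β j` is a splitting into a
      -- monomial and an admissible pair, which are not proportional.
      monomial∉ρ : ∀ {β M z} → 0# < M → ¬ (expSum (λ k → M * δ β k) z ∈ ρ)
      monomial∉ρ {β} {M} {z} 0<M Mδ∈ρ = ρ-unsplittable {k = j} {l = β} M′δ∈ρ (<⇒≤ (0<⁻¹ 0<M′))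
          (λ k → trans (⁻¹-cancelˡ (δ β k) (0<⇒≉0 0<M′)) (solve 2 (λ b j → b := con (+ 1) :* j :+ (b :- j)) refl (δ β k) (δ j k)))
          (AGE⊆SAGE (δ⇒AGE j 1# y (<⇒≤ 0<1))) (Admissible⇒K (pair-admissible β j y (proj₂ (proj₂ centre))))
          (≉-resp (trans (*-identityˡ _) (δ-same j)) 1≉0) (trans (*-identityˡ _) (δ-diff j≢β)) (≉-resp (pair-left β j (j≢β ∘ ≡.sym)) 1≉0)
        where
        j = proj₁ (another β)
        j≢β = proj₂ (another β)
        centre : ∃[ y ] y ∈ X × (∀ {x} → x ∈ X → 0# ≤ (α β - α j) * (x - y))
        centre with ≤-total (α j) (α β)
        ... | inj₁ αj≤αβ = - 1# , (≤-refl , -1≤1) , λ (-1≤x , _) → 0≤x*y (≤-elim αj≤αβ) (≤-elim -1≤x)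
        ... | inj₂ αβ≤αj = 1# , (-1≤1 , ≤-refl) , λ {x} (_ , x≤1) →
            0≤-resp-≈ (solve 4 (λ b j o x → (j :- b) :* (o :- x) := (b :- j) :* (x :- o)) refl (α β) (α j) 1# x) (0≤x*y (≤-elim αβ≤αj) (≤-elim x≤1))
        y = proj₁ centre
        M′ = M * exp (α β * (y - z))
        0<M′ : 0# < M′
        0<M′ = 0<x*y 0<M (0<exp _)
        M′δ≈ : ∀ k → M′ * δ β k ≈ M * δ β k * exp (α k * (y - z))
        M′δ≈ k with β ≟ k
        ... | yes ≡.refl = solve 2 (λ m e → m :* e :* con (+ 1) := m :* con (+ 1) :* e) refl M (exp (α k * (y - z)))
        ... | no _ = solve 3 (λ m e f → m :* e :* con (+ 0) := m :* con (+ 0) :* f) refl M (exp (α β * (y - z))) (exp (α k * (y - z)))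
        M′δ∈ρ : expSum (λ k → M′ * δ β k) y ∈ ρ
        M′δ∈ρ = ρ-resp Mδ∈ρ λ x → trans (expSum-cong y x M′δ≈) (expSum-recentre (λ k → M * δ β k) z y x)

      -- Once a positive multiple of `T` can be subtracted from `q` within the admissible vectors,
      -- extremality puts `T` itself on the ray. It remains to find small enough `ε` for the two-
      -- and three-entry vectors.
      remove : ∀ {z β q T ε} → 0# < ε → expSum q z ∈ ρ → Admissible z β T → Admissible z β (λ k → q k - ε * T k) → expSum T z ∈ ρ
      remove {z} {β} {q} {T} {ε} 0<ε q∈ρ T-adm rest-adm = ρ-scale εT∈ρ (<⇒≤ (0<⁻¹ 0<ε))
          λ x → sym (trans (*-congˡ (expSum-* ε T z x)) (⁻¹-cancelˡ _ (0<⇒≉0 0<ε)))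
        where
        εT∈ρ : expSum (λ k → ε * T k) z ∈ ρ
        εT∈ρ = proj₁ (ρ-split (Admissible⇒K (Admissible-scale (<⇒≤ 0<ε) T-adm)) (Admissible⇒K rest-adm) q∈ρ
          λ x → trans (expSum-cong z x λ k → solve 2 (λ q t → q := t :+ (q :- t)) refl (q k) (ε * T k)) (expSum-+ _ _ z x))

      interior-form : ∀ {z i β j} → z ∈ X → α i < α β → α β < α j →
        expSum (tri (α j - α β) i (α β - α i) j β) z ∈ ρ → InteriorForm ρ
      interior-form {z} {i} {β} {j} z∈X αi<αβ αβ<αj T∈ρ = record
        { z = z ; z∈X = z∈X ; i = i ; β = β ; j = j ; αi<αβ = αi<αβ ; αβ<αj = αβ<αj
        ; noneLeft = λ l αi<αl αl<αβ →
            let E = α β - α l ; F = α l - α i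
                0<E = <-elim αl<αβ ; 0<F = <-elim αi<αl
                l≢j = α<⇒≢ (<-≤-trans αl<αβ (<⇒≤ αβ<αj))
            -- An exponent `l` between `i` and `β` splits `E * T` into a balanced vector with
            -- negative entry at `l` and one with negative entry at `β`. Their entries `- A B` and
            -- `B A` at `l` cancel, as `E + F = B`. An exponent on the other side is treated in the
            -- mirrored way.
            in ρ-unsplittable {v = T} {u = tri (A * E) i (A * F) β l} {w = tri (B * A) l (B * E) j β} {c = E} {k = i} {l = j} T∈ρ (<⇒≤ 0<E)
              (λ k → solve 8 (λ ai ab aj al x y u v → (ab :- al) :* ((aj :- ab) :* x :+ (ab :- ai) :* y :- ((aj :- ab) :+ (ab :- ai)) :* u)
                := ((aj :- ab) :* (ab :- al) :* x :+ (aj :- ab) :* (al :- ai) :* u :- ((aj :- ab) :* (ab :- al) :+ (aj :- ab) :* (al :- ai)) :* v)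
                  :+ ((ab :- ai) :* (aj :- ab) :* v :+ (ab :- ai) :* (ab :- al) :* y :- ((ab :- ai) :* (aj :- ab) :+ (ab :- ai) :* (ab :- al)) :* u))
                refl (α i) (α β) (α j) (α l) (δ i k) (δ j k) (δ β k) (δ l k))
              (Admissible⇒K (balanced-admissible i β l z (<⇒≤ (0<x*y 0<A 0<E)) (<⇒≤ (0<x*y 0<A 0<F))
                (solve 4 (λ ai ab aj al → (aj :- ab) :* (ab :- al) :* (ai :- al) :+ (aj :- ab) :* (al :- ai) :* (ab :- al) := con (+ 0)) refl (α i) (α β) (α j) (α l))))
              (Admissible⇒K (balanced-admissible l j β z (<⇒≤ (0<x*y 0<B 0<A)) (<⇒≤ (0<x*y 0<B 0<E))
                (solve 4 (λ ai ab aj al → (ab :- ai) :* (aj :- ab) :* (al :- ab) :+ (ab :- ai) :* (ab :- al) :* (aj :- ab) := con (+ 0)) refl (α i) (α β) (α j) (α l))))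
              (≉-resp (tri-left (A * E) i (A * F) β l i≢β (α<⇒≢ αi<αl)) (0<⇒≉0 (0<x*y 0<A 0<E)))
              (tri-other (A * E) i (A * F) β l j (i≢j ∘ ≡.sym) j≢β (l≢j ∘ ≡.sym))
              (≉-resp (tri-right (B * A) l (B * E) j β l≢j j≢β) (0<⇒≉0 (0<x*y 0<B 0<E)))
        ; noneRight = λ l αβ<αl αl<αj →
            let E = α l - α β ; F = α j - α l
                0<E = <-elim αβ<αl ; 0<F = <-elim αl<αj
                i≢l = α<⇒≢ (<-≤-trans αi<αβ (<⇒≤ αβ<αl))
            in ρ-unsplittable {v = T} {u = tri (B * F) β (B * E) j l} {w = tri (A * E) i (A * B) l β} {c = E} {k = j} {l = i} T∈ρ (<⇒≤ 0<E)
              (λ k → solve 8 (λ ai ab aj al x y u v → (al :- ab) :* ((aj :- ab) :* x :+ (ab :- ai) :* y :- ((aj :- ab) :+ (ab :- ai)) :* u)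
                := ((ab :- ai) :* (aj :- al) :* u :+ (ab :- ai) :* (al :- ab) :* y :- ((ab :- ai) :* (aj :- al) :+ (ab :- ai) :* (al :- ab)) :* v)
                  :+ ((aj :- ab) :* (al :- ab) :* x :+ (aj :- ab) :* (ab :- ai) :* v :- ((aj :- ab) :* (al :- ab) :+ (aj :- ab) :* (ab :- ai)) :* u))
                refl (α i) (α β) (α j) (α l) (δ i k) (δ j k) (δ β k) (δ l k))
              (Admissible⇒K (balanced-admissible β j l z (<⇒≤ (0<x*y 0<B 0<F)) (<⇒≤ (0<x*y 0<B 0<E))
                (solve 4 (λ ai ab aj al → (ab :- ai) :* (aj :- al) :* (ab :- al) :+ (ab :- ai) :* (al :- ab) :* (aj :- al) := con (+ 0)) refl (α i) (α β) (α j) (α l))))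
              (Admissible⇒K (balanced-admissible i l β z (<⇒≤ (0<x*y 0<A 0<E)) (<⇒≤ (0<x*y 0<A 0<B))
                (solve 4 (λ ai ab aj al → (aj :- ab) :* (al :- ab) :* (ai :- ab) :+ (aj :- ab) :* (ab :- ai) :* (al :- ab) := con (+ 0)) refl (α i) (α β) (α j) (α l))))
              (≉-resp (tri-right (B * F) β (B * E) j l (j≢β ∘ ≡.sym) (α<⇒≢ αl<αj ∘ ≡.sym)) (0<⇒≉0 (0<x*y 0<B 0<E)))
              (tri-other (B * F) β (B * E) j l i i≢β i≢j i≢l)
              (≉-resp (tri-left (A * E) i (A * B) l β i≢l i≢β) (0<⇒≉0 (0<x*y 0<A 0<E)))
        ; generated = ρ-generated T∈ρ (nonzero⇒≢0ᶠ {k = i} (≉-resp (tri-left (α j - α β) i (α β - α i) j β i≢j i≢β) (0<⇒≉0 0<A)))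
        }
        where
        A = α j - α β
        B = α β - α i
        0<A = <-elim αβ<αj
        0<B = <-elim αi<αβ
        i≢β = α<⇒≢ αi<αβ
        j≢β = α<⇒≢ αβ<αj ∘ ≡.sym
        i≢j = α<⇒≢ (<-≤-trans αi<αβ (<⇒≤ αβ<αj))
        T = tri (α j - α β) i (α β - α i) j β

      interior-member : ∀ {z i β j q} → Admissible z β q → moment q ≈ 0# → expSum q z ∈ ρ → 0# < q i → 0# < q j →
        α i < α β → α β < α j → expSum (tri (α j - α β) i (α β - α i) j β) z ∈ ρ
      interior-member {z} {i} {β} {j} {q} adm moment≈0 q∈ρ 0<qi 0<qj αi<αβ αβ<αj = remove (proj₁ (proj₂ scale)) q∈ρ T-adm (Admissible-minus adm T-adm rest≥0
          λ _ → ≤-reflexive (sym (trans (*-congʳ (trans (+-cong moment≈0 (-‿cong (trans (*-congˡ (trans (tri-moment (α j - α β) i (α β - α i) j β) T-balanced)) (zeroʳ ε)))) (-‿inverseʳ 0#))) (zeroˡ _))))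
        where
        A = α j - α β
        B = α β - α i
        0<A = <-elim αβ<αj
        0<B = <-elim αi<αβ
        i≢β = α<⇒≢ αi<αβ
        j≢β = α<⇒≢ αβ<αj ∘ ≡.sym
        i≢j = α<⇒≢ (<-≤-trans αi<αβ (<⇒≤ αβ<αj))
        T : Vector ℝ m
        T = tri (α j - α β) i (α β - α i) j β
        T-balanced : (α j - α β) * (α i - α β) + (α β - α i) * (α j - α β) ≈ 0#
        T-balanced = solve 3 (λ i b j → (j :- b) :* (i :- b) :+ (b :- i) :* (j :- b) := con (+ 0)) refl (α i) (α β) (α j)
        T-adm : Admissible z β T
        T-adm = balanced-admissible i j β z (<⇒≤ 0<A) (<⇒≤ 0<B) T-balanced
        -- Off `β` the only non-zero entries of `T` are `A` at `i` and `B` at `j`, so `ε` has to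
        -- satisfy `ε A ≤ q i` and `ε B ≤ q j`.
        scale = commonScale 0<A 0<qi 0<B 0<qj
        ε = proj₁ scale
        rest≥0 : ∀ k → k ≢ β → 0# ≤ q k - ε * T k
        rest≥0 k k≢β with k ≟ i | k ≟ j
        ... | yes ≡.refl | _ = 0≤-resp-≈ (+-congˡ (-‿cong (*-congˡ (sym (tri-left (α j - α β) i (α β - α i) j β i≢j i≢β))))) (≤-elim (proj₁ (proj₂ (proj₂ scale))))
        ... | no _ | yes ≡.refl = 0≤-resp-≈ (+-congˡ (-‿cong (*-congˡ (sym (tri-right (α j - α β) i (α β - α i) j β i≢j j≢β))))) (≤-elim (proj₂ (proj₂ (proj₂ scale))))
        ... | no k≢i | no k≢j = 0≤-resp-≈ (trans (solve 2 (λ q e → q := q :- e :* con (+ 0)) refl (q k) ε)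
            (+-congˡ (-‿cong (*-congˡ (sym (tri-other (α j - α β) i (α β - α i) j β k k≢i k≢j k≢β)))))) (nonneg adm k k≢β)

      -- The numbers `q k * (α k - α β)` have sum 0 and are not all 0, so both signs occur. As `q`
      -- is non-negative off `β`, these signs are those of `α k - α β`, which yields an exponent on
      -- either side of `β`.
      interior : ∀ {z β q} → z ∈ X → Admissible z β q → moment q ≈ 0# → ¬ (∀ k → q k ≈ 0#) → expSum q z ∈ ρ → InteriorForm ρ
      interior {z} {β} {q} z∈X adm moment≈0 q≢0 q∈ρ = assemble
          (exists-positive v (≤-reflexive (sym ∑v≈0)) v≢0)
          (exists-positive (λ k → - v k)
            (≤-reflexive (sym (trans (∑-cong -v≈) (trans (∑-*ˡ (- 1#) v) (trans (*-congˡ ∑v≈0) (zeroʳ _))))))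
            λ -v≈0 → v≢0 λ k → trans (sym neg-neg) (trans (-‿cong (-v≈0 k)) -0≈0))
        where
        v : Vector ℝ m
        v k = q k * (α k - α β)
        ∑v≈0 : ∑ v ≈ 0#
        ∑v≈0 = trans (centralMoment (α β) q) (trans (+-cong moment≈0 (-‿cong (trans (*-congʳ (total≈0 adm)) (zeroˡ _)))) (-‿inverseʳ 0#))
        v≢0 : ¬ (∀ k → v k ≈ 0#)
        v≢0 v≈0 = let k , k≢β , qk≉0 = Admissible-nonzero adm q≢0 in
          x*y≉0 qk≉0 (λ ≈0 → distinct k β k≢β (x-y≈0⇒x≈y ≈0)) (v≈0 k)
        -v≈ : ∀ k → - v k ≈ - 1# * v k
        -v≈ k = solve 1 (λ v → :- v := :- con (+ 1) :* v) refl (v k)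
        factors : ∀ k {w} → (k ≡ β → w ≈ 0#) → 0# < q k * w → 0# < q k × 0# < w
        factors k {w} at-β 0<qw with k ≟ β
        ... | yes k≡β = contradiction (trans (*-congˡ (at-β k≡β)) (zeroʳ _)) (0<⇒≉0 0<qw)
        ... | no k≢β = positive-factors (nonneg adm k k≢β) 0<qw
        assemble : ∃[ j ] 0# < v j → ∃[ i ] 0# < - v i → InteriorForm ρ
        assemble (j , 0<vj) (i , 0<-vi) =
          let 0<qj , 0<A = factors j {α j - α β} (λ where ≡.refl → -‿inverseʳ _) 0<vj
              0<qi , 0<B = factors i {α β - α i} (λ where ≡.refl → -‿inverseʳ _)
                (0<-resp-≈ (solve 3 (λ q a b → :- (q :* (a :- b)) := q :* (b :- a)) refl (q i) (α i) (α β)) 0<-vi)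
              αi<αβ = <-intro refl 0<B
              αβ<αj = <-intro refl 0<A
          in interior-form z∈X αi<αβ αβ<αj (interior-member adm moment≈0 q∈ρ 0<qi 0<qj αi<αβ αβ<αj)

      end-form : ∀ {z D β j} → z ∈ X → ¬ (D ≈ 0#) → (∀ {x} → x ∈ X → 0# ≤ D * (x - z)) → 0# < D * (α j - α β) →
        expSum (pair j β) z ∈ ρ → EndForm ρ
      end-form {z} {D} {β} {j} z∈X D≉0 0≤D[x-z] 0<DA P∈ρ = record
        { z = z ; D = D ; z∈X = z∈X ; 0≤D[x-z] = 0≤D[x-z] ; β = β ; j = j ; 0<D[αj-αβ] = 0<DA
        ; noneBelow = λ i 0<DB →
            let A = D * (α j - α β) ; B = D * (α β - α i)
                i≢β : i ≢ β
                i≢β = λ where ≡.refl → 0<⇒≉0 0<DB (trans (*-congˡ (-‿inverseʳ _)) (zeroʳ D))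
                i≢j : i ≢ j
                i≢j = λ where ≡.refl → 0<⇒≉0 (0<x+y 0<DB (<⇒≤ 0<DA)) (solve 3 (λ d b j → d :* (b :- j) :+ d :* (j :- b) := con (+ 0)) refl D (α β) (α j))
            -- If `i` precedes `β` in the direction of `D`, then `B (e_j - e_β)` is `A (e_β - e_i)`
            -- plus the balanced vector with entries `A` at `i` and `B` at `j`.
            in ρ-unsplittable {v = pair j β} {u = λ k → A * pair β i k} {w = tri A i B j β} {c = B} {k = β} {l = j} P∈ρ (<⇒≤ 0<DB)
              (λ k → solve 7 (λ d ai ab aj x y u → d :* (ab :- ai) :* (y :- u)
                := d :* (aj :- ab) :* (u :- x) :+ (d :* (aj :- ab) :* x :+ d :* (ab :- ai) :* y :- (d :* (aj :- ab) :+ d :* (ab :- ai)) :* u))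
                refl D (α i) (α β) (α j) (δ i k) (δ j k) (δ β k))
              (Admissible⇒K (Admissible-scale (<⇒≤ 0<DA) (pair-admissible β i z λ x∈X → sameSign D≉0 (<⇒≤ 0<DB) (0≤D[x-z] x∈X))))
              (Admissible⇒K (balanced-admissible i j β z (<⇒≤ 0<DA) (<⇒≤ 0<DB)
                (solve 4 (λ d ai ab aj → d :* (aj :- ab) :* (ai :- ab) :+ d :* (ab :- ai) :* (aj :- ab) := con (+ 0)) refl D (α i) (α β) (α j))))
              (x*y≉0 (0<⇒≉0 0<DA) (≉-resp (pair-left β i (i≢β ∘ ≡.sym)) 1≉0))
              (trans (*-congˡ (pair-other β i j j≢β (i≢j ∘ ≡.sym))) (zeroʳ _))
              (≉-resp (tri-right A i B j β i≢j j≢β) (0<⇒≉0 0<DB))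
        ; noneBetween = λ l 0<DE 0<DF →
            let l≢β : l ≢ β
                l≢β = λ where ≡.refl → 0<⇒≉0 0<DE (trans (*-congˡ (-‿inverseʳ _)) (zeroʳ D))
                l≢j : l ≢ j
                l≢j = λ where ≡.refl → 0<⇒≉0 0<DF (trans (*-congˡ (-‿inverseʳ _)) (zeroʳ D))
            -- An exponent in between gives the telescoping `e_j - e_β = (e_j - e_l) + (e_l - e_β)`.
            in ρ-unsplittable {v = pair j β} {u = pair j l} {w = pair l β} {c = 1#} {k = j} {l = β} P∈ρ (<⇒≤ 0<1)
              (λ k → solve 3 (λ j l b → con (+ 1) :* (j :- b) := (j :- l) :+ (l :- b)) refl (δ j k) (δ l k) (δ β k))
              (Admissible⇒K (pair-admissible j l z λ x∈X → sameSign D≉0 (<⇒≤ 0<DF) (0≤D[x-z] x∈X)))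
              (Admissible⇒K (pair-admissible l β z λ x∈X → sameSign D≉0 (<⇒≤ 0<DE) (0≤D[x-z] x∈X)))
              (≉-resp (pair-left j l (l≢j ∘ ≡.sym)) 1≉0) (pair-other j l β (j≢β ∘ ≡.sym) (l≢β ∘ ≡.sym)) (≉-resp (pair-right l β l≢β) -1≉0)
        ; generated = ρ-generated P∈ρ (nonzero⇒≢0ᶠ {k = j} (≉-resp (pair-left j β j≢β) 1≉0))
        }
        where
        j≢β : j ≢ β
        j≢β = λ where ≡.refl → 0<⇒≉0 0<DA (trans (*-congˡ (-‿inverseʳ _)) (zeroʳ D))

      end-member : ∀ {z β j q} → Admissible z β q → ¬ (moment q ≈ 0#) → expSum q z ∈ ρ → j ≢ β → 0# < q j →
        0# < moment q * (α j - α β) → expSum (pair j β) z ∈ ρ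
      end-member {z} {β} {j} {q} adm D≉0 q∈ρ j≢β 0<qj 0<DA = remove (proj₁ (proj₂ scale)) q∈ρ P-adm (Admissible-minus adm P-adm rest≥0 λ x∈X →
          sameSign D≉0 (0≤-resp-≈ (trans (solve 3 (λ d e a → d :* d :- e :* (d :* a) := d :* (d :- e :* a)) refl D ε (α j - α β))
              (*-congˡ (+-congˡ (-‿cong (*-congˡ (sym (∑-pair j β α))))))) (≤-elim (proj₂ (proj₂ (proj₂ scale)))))
            (slope adm x∈X))
        where
        D = moment q
        P-adm : Admissible z β (pair j β)
        P-adm = pair-admissible j β z λ x∈X → sameSign D≉0 (<⇒≤ 0<DA) (slope adm x∈X)
        -- The first bound `ε ≤ q j` keeps the entry at `j` non-negative. The second,
        -- `ε D (α j - α β) ≤ D²`, keeps the slope of the remainder from changing sign.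
        scale = commonScale 0<1 0<qj 0<DA (0<x*x D≉0)
        ε = proj₁ scale
        rest≥0 : ∀ k → k ≢ β → 0# ≤ q k - ε * pair j β k
        rest≥0 k k≢β with k ≟ j
        ... | yes ≡.refl = 0≤-resp-≈ (+-congˡ (-‿cong (*-congˡ (sym (pair-left j β j≢β))))) (≤-elim (proj₁ (proj₂ (proj₂ scale))))
        ... | no k≢j = 0≤-resp-≈ (trans (solve 2 (λ q e → q := q :- e :* con (+ 0)) refl (q k) ε)
            (+-congˡ (-‿cong (*-congˡ (sym (pair-other j β k k≢j k≢β)))))) (nonneg adm k k≢β)

      -- The numbers `q k * (D * (α k - α β))` add up to `D² > 0`, so one of them is positive; it
      -- cannot be the one at `β`, which is 0.
      end : ∀ {z β q} → z ∈ X → Admissible z β q → ¬ (moment q ≈ 0#) → expSum q z ∈ ρ → EndForm ρ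
      end {z} {β} {q} z∈X adm D≉0 q∈ρ = assemble
          (exists-positive v (0≤-resp-≈ (sym ∑v≈) (<⇒≤ 0<DD)) λ v≈0 → 0<⇒≉0 0<DD (trans (sym ∑v≈) (∑-zero v v≈0)))
        where
        D = moment q
        v : Vector ℝ m
        v k = q k * (D * (α k - α β))
        ∑v≈ : ∑ v ≈ D * D
        ∑v≈ = trans (∑-cong λ k → solve 3 (λ q d a → q :* (d :* a) := d :* (q :* a)) refl (q k) D (α k - α β)) (trans (∑-*ˡ D _)
          (*-congˡ (trans (centralMoment (α β) q) (trans (+-congˡ (-‿cong (trans (*-congʳ (total≈0 adm)) (zeroˡ _)))) x-0≈x))))
        0<DD = 0<x*x D≉0
        assemble : ∃[ j ] 0# < v j → EndForm ρ
        assemble (j , 0<vj) =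
          let j≢β : j ≢ β
              j≢β = λ where ≡.refl → 0<⇒≉0 0<vj (trans (*-congˡ (trans (*-congˡ (-‿inverseʳ _)) (zeroʳ D))) (zeroʳ _))
              0<qj , 0<DA = positive-factors (nonneg adm j j≢β) 0<vj
          in end-form z∈X D≉0 (slope adm) 0<DA (end-member adm D≉0 q∈ρ j≢β 0<qj 0<DA)

      summand∈ρ : ∀ {f} (f∈K : f ∈ K) → f ∈ ρ → ∀ β → proj₁ f∈K β ∈ ρ
      summand∈ρ {f} f∈K@(g , g∈AGE , f≗∑g) f∈ρ β = proj₁ (ρ-split (AGE⊆SAGE (g∈AGE β)) (SAGE-part f∈K t 0or1) f∈ρ
          λ x → trans (f≗∑g x) (trans (sym (∑≈sum _)) (sym (trans (+-cong (sym (∑-δ β λ k → g k x)) refl)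
            (trans (sym (∑-+ _ _)) (∑-cong λ k → solve 2 (λ d g → d :* g :+ (con (+ 1) :- d) :* g := g) refl (δ β k) (g k x)))))))
        where
        t : Vector ℝ m
        t k = 1# - δ β k
        0or1 : ∀ k → t k ≈ 0# ⊎ t k ≈ 1#
        0or1 k with β ≟ k
        ... | yes _ = inj₁ (-‿inverseʳ 1#)
        ... | no _ = inj₂ (solve 0 (con (+ 1) :- con (+ 0) := con (+ 1)) refl)

      classify-AGE : ∀ {β f} → f ∈ AGE X α β → f ∈ ρ → ¬ (f ≗ᶠ 0ᶠ) → InteriorForm ρ ⊎ EndForm ρ
      classify-AGE {β} {f} f∈AGE f∈ρ f≢0 = centred (minimiser f∈AGE)
        where
        centred : (∃[ z ] ∃[ q ] z ∈ X × (f ≗ᶠ expSum q z) × (∀ k → k ≢ β → 0# ≤ q k) ×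
          (∀ {x} → x ∈ X → 0# ≤ (moment q - ∑ q * α β) * (x - z))) → InteriorForm ρ ⊎ EndForm ρ
        centred (z , q , z∈X , f≗q , 0≤q , 0≤slope) = byMinimum (≤-<-connex M 0#)
          where
          M = ∑ q
          q∈ρ : expSum q z ∈ ρ
          q∈ρ = ρ-resp f∈ρ λ x → sym (f≗q x)
          byMinimum : M ≤ 0# ⊎ 0# < M → InteriorForm ρ ⊎ EndForm ρ
          -- `M` is the value of `f` at `z`. Without `M` times the monomial of `β` the total is 0
          -- and the moment is `moment q - M * α β`, exactly the slope that `minimiser` controls, so
          -- the remainder is admissible.
          byMinimum (inj₂ 0<M) = contradiction
              (proj₁ (ρ-split (AGE⊆SAGE (δ⇒AGE β M z (<⇒≤ 0<M))) (Admissible⇒K rest-adm) q∈ρ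
                λ x → trans (expSum-cong z x λ k → solve 2 (λ q t → q := t :+ (q :- t)) refl (q k) (M * δ β k)) (expSum-+ _ _ z x)))
              (monomial∉ρ {β} {M} {z} 0<M)
            where
            sum-Mδ : ∀ (u : Vector ℝ m) → ∑ (λ k → M * δ β k * u k) ≈ M * u β
            sum-Mδ u = trans (∑-cong λ k → *-assoc M (δ β k) (u k)) (trans (∑-*ˡ M _) (*-congˡ (∑-δ β u)))
            rest-adm : Admissible z β (λ k → q k - M * δ β k)
            rest-adm = record
              { total≈0 = trans (∑-‿- q _) (trans (+-congˡ (-‿cong (trans (∑-via-1 (λ k → M * δ β k) (sum-Mδ (λ _ → 1#))) (*-identityʳ M)))) (-‿inverseʳ M))
              ; nonneg = λ k k≢β → 0≤-resp-≈ (trans (solve 2 (λ q m → q := q :- m :* con (+ 0)) refl (q k) M)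
                  (+-congˡ (-‿cong (*-congˡ (sym (δ-diff′ k≢β)))))) (0≤q k k≢β)
              ; slope = λ x∈X → 0≤-resp-≈ (*-congʳ (sym (trans (∑-cong λ k → solve 3 (λ q t a → (q :- t) :* a := q :* a :- t :* a) refl (q k) (M * δ β k) (α k))
                  (trans (∑-‿- _ _) (+-congˡ (-‿cong (sum-Mδ α))))))) (0≤slope x∈X)
              }
          byMinimum (inj₁ M≤0) = byMoment em
            where
            M≈0 : M ≈ 0#
            M≈0 = ≤-antisym M≤0 (0≤-resp-≈ (trans (f≗q z) (expSum-centre q z)) (AGE-nonneg f∈AGE z∈X))
            adm : Admissible z β q
            adm = record
              { total≈0 = M≈0 ; nonneg = 0≤q
              ; slope = λ x∈X → 0≤-resp-≈ (*-congʳ (trans (+-congˡ (-‿cong (trans (*-congʳ M≈0) (zeroˡ _)))) x-0≈x)) (0≤slope x∈X) }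
            q≢0 : ¬ (∀ k → q k ≈ 0#)
            q≢0 q≈0 = f≢0 λ x → trans (f≗q x) (∑-zero _ λ k → trans (*-congʳ (q≈0 k)) (zeroˡ _))
            byMoment : Dec (moment q ≈ 0#) → InteriorForm ρ ⊎ EndForm ρ
            byMoment (yes moment≈0) = inj₁ (interior z∈X adm moment≈0 q≢0 q∈ρ)
            byMoment (no moment≉0) = inj₂ (end z∈X adm moment≉0 q∈ρ)

      classify : InteriorForm ρ ⊎ EndForm ρ
      classify = byGenerator (proj₁ extremal)
        where
        byGenerator : (∃[ f ] f ∈ K × ¬ (f ≗ᶠ 0ᶠ) × ρ ≐ Ray f) → InteriorForm ρ ⊎ EndForm ρ
        byGenerator (f , f∈K@(g , g∈AGE , f≗∑g) , f≢0 , ρ≐f) = byNonzero em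
          where
          f∈ρ : f ∈ ρ
          f∈ρ = proj₂ ρ≐f (1# , <⇒≤ 0<1 , λ x → sym (*-identityˡ _))
          byNonzero : Dec (∃[ β ] ¬ (g β ≗ᶠ 0ᶠ)) → InteriorForm ρ ⊎ EndForm ρ
          byNonzero (yes (β , g≢0)) = classify-AGE (g∈AGE β) (summand∈ρ f∈K f∈ρ β) g≢0
          byNonzero (no none) = contradiction
            (λ x → trans (f≗∑g x) (trans (sym (∑≈sum _)) (∑-zero _ λ β → g≗0 β em x))) f≢0
            where
            g≗0 : ∀ β → Dec (g β ≗ᶠ 0ᶠ) → g β ≗ᶠ 0ᶠ
            g≗0 β (yes gβ≗0) = gβ≗0
            g≗0 β (no gβ≢0) = contradiction (β , gβ≢0) none

  -- Rigidity of the listed generators.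

  module RigidVectors {m} (α : Vector ℝ m) (distinct : ∀ i j → i ≢ j → ¬ (α i ≈ α j)) where
    open Exponents α
    open DistinctExponents α distinct
    open AdmissibleVectors α distinct

    -- `G β` and `H β` stand for the centred coefficients of the AGE summands of two SAGE functions
    -- whose sum lies on the ray of `v`. The two families stay separate because each function has to
    -- be shown to lie on the ray by itself.
    record Decomposition (z t : ℝ) (v : Vector ℝ m) : Set where
      field
        G H   : Fin m → Vector ℝ m
        G-adm : ∀ β → Admissible z β (G β)
        H-adm : ∀ β → Admissible z β (H β)
        sum≈  : ∀ k → ∑ (λ β → G β k) + ∑ (λ β → H β k) ≈ t * v k

    open Decomposition

    pairing : Vector ℝ m → Vector ℝ m → ℝ
    pairing w q = ∑ (λ k → q k * w k)

    ∑-pairing : ∀ w (G : Fin m → Vector ℝ m) → ∑ (λ β → pairing w (G β)) ≈ pairing w (λ k → ∑ (λ β → G β k))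
    ∑-pairing w G = trans (∑-swap _) (∑-cong λ k → ∑-*ʳ (w k) _)

    pairing-+ : ∀ w (u v : Vector ℝ m) → pairing w (λ k → u k + v k) ≈ pairing w u + pairing w v
    pairing-+ w u v = trans (∑-cong λ k → distribʳ (w k) (u k) (v k)) (∑-+ _ _)

    pairing-* : ∀ w t (v : Vector ℝ m) → pairing w (λ k → t * v k) ≈ t * pairing w v
    pairing-* w t v = trans (∑-cong λ k → *-assoc t (v k) (w k)) (∑-*ˡ t _)

    -- `w` acts as a supporting functional: it exposes a face that contains `v`, hence every summand
    -- of a multiple of `v`.
    pairing-vanishes : ∀ {z t v} (d : Decomposition z t v) w →
      (∀ β → 0# ≤ pairing w (G d β)) → (∀ β → 0# ≤ pairing w (H d β)) → pairing w v ≈ 0# →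
      (∀ β → pairing w (G d β) ≈ 0#) × (∀ β → pairing w (H d β) ≈ 0#)
    pairing-vanishes {z} {t} {v} d w 0≤G 0≤H wv≈0 =
      ∑≈0⇒≈0 _ 0≤G (x+y≈0⇒x≈0 (0≤∑ _ 0≤G) (0≤∑ _ 0≤H) ∑≈0) , ∑≈0⇒≈0 _ 0≤H (x+y≈0⇒y≈0 (0≤∑ _ 0≤G) (0≤∑ _ 0≤H) ∑≈0)
      where
      ∑≈0 : ∑ (λ β → pairing w (G d β)) + ∑ (λ β → pairing w (H d β)) ≈ 0#
      ∑≈0 = trans (+-cong (∑-pairing w (G d)) (∑-pairing w (H d))) (trans (sym (pairing-+ w _ _))
        (trans (∑-cong λ k → *-congʳ (sum≈ d k)) (trans (pairing-* w t v) (trans (*-congˡ wv≈0) (zeroʳ t)))))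

    -- Only `G` is mentioned, as `rigid⇒extremal` handles the second function by exchanging the two.
    Rigid : ℝ → Fin m → Vector ℝ m → Set
    Rigid z p v = ∀ {t} (d : Decomposition z t v) →
      (∀ β → β ≢ p → ∀ k → G d β k ≈ 0#) × (∃[ τ ] 0# ≤ τ × (∀ k → G d p k ≈ τ * v k))

    -- At `z` the generator vanishes and all AGE summands are non-negative, so each summand vanishes
    -- there and has an admissible coefficient vector. Linear independence turns the equation of
    -- functions into one of vectors, and `Rigid` applies.
    rigid⇒extremal : ∀ {z p v l ρ} → z ∈ X → Admissible z p v → ¬ (v l ≈ 0#) → Rigid z p v → ρ ≐ Ray (expSum v z) → IsExtremalRay K ρ
    rigid⇒extremal {z} {p} {v} {l} {ρ} z∈X adm vl≉0 rigid ρ≐v =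
      (expSum v z , Admissible⇒K adm , nonzero⇒≢0ᶠ vl≉0 , ρ≐v) ,
      λ g h g∈K h∈K g+h∈ρ → left g∈K h∈K (proj₁ ρ≐v g+h∈ρ) ,
        left h∈K g∈K (let t , 0≤t , eq = proj₁ ρ≐v g+h∈ρ in t , 0≤t , λ x → trans (+-comm _ _) (eq x))
      where
      left : ∀ {g h} → g ∈ K → h ∈ K → (g +ᶠ h) ∈ Ray (expSum v z) → g ∈ ρ
      left {g} {h} (gs , gs∈AGE , g≗) (hs , hs∈AGE , h≗) (t , 0≤t , g+h≗) = proj₂ ρ≐v (conclude (rigid d))
        where
        g≗∑ : ∀ x → g x ≈ ∑ (λ β → gs β x)
        g≗∑ x = trans (g≗ x) (sym (∑≈sum _))
        h≗∑ : ∀ x → h x ≈ ∑ (λ β → hs β x)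
        h≗∑ x = trans (h≗ x) (sym (∑≈sum _))
        0≤gs : ∀ β → 0# ≤ gs β z
        0≤gs β = AGE-nonneg (gs∈AGE β) z∈X
        0≤hs : ∀ β → 0# ≤ hs β z
        0≤hs β = AGE-nonneg (hs∈AGE β) z∈X
        contact : ∑ (λ β → gs β z) + ∑ (λ β → hs β z) ≈ 0#
        contact = trans (+-cong (sym (g≗∑ z)) (sym (h≗∑ z))) (trans (g+h≗ z)
          (trans (*-congˡ (trans (expSum-centre v z) (total≈0 adm))) (zeroʳ t)))
        gs≈0 : ∀ β → gs β z ≈ 0#
        gs≈0 = ∑≈0⇒≈0 _ 0≤gs (x+y≈0⇒x≈0 (0≤∑ _ 0≤gs) (0≤∑ _ 0≤hs) contact)
        hs≈0 : ∀ β → hs β z ≈ 0#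
        hs≈0 = ∑≈0⇒≈0 _ 0≤hs (x+y≈0⇒y≈0 (0≤∑ _ 0≤gs) (0≤∑ _ 0≤hs) contact)
        component : ∀ {β f} → f ∈ AGE X α β → f z ≈ 0# → ∃[ q ] (f ≗ᶠ expSum q z) × Admissible z β q
        component f∈AGE fz≈0 = let q , f≗q , 0≤q = AGE-elim f∈AGE z in
          q , f≗q , contact⇒Admissible z∈X 0≤q (λ {x} x∈X → 0≤-resp-≈ (f≗q x) (AGE-nonneg f∈AGE x∈X)) (trans (sym (f≗q z)) fz≈0)
        gc : ∀ β → ∃[ q ] (gs β ≗ᶠ expSum q z) × Admissible z β q
        gc β = component (gs∈AGE β) (gs≈0 β)
        hc : ∀ β → ∃[ q ] (hs β ≗ᶠ expSum q z) × Admissible z β q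
        hc β = component (hs∈AGE β) (hs≈0 β)
        G′ H′ : Fin m → Vector ℝ m
        G′ β = proj₁ (gc β)
        H′ β = proj₁ (hc β)
        ∑-expSum : ∀ (F : Fin m → Vector ℝ m) x → expSum (λ k → ∑ (λ β → F β k)) z x ≈ ∑ (λ β → expSum (F β) z x)
        ∑-expSum F x = sym (∑-pairing (λ k → exp (α k * (x - z))) F)
        d : Decomposition z t v
        d = record
          { G = G′ ; H = H′ ; G-adm = λ β → proj₂ (proj₂ (gc β)) ; H-adm = λ β → proj₂ (proj₂ (hc β))
          ; sum≈ = expSum-injective _ (λ k → t * v k) z λ x → trans (expSum-+ _ _ z x) (trans
              (+-cong (trans (∑-expSum G′ x) (trans (∑-cong λ β → sym (proj₁ (proj₂ (gc β)) x)) (sym (g≗∑ x))))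
                (trans (∑-expSum H′ x) (trans (∑-cong λ β → sym (proj₁ (proj₂ (hc β)) x)) (sym (h≗∑ x)))))
              (trans (g+h≗ x) (sym (expSum-* t v z x)))) }
        conclude : (∀ β → β ≢ p → ∀ k → G′ β k ≈ 0#) × (∃[ τ ] 0# ≤ τ × (∀ k → G′ p k ≈ τ * v k)) → g ∈ Ray (expSum v z)
        conclude (off , τ , 0≤τ , Gp≈τv) = τ , 0≤τ , λ x → trans (g≗∑ x) (trans
          (∑-single (λ β → gs β x) p λ β β≢p → trans (proj₁ (proj₂ (gc β)) x) (∑-zero _ λ k → trans (*-congʳ (off β β≢p k)) (zeroˡ _)))
          (trans (proj₁ (proj₂ (gc p)) x) (trans (expSum-cong z x Gp≈τv) (expSum-* τ v z x))))

    -- The weights (α k - a) (α k - b), with the one at the pivot replaced by zero,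
    -- are non-negative on admissible vectors and vanish only on the expected ones.
    module Pivot (a b : ℝ) (p : Fin m) where

      Q : Vector ℝ m
      Q k = (α k - a) * (α k - b)

      weight : Vector ℝ m
      weight k = Q k * (1# - δ p k)

      weight-p : weight p ≈ 0#
      weight-p = trans (*-congˡ (trans (+-congˡ (-‿cong (δ-same p))) (-‿inverseʳ 1#))) (zeroʳ _)

      weight-off : ∀ {k} → k ≢ p → weight k ≈ Q k
      weight-off k≢p = trans (*-congˡ (trans (+-congˡ (-‿cong (δ-diff′ k≢p))) (solve 0 (con (+ 1) :- con (+ 0) := con (+ 1)) refl))) (*-identityʳ _)

      spread : Fin m → Vector ℝ m → ℝ
      spread β q = ∑ (λ k → q k * ((α k - α β) * (α k - α β)))

      -- With `x = α k` and `y = α β`, `(x - a)(x - b) = (x - y)² + x (2 y - (a + b)) + (a b -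
      -- y²)`. The constant is annihilated by `∑ q ≈ 0#`, the linear part yields the moment, and
      -- `- (q p * Q p)` accounts for the altered weight at the pivot.
      pairing-weight : ∀ β (q : Vector ℝ m) → ∑ q ≈ 0# →
        pairing weight q ≈ spread β q + (moment q * ((α β + α β) - (a + b)) + - (q p * Q p))
      pairing-weight β q ∑q≈0 = trans (∑-cong λ k → solve 6 (λ q x y a b d → q :* ((x :- a) :* (x :- b) :* (con (+ 1) :- d))
          := (q :* ((x :- y) :* (x :- y)) :+ (q :* x) :* ((y :+ y) :- (a :+ b))) :+ q :* (a :* b :- y :* y) :- d :* (q :* ((x :- a) :* (x :- b))))
          refl (q k) (α k) (α β) a b (δ p k))
        (trans (∑-‿- _ _) (trans (+-cong (trans (∑-+ _ _) (+-cong (trans (∑-+ _ _) (+-congˡ (∑-*ʳ _ _)))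
            (trans (∑-*ʳ _ q) (trans (*-congʳ ∑q≈0) (zeroˡ _))))) (-‿cong (∑-δ p _)))
          (solve 3 (λ s n t → s :+ n :+ con (+ 0) :- t := s :+ (n :+ :- t)) refl (spread β q) _ (q p * Q p))))

      spread-term : ∀ {β} {q : Vector ℝ m} → (∀ k → k ≢ β → 0# ≤ q k) → ∀ k → 0# ≤ q k * ((α k - α β) * (α k - α β))
      spread-term {β} {q} 0≤q k with k ≟ β
      ... | yes ≡.refl = ≤-reflexive (sym (trans (*-congˡ (trans (*-congʳ (-‿inverseʳ _)) (zeroˡ _))) (zeroʳ _)))
      ... | no k≢β = 0≤x*y (0≤q k k≢β) (0≤x*x _)

      pivot-term : (∀ k → k ≢ p → 0# ≤ Q k) → ∀ {q : Vector ℝ m} → (∀ k → k ≢ p → 0# ≤ q k) → ∀ k → 0# ≤ q k * weight k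
      pivot-term 0≤Q {q} 0≤q k with k ≟ p
      ... | yes ≡.refl = ≤-reflexive (sym (trans (*-congˡ weight-p) (zeroʳ _)))
      ... | no k≢p = 0≤x*y (0≤q k k≢p) (0≤-resp-≈ (sym (weight-off k≢p)) (0≤Q k k≢p))

      module _ (0≤Q : ∀ k → k ≢ p → 0# ≤ Q k) (Qp≤0 : Q p ≤ 0#) {z : ℝ} where

        0≤tail : ∀ {β q} → β ≢ p → Admissible z β q → 0# ≤ moment q * ((α β + α β) - (a + b)) →
          0# ≤ moment q * ((α β + α β) - (a + b)) + - (q p * Q p)
        0≤tail {β} {q} β≢p adm 0≤slope = 0≤x+y 0≤slope
          (0≤-resp-≈ (solve 2 (λ q Q → q :* :- Q := :- (q :* Q)) refl (q p) (Q p)) (0≤x*y (nonneg adm p (β≢p ∘ ≡.sym)) (0≤-x Qp≤0)))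

        -- For `β = p` all terms are non-negative, the zero weight having removed the entry of
        -- unknown sign. For other `β` the three parts of `pairing-weight` are non-negative, the
        -- last because `q p ≥ 0` and `Q p ≤ 0`.
        0≤pairing : ∀ {β q} → Admissible z β q → (β ≢ p → 0# ≤ moment q * ((α β + α β) - (a + b))) → 0# ≤ pairing weight q
        0≤pairing {β} {q} adm 0≤slope with β ≟ p
        ... | yes ≡.refl = 0≤∑ _ (pivot-term 0≤Q (nonneg adm))
        ... | no β≢p = 0≤-resp-≈ (sym (pairing-weight β q (total≈0 adm)))
            (0≤x+y (0≤∑ _ (spread-term (nonneg adm))) (0≤tail β≢p adm (0≤slope β≢p)))

        -- A vanishing pairing makes the spread vanish, hence every `q k` with `k ≢ β`; the total
        -- then removes the entry at `β`.
        off-pivot : ∀ {β q} → β ≢ p → Admissible z β q → 0# ≤ moment q * ((α β + α β) - (a + b)) → pairing weight q ≈ 0# → ∀ k → q k ≈ 0#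
        off-pivot {β} {q} β≢p adm 0≤slope pairing≈0 = supported-at (total≈0 adm) λ k k≢β →
          let gap≉0 = λ ≈0 → distinct k β k≢β (x-y≈0⇒x≈y ≈0)
          in *-cancelˡ-≈0 (x*y≉0 gap≉0 gap≉0) (trans (*-comm _ _) (spread≈0 k))
          where
          spread≈0 : ∀ k → q k * ((α k - α β) * (α k - α β)) ≈ 0#
          spread≈0 = ∑≈0⇒≈0 _ (spread-term (nonneg adm)) (x+y≈0⇒x≈0 (0≤∑ _ (spread-term (nonneg adm))) (0≤tail β≢p adm 0≤slope)
            (trans (sym (pairing-weight β q (total≈0 adm))) pairing≈0))

        at-pivot : ∀ {q} → Admissible z p q → pairing weight q ≈ 0# → ∀ k → k ≢ p → ¬ (α k ≈ a) → ¬ (α k ≈ b) → q k ≈ 0#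
        at-pivot {q} adm pairing≈0 k k≢p αk≉a αk≉b = *-cancelˡ-≈0 (x*y≉0 (αk≉a ∘ x-y≈0⇒x≈y) (αk≉b ∘ x-y≈0⇒x≈y))
          (trans (*-comm _ _) (trans (*-congˡ (sym (weight-off k≢p)))
            (∑≈0⇒≈0 (λ k → q k * weight k) (pivot-term 0≤Q (nonneg adm)) pairing≈0 k)))

    -- The slope condition says nothing at `x = z`; tested at any other point of `X` it gives sign
    -- information on the moment.
    otherPoint : ∀ z → ∃[ x ] x ∈ X × ¬ (x - z ≈ 0#)
    otherPoint z with ≤-<-connex z 0#
    ... | inj₁ z≤0 = 1# , (-1≤1 , ≤-refl) , 0<⇒≉0 (0<x+y 0<1 (0≤-x z≤0))
    ... | inj₂ 0<z = - 1# , (≤-refl , -1≤1) , λ ≈0 → 0<⇒≉0 (0<x+y 0<1 (<⇒≤ 0<z))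
        (trans (solve 1 (λ z → con (+ 1) :+ z := :- (:- con (+ 1) :- z)) refl z) (trans (-‿cong ≈0) -0≈0))

    minus-total : ∀ {q v : Vector ℝ m} τ → ∑ q ≈ 0# → ∑ v ≈ 0# → ∑ (λ k → q k - τ * v k) ≈ 0#
    minus-total {q} {v} τ ∑q≈0 ∑v≈0 = trans (∑-‿- q _) (trans (+-cong ∑q≈0 (-‿cong (trans (∑-*ˡ τ v) (trans (*-congˡ ∑v≈0) (zeroʳ τ))))) (-‿inverseʳ 0#))

    minus-moment : ∀ {q v : Vector ℝ m} τ → moment q ≈ 0# → moment v ≈ 0# → moment (λ k → q k - τ * v k) ≈ 0#
    minus-moment {q} {v} τ q≈0 v≈0 = trans (∑-cong λ k → solve 4 (λ q t v a → (q :- t :* v) :* a := q :* a :- t :* (v :* a)) refl (q k) τ (v k) (α k))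
      (minus-total τ q≈0 v≈0)

    module Interior {i p j : Fin m} (αi<αp : α i < α p) (αp<αj : α p < α j)
      (outside : ∀ k → k ≢ p → α k ≤ α i ⊎ α j ≤ α k) where
      open Pivot (α i) (α j) p

      private
        A = α j - α p
        B = α p - α i
        0<A : 0# < A
        0<A = <-elim αp<αj
        0<B : 0# < B
        0<B = <-elim αi<αp
        i≢p = α<⇒≢ αi<αp
        j≢p = α<⇒≢ αp<αj ∘ ≡.sym
        i≢j = α<⇒≢ (<-≤-trans αi<αp (<⇒≤ αp<αj))

      T : Vector ℝ m
      T = tri A i B j p

      T-adm : ∀ z → Admissible z p T
      T-adm z = balanced-admissible i j p z (<⇒≤ 0<A) (<⇒≤ 0<B)
        (solve 3 (λ i p j → (j :- p) :* (i :- p) :+ (p :- i) :* (j :- p) := con (+ 0)) refl (α i) (α p) (α j))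

      T-moment : moment T ≈ 0#
      T-moment = trans (tri-moment A i B j p)
        (solve 3 (λ i p j → (j :- p) :* (i :- p) :+ (p :- i) :* (j :- p) := con (+ 0)) refl (α i) (α p) (α j))

      T-left : T i ≈ A
      T-left = tri-left A i B j p i≢j i≢p

      T≉0 : ¬ (T i ≈ 0#)
      T≉0 = ≉-resp T-left (0<⇒≉0 0<A)

      0≤Q : ∀ k → k ≢ p → 0# ≤ Q k
      0≤Q k k≢p with outside k k≢p
      ... | inj₁ αk≤αi = 0≤-resp-≈ (solve 3 (λ k i j → (i :- k) :* ((i :- k) :+ ((j :- i))) := (k :- i) :* (k :- j)) refl (α k) (α i) (α j))
          (0≤x*y (≤-elim αk≤αi) (0≤x+y (≤-elim αk≤αi) (≤-elim (≤-trans (<⇒≤ αi<αp) (<⇒≤ αp<αj)))))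
      ... | inj₂ αj≤αk = 0≤x*y (≤-elim (≤-trans (≤-trans (<⇒≤ αi<αp) (<⇒≤ αp<αj)) αj≤αk)) (≤-elim αj≤αk)

      Qp≤0 : Q p ≤ 0#
      Qp≤0 = x≤0 (0≤-resp-≈ (solve 3 (λ i p j → (p :- i) :* (j :- p) := :- ((p :- i) :* (p :- j))) refl (α i) (α p) (α j)) (0≤x*y (<⇒≤ 0<B) (<⇒≤ 0<A)))

      T-pairing : pairing weight T ≈ 0#
      T-pairing = trans (∑-tri A i B j p weight) (trans (+-cong (+-cong
          (*-congˡ (trans (weight-off i≢p) (trans (*-congʳ (-‿inverseʳ _)) (zeroˡ _))))
          (*-congˡ (trans (weight-off j≢p) (trans (*-congˡ (-‿inverseʳ _)) (zeroʳ _))))) (-‿cong (*-congˡ weight-p)))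
        (solve 2 (λ a b → a :* con (+ 0) :+ b :* con (+ 0) :- (a :+ b) :* con (+ 0) := con (+ 0)) refl A B))

      -- The factor makes `r = q - τ T` vanish at `i`. The pairing clears all entries other than
      -- those at `i`, `j` and `p`, the moment about `α p` then clears `j`, and the total clears
      -- `p`.
      proportional : ∀ {z q} → Admissible z p q → moment q ≈ 0# → pairing weight q ≈ 0# → ∀ k → q k ≈ q i * A ⁻¹ * T k
      proportional {z} {q} adm moment≈0 pairing≈0 k = x-y≈0⇒x≈y (supported-at r-total r-off k)
        where
        τ = q i * A ⁻¹
        r : Vector ℝ m
        r k = q k - τ * T k
        r-total : ∑ r ≈ 0#
        r-total = minus-total τ (total≈0 adm) (total≈0 (T-adm z))
        ri≈0 : r i ≈ 0#
        ri≈0 = trans (+-congˡ (-‿cong (trans (*-congˡ T-left) (trans (solve 3 (λ q a i → q :* i :* a := q :* (a :* i)) refl (q i) A (A ⁻¹))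
          (trans (*-congˡ (⁻¹-inverseʳ (0<⇒≉0 0<A))) (*-identityʳ _)))))) (-‿inverseʳ _)
        r-other : ∀ k → k ≢ p → k ≢ j → r k ≈ 0#
        r-other k k≢p k≢j with k ≟ i
        ... | yes ≡.refl = ri≈0
        ... | no k≢i = trans (+-cong (at-pivot 0≤Q Qp≤0 adm pairing≈0 k k≢p (distinct k i k≢i) (distinct k j k≢j))
            (-‿cong (trans (*-congˡ (tri-other A i B j p k k≢i k≢j k≢p)) (zeroʳ τ)))) (-‿inverseʳ 0#)
        rj≈0 : r j ≈ 0#
        rj≈0 = *-cancelˡ-≈0 (0<⇒≉0 0<A) (trans (*-comm _ _) (trans
          (sym (∑-single (λ k → r k * (α k - α p)) j vanish))
          (trans (centralMoment (α p) r) (trans (+-cong (minus-moment τ moment≈0 T-moment) (-‿cong (trans (*-congʳ r-total) (zeroˡ _)))) (-‿inverseʳ 0#)))))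
          where
          vanish : ∀ k → k ≢ j → r k * (α k - α p) ≈ 0#
          vanish k k≢j with k ≟ p
          ... | yes ≡.refl = trans (*-congˡ (-‿inverseʳ _)) (zeroʳ _)
          ... | no k≢p = trans (*-congʳ (r-other k k≢p k≢j)) (zeroˡ _)
        r-off : ∀ k → k ≢ p → r k ≈ 0#
        r-off k k≢p with k ≟ j
        ... | yes ≡.refl = rj≈0
        ... | no k≢j = r-other k k≢p k≢j

      rigid : ∀ z → Rigid z p T
      rigid z d = withPoint (otherPoint z)
        where
        withPoint : (∃[ x ] x ∈ X × ¬ (x - z ≈ 0#)) → _
        withPoint (x , x∈X , x-z≉0) =
          (λ β β≢p → off-pivot 0≤Q Qp≤0 β≢p (G-adm d β) (0≤slope (G-adm d β) (G-moment β)) (proj₁ stage₂ β)) ,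
          G d p i * A ⁻¹ , 0≤x*y (nonneg (G-adm d p) i i≢p) (<⇒≤ (0<⁻¹ 0<A)) , proportional (G-adm d p) (G-moment p) (proj₁ stage₂ p)
          where
          -- A first pairing, with the slope itself, shows that all moments are 0 since that of `T`
          -- is. At an end point of `X` this is essential: the moment term in the pairing with
          -- `weight` would have no definite sign otherwise.
          w : Vector ℝ m
          w k = α k * (x - z)
          w-pairing : ∀ (q : Vector ℝ m) → pairing w q ≈ moment q * (x - z)
          w-pairing q = trans (∑-cong λ k → sym (*-assoc _ _ _)) (∑-*ʳ (x - z) _)
          stage₁ = pairing-vanishes d w (λ β → 0≤-resp-≈ (sym (w-pairing _)) (slope (G-adm d β) x∈X))
            (λ β → 0≤-resp-≈ (sym (w-pairing _)) (slope (H-adm d β) x∈X))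
            (trans (w-pairing T) (trans (*-congʳ T-moment) (zeroˡ _)))
          moment≈0 : ∀ (q : Vector ℝ m) → pairing w q ≈ 0# → moment q ≈ 0#
          moment≈0 q ≈0 = *-cancelˡ-≈0 x-z≉0 (trans (*-comm _ _) (trans (sym (w-pairing q)) ≈0))
          G-moment : ∀ β → moment (G d β) ≈ 0#
          G-moment β = moment≈0 (G d β) (proj₁ stage₁ β)
          H-moment : ∀ β → moment (H d β) ≈ 0#
          H-moment β = moment≈0 (H d β) (proj₂ stage₁ β)
          0≤slope : ∀ {β q y} → Admissible z β q → moment q ≈ 0# → 0# ≤ moment q * y
          0≤slope _ ≈0 = ≤-reflexive (sym (trans (*-congʳ ≈0) (zeroˡ _)))
          stage₂ = pairing-vanishes d weight
            (λ β → 0≤pairing 0≤Q Qp≤0 (G-adm d β) λ _ → 0≤slope (G-adm d β) (G-moment β))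
            (λ β → 0≤pairing 0≤Q Qp≤0 (H-adm d β) λ _ → 0≤slope (H-adm d β) (H-moment β)) T-pairing

    -- In the direction given by `D`, `p` is the first exponent and `j` the next, so both factors of
    -- the quadratic with roots `α p` and `α j` have the sign of `D` at all other exponents.
    module End {z D : ℝ} {p j : Fin m} (0≤D[x-z] : ∀ {x} → x ∈ X → 0# ≤ D * (x - z)) (0<D[αj-αp] : 0# < D * (α j - α p))
      (0≤D[αk-αp] : ∀ k → 0# ≤ D * (α k - α p)) (0≤D[αk-αj] : ∀ k → k ≢ p → 0# ≤ D * (α k - α j)) where
      open Pivot (α p) (α j) p

      private
        D≉0 : ¬ (D ≈ 0#)
        D≉0 D≈0 = 0<⇒≉0 0<D[αj-αp] (trans (*-congʳ D≈0) (zeroˡ _))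

      j≢p : j ≢ p
      j≢p = λ where ≡.refl → 0<⇒≉0 0<D[αj-αp] (trans (*-congˡ (-‿inverseʳ _)) (zeroʳ D))

      pair-adm : Admissible z p (pair j p)
      pair-adm = pair-admissible j p z λ x∈X → sameSign D≉0 (<⇒≤ 0<D[αj-αp]) (0≤D[x-z] x∈X)

      0≤Q : ∀ k → k ≢ p → 0# ≤ Q k
      0≤Q k k≢p = sameSign D≉0 (0≤D[αk-αp] k) (0≤D[αk-αj] k k≢p)

      Qp≤0 : Q p ≤ 0#
      Qp≤0 = ≤-reflexive (trans (*-congʳ (-‿inverseʳ _)) (zeroˡ _))

      pair-pairing : pairing weight (pair j p) ≈ 0#
      pair-pairing = trans (∑-pair j p weight) (trans (+-cong (trans (weight-off j≢p) (trans (*-congˡ (-‿inverseʳ _)) (zeroʳ _))) (-‿cong weight-p)) (-‿inverseʳ 0#))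

      -- Both factors have the sign of `D`: the moment because `D` and it satisfy the same slope
      -- condition at `z`, and `2 α β - (α p + α j)` because `β` comes no earlier than `p` and `j`.
      0≤slope : ∀ {β q} → Admissible z β q → β ≢ p → 0# ≤ moment q * ((α β + α β) - (α p + α j))
      0≤slope {β} {q} adm β≢p = sameSign D≉0 (along (otherPoint z))
        (0≤-resp-≈ (solve 4 (λ d b p j → d :* (b :- p) :+ d :* (b :- j) := d :* ((b :+ b) :- (p :+ j))) refl D (α β) (α p) (α j))
          (0≤x+y (0≤D[αk-αp] β) (0≤D[αk-αj] β β≢p)))
        where
        along : (∃[ x ] x ∈ X × ¬ (x - z ≈ 0#)) → 0# ≤ D * moment q
        along (x , x∈X , x-z≉0) = sameSign x-z≉0 (0≤-resp-≈ (*-comm _ _) (0≤D[x-z] x∈X)) (0≤-resp-≈ (*-comm _ _) (slope adm x∈X))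

      proportional : ∀ {q} → Admissible z p q → pairing weight q ≈ 0# → ∀ k → q k ≈ q j * pair j p k
      proportional {q} adm pairing≈0 k = x-y≈0⇒x≈y (supported-at (minus-total (q j) (total≈0 adm) (total≈0 pair-adm)) r-off k)
        where
        r-off : ∀ k → k ≢ p → q k - q j * pair j p k ≈ 0#
        r-off k k≢p with k ≟ j
        ... | yes ≡.refl = trans (+-congˡ (-‿cong (trans (*-congˡ (pair-left j p j≢p)) (*-identityʳ _)))) (-‿inverseʳ _)
        ... | no k≢j = trans (+-cong (at-pivot 0≤Q Qp≤0 adm pairing≈0 k k≢p (distinct k p k≢p) (distinct k j k≢j))
            (-‿cong (trans (*-congˡ (pair-other j p k k≢j k≢p)) (zeroʳ _)))) (-‿inverseʳ 0#)

      rigid : Rigid z p (pair j p)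
      rigid d =
        (λ β β≢p → off-pivot 0≤Q Qp≤0 β≢p (G-adm d β) (0≤slope (G-adm d β) β≢p) (proj₁ vanish β)) ,
        G d p j , nonneg (G-adm d p) j j≢p , proportional (G-adm d p) (proj₁ vanish p)
        where
        vanish = pairing-vanishes d weight
          (λ β → 0≤pairing 0≤Q Qp≤0 (G-adm d β) (0≤slope (G-adm d β)))
          (λ β → 0≤pairing 0≤Q Qp≤0 (H-adm d β) (0≤slope (H-adm d β))) pair-pairing

  /-intro : ∀ {x y c} → ¬ (c ≈ 0#) → x ≈ y * c → x / c ≈ y
  /-intro {x} {y} {c} c≉0 x≈yc = trans (*-congʳ x≈yc) (trans (*-assoc y c _) (trans (*-congˡ (⁻¹-inverseʳ c≉0)) (*-identityʳ y)))

  /-elim : ∀ {x c} → ¬ (c ≈ 0#) → x / c * c ≈ x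
  /-elim {x} {c} c≉0 = trans (solve 3 (λ x c i → x :* i :* c := x :* (c :* i)) refl x c (c ⁻¹)) (trans (*-congˡ (⁻¹-inverseʳ c≉0)) (*-identityʳ x))

  0</ : ∀ {x c} → 0# < x → 0# < c → 0# < x / c
  0</ 0<x 0<c = 0<x*y 0<x (0<⁻¹ 0<c)

  -- Trinomials and equality of weighted means.

  module Trinomial (a₋ a₀ a₊ : ℝ) (a₋<a₀ : a₋ < a₀) (a₀<a₊ : a₀ < a₊) where

    A = a₊ - a₀
    B = a₀ - a₋
    C = a₊ - a₋

    0<A : 0# < A
    0<A = <-elim a₀<a₊
    0<B : 0# < B
    0<B = <-elim a₋<a₀
    0<C : 0# < C
    0<C = <-elim (<-≤-trans a₋<a₀ (<⇒≤ a₀<a₊))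
    C≉0 = 0<⇒≉0 0<C

    λ₋ = A / C
    λ₊ = B / C

    0<λ₋ : 0# < λ₋
    0<λ₋ = 0</ 0<A 0<C
    0<λ₊ : 0# < λ₊
    0<λ₊ = 0</ 0<B 0<C

    ratio : ℝ → ℝ → ℝ
    ratio c₋ c₊ = (c₋ * λ₊) / (c₊ * λ₋)

    c₀ : ℝ → ℝ → ℝ
    c₀ c₋ c₊ = - ((c₋ / λ₋) ** λ₋ * (c₊ / λ₊) ** λ₊)

    trinomial : ℝ → ℝ → ℝ → ℝ
    trinomial c₋ c₊ x = c₋ * exp (a₋ * x) + c₀ c₋ c₊ * exp (a₀ * x) + c₊ * exp (a₊ * x)

    centred : ℝ → ℝ → ℝ
    centred z x = A * exp (a₋ * (x - z)) + B * exp (a₊ * (x - z)) - (A + B) * exp (a₀ * (x - z))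

    module _ {c₋ c₊ : ℝ} (0<c₋ : 0# < c₋) (0<c₊ : 0# < c₊) where
      private
        l₋ = ln (c₋ / λ₋)
        l₊ = ln (c₊ / λ₊)
        Z = ln (ratio c₋ c₊)

        exp-l₋ : exp l₋ ≈ c₋ / λ₋
        exp-l₋ = exp-ln (0</ 0<c₋ 0<λ₋)

        exp-l₊ : exp l₊ ≈ c₊ / λ₊
        exp-l₊ = exp-ln (0</ 0<c₊ 0<λ₊)

        c₋≈ : c₋ ≈ exp l₋ * λ₋
        c₋≈ = sym (trans (*-congʳ exp-l₋) (/-elim (0<⇒≉0 0<λ₋)))

        c₊≈ : c₊ ≈ exp l₊ * λ₊
        c₊≈ = sym (trans (*-congʳ exp-l₊) (/-elim (0<⇒≉0 0<λ₊)))

      ln-ratio : Z ≈ l₋ - l₊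
      ln-ratio = ln-unique (sym (/-intro (0<⇒≉0 (0<x*y 0<c₊ 0<λ₋)) (trans (*-congʳ c₋≈) (sym (trans
        (*-congˡ (*-congʳ c₊≈)) (trans
        (solve 4 (λ e f p q → e :* (f :* p :* q) := (e :* f) :* q :* p) refl (exp (l₋ - l₊)) (exp l₊) λ₊ λ₋)
        (*-congʳ (*-congʳ (trans (sym (exp-+ _ _)) (exp-cong (solve 2 (λ x y → x :- y :+ y := x) refl l₋ l₊)))))))))))

      -- The trinomial is a weighted arithmetic mean minus the geometric mean of `exp (l₋ + a₋ * x)`
      -- and `exp (l₊ + a₊ * x)`. It vanishes where the two agree, which is the equation
      -- `z * C ≈ Z`; at this point the three exponents have the common value `w`.
      trinomial-centred : ∀ {z} → z * C ≈ Z → ∃[ s ] 0# < s × trinomial c₋ c₊ ≗ᶠ (s ∙ᶠ centred z)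
      trinomial-centred {z} zC≈Z = exp w * C ⁻¹ , 0<x*y (0<exp w) (0<⁻¹ 0<C) , λ x → trans
          (+-cong (+-cong (term₋ x) (term₀ x)) (term₊ x))
          (solve 7 (λ e i a b E F G → e :* (a :* i) :* E :+ :- (e :* ((a :+ b) :* i)) :* F :+ e :* (b :* i) :* G
            := e :* i :* (a :* E :+ b :* G :- (a :+ b) :* F)) refl (exp w) (C ⁻¹) A B (exp (a₋ * (x - z))) (exp (a₀ * (x - z))) (exp (a₊ * (x - z))))
        where
        w = l₋ + a₋ * z
        w₊ : l₊ + a₊ * z ≈ w
        w₊ = trans (solve 5 (λ l m z p q → m :+ p :* z := (m :+ (z :* (p :- q))) :+ q :* z) refl l₋ l₊ z a₊ a₋)
          (+-congʳ (trans (+-congˡ (trans zC≈Z ln-ratio)) (solve 2 (λ l m → m :+ (l :- m) := l) refl l₋ l₊)))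
        shift : ∀ {l a} x → l + a * z ≈ w → exp l * exp (a * x) ≈ exp w * exp (a * (x - z))
        shift {l} {a} x l+az≈w = trans (sym (exp-+ _ _)) (trans (exp-cong (trans
          (solve 4 (λ l a x z → l :+ a :* x := (l :+ a :* z) :+ a :* (x :- z)) refl l a x z) (+-congʳ l+az≈w))) (exp-+ _ _))
        term₋ : ∀ x → c₋ * exp (a₋ * x) ≈ exp w * λ₋ * exp (a₋ * (x - z))
        term₋ x = trans (*-congʳ c₋≈) (trans (solve 3 (λ l p e → l :* p :* e := p :* (l :* e)) refl (exp l₋) λ₋ (exp (a₋ * x)))
          (trans (*-congˡ (shift x refl)) (solve 3 (λ p e f → p :* (e :* f) := e :* p :* f) refl λ₋ (exp w) (exp (a₋ * (x - z))))))
        term₊ : ∀ x → c₊ * exp (a₊ * x) ≈ exp w * λ₊ * exp (a₊ * (x - z))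
        term₊ x = trans (*-congʳ c₊≈) (trans (solve 3 (λ l p e → l :* p :* e := p :* (l :* e)) refl (exp l₊) λ₊ (exp (a₊ * x)))
          (trans (*-congˡ (shift x w₊)) (solve 3 (λ p e f → p :* (e :* f) := e :* p :* f) refl λ₊ (exp w) (exp (a₊ * (x - z))))))
        l₀ = λ₋ * l₋ + λ₊ * l₊
        A+B≈C : A + B ≈ C
        A+B≈C = solve 3 (λ p q r → (p :- q) :+ (q :- r) := p :- r) refl a₊ a₀ a₋
        λ₋+λ₊ : (A + B) * C ⁻¹ ≈ 1#
        λ₋+λ₊ = trans (*-congʳ A+B≈C) (⁻¹-inverseʳ C≉0)
        -- As `a₀` is the mean of `a₋` and `a₊` with weights `λ₋` and `λ₊`, the left side is the
        -- same mean of `l₋ + a₋ z` and `l₊ + a₊ z`, both equal to `w`.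
        w₀ : l₀ + a₀ * z ≈ w
        w₀ = trans (+-congˡ (trans (sym (*-identityʳ _)) (*-congˡ (sym (trans (*-congʳ (sym A+B≈C)) λ₋+λ₊)))))
          (trans (solve 7 (λ i l m z p q r → ((p :- q) :* i :* l :+ (q :- r) :* i :* m) :+ q :* z :* ((p :- r) :* i)
              := (p :- q) :* i :* (l :+ r :* z) :+ (q :- r) :* i :* (m :+ p :* z)) refl (C ⁻¹) l₋ l₊ z a₊ a₀ a₋)
            (trans (+-congˡ (*-congˡ w₊)) (trans (solve 4 (λ a b i w → a :* i :* w :+ b :* i :* w := (a :+ b) :* i :* w) refl A B (C ⁻¹) w)
              (trans (*-congʳ λ₋+λ₊) (*-identityˡ w)))))
        term₀ : ∀ x → c₀ c₋ c₊ * exp (a₀ * x) ≈ - (exp w * ((A + B) * C ⁻¹)) * exp (a₀ * (x - z))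
        term₀ x = trans (*-congʳ (-‿cong (sym (exp-+ _ _)))) (trans
          (solve 2 (λ l e → :- l :* e := :- (l :* e)) refl (exp l₀) (exp (a₀ * x)))
          (trans (-‿cong (shift x w₀)) (trans (solve 2 (λ e f → :- (e :* f) := :- (e :* con (+ 1)) :* f) refl (exp w) (exp (a₀ * (x - z))))
            (*-congʳ (-‿cong (*-congˡ (sym λ₋+λ₊)))))))

    coefficients : ∀ z → ∃[ c₋ ] ∃[ c₊ ] 0# < c₋ × 0# < c₊ × z * C ≈ ln (ratio c₋ c₊)
    coefficients z = c₋ , c₊ , 0<c₋ , 0<c₊ , sym (ln-unique (sym (/-intro (0<⇒≉0 (0<x*y 0<c₊ 0<λ₋)) (sym (trans
        (solve 4 (λ e p f q → e :* (p :* f :* q) := q :* (e :* f) :* p) refl (exp (z * C)) λ₊ (exp (- (a₊ * z))) λ₋)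
        (*-congʳ (*-congˡ (trans (sym (exp-+ _ _)) (exp-cong (solve 3 (λ z p r → z :* (p :- r) :+ :- (p :* z) := :- (r :* z)) refl z a₊ a₋))))))))))
      where
      -- Chosen so that the common exponent at `z` is 0: both `c₋ exp (a₋ z) / λ₋` and
      -- `c₊ exp (a₊ z) / λ₊` equal 1.
      c₋ = λ₋ * exp (- (a₋ * z))
      c₊ = λ₊ * exp (- (a₊ * z))
      0<c₋ = 0<x*y 0<λ₋ (0<exp _)
      0<c₊ = 0<x*y 0<λ₊ (0<exp _)

  -- Matching the normal forms with the list.

  module Characterisation (n : ℕ) (α : Vector ℝ (3 ℕ.+ n)) (increasing : ∀ i j → i <ꟳ j → α i < α j) where

    distinct : ∀ i j → i ≢ j → ¬ (α i ≈ α j)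
    distinct i j i≢j with <-cmp i j
    ... | tri< i<j _ _ = proj₂ (increasing i j i<j)
    ... | tri≈ _ i≡j _ = contradiction i≡j i≢j
    ... | tri> _ _ j<i = proj₂ (increasing j i j<i) ∘ sym

    reflects-< : ∀ i j → α i < α j → i <ꟳ j
    reflects-< i j αi<αj with <-cmp i j
    ... | tri< i<j _ _ = i<j
    ... | tri≈ _ ≡.refl _ = contradiction refl (proj₂ αi<αj)
    ... | tri> _ _ j<i = contradiction (<⇒≤ (increasing j i j<i)) (<⇒≱ αi<αj)

    monotone : ∀ i j → toℕ i ℕ.≤ toℕ j → α i ≤ α j
    monotone i j i≤j with <-cmp i j
    ... | tri< i<j _ _ = <⇒≤ (increasing i j i<j)
    ... | tri≈ _ ≡.refl _ = ≤-refl
    ... | tri> _ _ j<i = contradiction i≤j (ℕ.<⇒≱ j<i)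

    another : ∀ (β : Fin (3 ℕ.+ n)) → ∃[ j ] j ≢ β
    another zero = suc zero , λ ()
    another (suc β) = zero , λ ()

    last penultimate : Fin (3 ℕ.+ n)
    last = fromℕ (suc (suc n))
    penultimate = inject₁ (fromℕ (suc n))

    penultimate<last : penultimate <ꟳ last
    penultimate<last = ℕ.≤-reflexive (≡.cong suc (≡.trans (toℕ-inject₁ (fromℕ (suc n))) ≡.refl))

    ≢last⇒<last : ∀ {k} → k ≢ last → k <ꟳ last
    ≢last⇒<last {k} k≢last = ℕ.≤∧≢⇒< (≤fromℕ k) (k≢last ∘ toℕ-injective)

    ≢last⇒≤penultimate : ∀ {k} → k ≢ last → toℕ k ℕ.≤ toℕ penultimate
    ≢last⇒≤penultimate {k} k≢last = ≡.subst (toℕ k ℕ.≤_) (≡.sym (toℕ-inject₁ (fromℕ (suc n)))) (ℕ.≤-pred (≢last⇒<last k≢last))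

    open Exponents α
    open DistinctExponents α distinct
    open AdmissibleVectors α distinct
    open ExtremalForm α distinct another
    open RigidVectors α distinct hiding (module End; module Interior)
    module Interior = RigidVectors.Interior α distinct
    module End = RigidVectors.End α distinct

    binomial : Fin (3 ℕ.+ n) → Fin (3 ℕ.+ n) → ℝ → ℝ → ℝ
    binomial j β w x = exp (α j * x) - exp w * exp (α β * x)

    -- Undoes the centring. For `z = - 1` and `z = 1` the number `(α j - α β) * z` becomes the
    -- exponent in the constant of the first and of the second binomial of the list.
    pair-binomial : ∀ {j β z w} → (α j - α β) * z ≈ w → expSum (pair j β) z ≗ᶠ (exp (- (α j * z)) ∙ᶠ binomial j β w)
    pair-binomial {j} {β} {z} {w} ≈w x = trans (∑-pair j β _) (sym (trans
      (solve 4 (λ e f g h → e :* (f :- g :* h) := e :* f :- e :* (g :* h)) refl (exp (- (α j * z))) (exp (α j * x)) (exp w) (exp (α β * x)))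
      (+-cong (trans (sym (exp-+ _ _)) (exp-cong (solve 3 (λ a z x → :- (a :* z) :+ a :* x := a :* (x :- z)) refl (α j) z x)))
        (-‿cong (trans (*-congˡ (sym (exp-+ _ _))) (trans (sym (exp-+ _ _)) (exp-cong (trans (+-congˡ (+-congʳ (sym ≈w)))
          (solve 4 (λ a b z x → :- (a :* z) :+ ((a :- b) :* z :+ b :* x) := b :* (x :- z)) refl (α j) (α β) z x)))))))))

    binomial-Ray : ∀ {j β z w} → (α j - α β) * z ≈ w → Ray (expSum (pair j β) z) ≐ Ray (binomial j β w)
    binomial-Ray ≈w = Ray-cong (0<exp _) (pair-binomial ≈w)

    left middle right : Fin (suc n) → Fin (3 ℕ.+ n)
    left i = inject₁ (inject₁ i)
    middle i = suc (inject₁ i)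
    right i = suc (suc i)

    toℕ-left : ∀ i → toℕ (left i) ≡ toℕ i
    toℕ-left i = ≡.trans (toℕ-inject₁ (inject₁ i)) (toℕ-inject₁ i)

    toℕ-middle : ∀ i → toℕ (middle i) ≡ suc (toℕ i)
    toℕ-middle i = ≡.cong suc (toℕ-inject₁ i)

    left<middle : ∀ i → α (left i) < α (middle i)
    left<middle i = increasing _ _ (ℕ.≤-reflexive (≡.trans (≡.cong suc (toℕ-left i)) (≡.sym (toℕ-middle i))))

    middle<right : ∀ i → α (middle i) < α (right i)
    middle<right i = increasing _ _ (ℕ.≤-reflexive (≡.cong suc (toℕ-middle i)))

    module Tri i = Trinomial (α (left i)) (α (middle i)) (α (right i)) (left<middle i) (middle<right i)

    triVector : Fin (suc n) → Vector ℝ (3 ℕ.+ n)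
    triVector i = tri (α (right i) - α (middle i)) (left i) (α (middle i) - α (left i)) (right i) (middle i)

    trinomial-Ray : ∀ i {c₋ c₊ z} → 0# < c₋ → 0# < c₊ → z * Tri.C i ≈ ln (Tri.ratio i c₋ c₊) →
      Ray (expSum (triVector i) z) ≐ Ray (Tri.trinomial i c₋ c₊)
    trinomial-Ray i {z = z} 0<c₋ 0<c₊ zC≈ln =
      let s , 0<s , eq = Tri.trinomial-centred i 0<c₋ 0<c₊ zC≈ln
      in ≐-sym (Ray-cong 0<s λ x → trans (eq x) (*-congˡ (sym (∑-tri _ (left i) _ (right i) (middle i) _))))

    -- Arranged so that it unfolds to the right-hand side of `theorem6p6`.
    Listed : Pred (ℝ → ℝ) 0ℓ → Set
    Listed ρ =
        (ρ ≐ Ray (binomial (suc zero) zero (α zero - α (suc zero))))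
      ⊎ (ρ ≐ Ray (binomial penultimate last (α penultimate - α last)))
      ⊎ (∃[ i ] ∃[ c₋ ] ∃[ c₊ ] 0# < c₋ × 0# < c₊
          × α (left i) - α (right i) ≤ ln (Tri.ratio i c₋ c₊)
          × ln (Tri.ratio i c₋ c₊) ≤ α (right i) - α (left i)
          × (ρ ≐ Ray (Tri.trinomial i c₋ c₊)))

    consecutive : ∀ i j → α i < α j → (∀ l → α i < α l → ¬ (α l < α j)) → toℕ j ≡ suc (toℕ i)
    consecutive i j αi<αj none with ℕ.m≤n⇒m<n∨m≡n (reflects-< i j αi<αj)
    ... | inj₂ 1+i≡j = ≡.sym 1+i≡j
    ... | inj₁ 1+i<j = contradiction (increasing l j (≡.subst (ℕ._< toℕ j) (≡.sym l≡1+i) 1+i<j))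
        (none l (increasing i l (ℕ.≤-reflexive (≡.sym l≡1+i))))
      where
      1+i<size = ℕ.<-trans 1+i<j (toℕ<n j)
      l = fromℕ< 1+i<size
      l≡1+i : toℕ l ≡ suc (toℕ i)
      l≡1+i = toℕ-fromℕ< 1+i<size

    window : ∀ i β j → toℕ β ≡ suc (toℕ i) → toℕ j ≡ suc (toℕ β) → ∃[ k ] left k ≡ i × middle k ≡ β × right k ≡ j
    window i β zero _ ()
    window i β (suc zero) β≡1+i j≡1+β = contradiction (≡.trans (ℕ.suc-injective j≡1+β) β≡1+i) λ ()
    window i β (suc (suc k)) β≡1+i j≡1+β = k ,
      toℕ-injective (≡.trans (toℕ-left k) (ℕ.suc-injective (≡.trans (ℕ.suc-injective j≡1+β) β≡1+i))) ,
      toℕ-injective (≡.trans (toℕ-middle k) (ℕ.suc-injective j≡1+β)) , ≡.refl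

    -- Multiplied by `C`, the condition that the zero `z` lies between -1 and 1 becomes the pair of
    -- bounds on the logarithm.
    listTrinomial : ∀ {ρ z} k → z ∈ X → ρ ≐ Ray (expSum (triVector k) z) → Listed ρ
    listTrinomial {ρ} {z} k (-1≤z , z≤1) ρ≐ = list (Tri.coefficients k z)
      where
      list : (∃[ c₋ ] ∃[ c₊ ] 0# < c₋ × 0# < c₊ × z * Tri.C k ≈ ln (Tri.ratio k c₋ c₊)) → Listed ρ
      list (c₋ , c₊ , 0<c₋ , 0<c₊ , zC≈ln) = inj₂ (inj₂ (k , c₋ , c₊ , 0<c₋ , 0<c₊ ,
        ≤-respʳ-≈ zC≈ln (≤-intro (solve 3 (λ z p r → (z :- :- con (+ 1)) :* (p :- r) := z :* (p :- r) :- (r :- p)) refl z (α (right k)) (α (left k)))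
          (0≤x*y (≤-elim -1≤z) (<⇒≤ (Tri.0<C k)))) ,
        ≤-respˡ-≈ zC≈ln (≤-intro (solve 3 (λ z p r → (con (+ 1) :- z) :* (p :- r) := (p :- r) :- z :* (p :- r)) refl z (α (right k)) (α (left k)))
          (0≤x*y (≤-elim z≤1) (<⇒≤ (Tri.0<C k)))) ,
        ≐-trans ρ≐ (trinomial-Ray k 0<c₋ 0<c₊ zC≈ln)))

    listInterior : ∀ {ρ} → InteriorForm ρ → Listed ρ
    listInterior {ρ} record { z∈X = z∈X ; i = i ; β = β ; j = j ; αi<αβ = αi<αβ ; αβ<αj = αβ<αj ; noneLeft = noneLeft ; noneRight = noneRight ; generated = generated }
      with window i β j (consecutive i β αi<αβ noneLeft) (consecutive β j αβ<αj noneRight)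
    ... | k , ≡.refl , ≡.refl , ≡.refl = listTrinomial k z∈X generated

    listEnd : ∀ {ρ} → EndForm ρ → Listed ρ
    listEnd {ρ} record { z = z ; D = D ; z∈X = -1≤z , z≤1 ; 0≤D[x-z] = 0≤D[x-z] ; β = β ; j = j ; 0<D[αj-αβ] = 0<D[αj-αβ] ; noneBelow = noneBelow ; noneBetween = noneBetween ; generated = generated } =
      bySign (≤-<-connex D 0#)
      where
      -- For positive `D`, `noneBelow zero` leaves only the first index for `β`, and
      -- `noneBetween (suc zero)` only the second for `j`; the slope condition tested at -1 gives
      -- `z = - 1`. For negative `D` the order is reversed, and the test at 1 gives `z = 1`.
      bySign : D ≤ 0# ⊎ 0# < D → Listed ρ
      bySign (inj₂ 0<D) = inj₁ (first β j generated β≡0 j≡1)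
        where
        below : ∀ {i k} → i <ꟳ k → 0# < D * (α k - α i)
        below i<k = 0<x*y 0<D (<-elim (increasing _ _ i<k))
        β≡0 : β ≡ zero
        β≡0 with β ≟ zero
        ... | yes β≡0 = β≡0
        ... | no β≢0 = contradiction (below (ℕ.≤∧≢⇒< ℕ.z≤n λ 0≡β → β≢0 (≡.sym (toℕ-injective 0≡β)))) (noneBelow zero)
        β<j : β <ꟳ j
        β<j = reflects-< β j (<-intro refl (0<-cancelˡ 0<D 0<D[αj-αβ]))
        j≡1 : j ≡ suc zero
        j≡1 with j ≟ suc zero
        ... | yes j≡1 = j≡1
        ... | no j≢1 = contradiction (below {suc zero} {j} (ℕ.≤∧≢⇒< (ℕ.≤-<-trans ℕ.z≤n β<j) λ 1≡j → j≢1 (≡.sym (toℕ-injective 1≡j))))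
            (noneBetween (suc zero) (below {β} {suc zero} (≡.subst (ℕ._< 1) (≡.cong toℕ (≡.sym β≡0)) (ℕ.s≤s ℕ.z≤n))))
        z≈-1 : z ≈ - 1#
        z≈-1 = ≤-antisym (≤-intro refl (0≤-cancelˡ 0<D (0≤D[x-z] (≤-refl , -1≤1)))) -1≤z
        first : ∀ β j → ρ ≐ Ray (expSum (pair j β) z) → β ≡ zero → j ≡ suc zero → ρ ≐ Ray (binomial (suc zero) zero (α zero - α (suc zero)))
        first _ _ gen ≡.refl ≡.refl = ≐-trans gen (binomial-Ray (trans (*-congˡ z≈-1) (solve 2 (λ a b → (b :- a) :* :- con (+ 1) := a :- b) refl (α zero) (α (suc zero)))))
      bySign (inj₁ D≤0) = inj₂ (inj₁ (final β j generated β≡last j≡penultimate))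
        where
        0<-D : 0# < - D
        0<-D = 0≤-x D≤0 , λ 0≈-D → 0<⇒≉0 0<D[αj-αβ] (trans (*-congʳ (trans (sym neg-neg) (trans (-‿cong (sym 0≈-D)) -0≈0))) (zeroˡ _))
        above : ∀ {i k} → i <ꟳ k → 0# < D * (α i - α k)
        above {i} {k} i<k = 0<-resp-≈ (solve 3 (λ d i k → :- d :* (k :- i) := d :* (i :- k)) refl D (α i) (α k)) (0<x*y 0<-D (<-elim (increasing _ _ i<k)))
        β≡last : β ≡ last
        β≡last with β ≟ last
        ... | yes β≡last = β≡last
        ... | no β≢last = contradiction (above (≢last⇒<last β≢last)) (noneBelow last)
        j<β : j <ꟳ β
        j<β = reflects-< j β (<-intro refl (0<-cancelˡ 0<-D (0<-resp-≈ (solve 3 (λ d i k → d :* (i :- k) := :- d :* (k :- i)) refl D (α j) (α β)) 0<D[αj-αβ])))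
        j≡penultimate : j ≡ penultimate
        j≡penultimate with j ≟ penultimate
        ... | yes j≡p = j≡p
        ... | no j≢p = contradiction (above {j} {penultimate} (ℕ.≤∧≢⇒< (≢last⇒≤penultimate λ j≡last → ℕ.<⇒≢ j<β (≡.cong toℕ (≡.trans j≡last (≡.sym β≡last)))) (j≢p ∘ toℕ-injective)))
            (noneBetween penultimate (above {penultimate} {β} (≡.subst (penultimate <ꟳ_) (≡.sym β≡last) penultimate<last)))
        z≈1 : z ≈ 1#
        z≈1 = ≤-antisym z≤1 (≤-intro refl (0≤-cancelˡ 0<-D
          (0≤-resp-≈ (solve 3 (λ d o z → d :* (o :- z) := :- d :* (z :- o)) refl D 1# z) (0≤D[x-z] (-1≤1 , ≤-refl)))))
        final : ∀ β j → ρ ≐ Ray (expSum (pair j β) z) → β ≡ last → j ≡ penultimate → ρ ≐ Ray (binomial penultimate last (α penultimate - α last))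
        final _ _ gen ≡.refl ≡.refl = ≐-trans gen (binomial-Ray (trans (*-congˡ z≈1) (*-identityʳ _)))

    extremal⇒listed : ∀ {ρ} → IsExtremalRay K ρ → Listed ρ
    extremal⇒listed {ρ} extremal = list (Classify.classify ρ extremal)
      where
      list : InteriorForm ρ ⊎ EndForm ρ → Listed ρ
      list (inj₁ form) = listInterior form
      list (inj₂ form) = listEnd form

    listed⇒extremal : ∀ {ρ} → Listed ρ → IsExtremalRay K ρ
    listed⇒extremal {ρ} (inj₁ ρ≐) = rigid⇒extremal {l = suc zero} (≤-refl , -1≤1) pair-adm (≉-resp (pair-left (suc zero) zero j≢p) 1≉0) rigid
        (≐-trans ρ≐ (≐-sym (binomial-Ray (solve 2 (λ a b → (b :- a) :* :- con (+ 1) := a :- b) refl (α zero) (α (suc zero))))))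
      where
      scaled : ∀ {i j} → toℕ i ℕ.≤ toℕ j → 0# ≤ 1# * (α j - α i)
      scaled i≤j = 0≤x*y (<⇒≤ 0<1) (≤-elim (monotone _ _ i≤j))
      -- Any `D` of the right sign would do as direction: 1 for the left end point, and -1 for the
      -- right one below.
      open End {z = - 1#} {D = 1#} {p = zero} {j = suc zero} (λ (-1≤x , _) → 0≤x*y (<⇒≤ 0<1) (≤-elim -1≤x))
        (0<x*y 0<1 (<-elim (increasing zero (suc zero) ℕ.≤-refl))) (λ k → scaled ℕ.z≤n)
        (λ k k≢0 → scaled (ℕ.≤∧≢⇒< ℕ.z≤n (λ 0≡k → k≢0 (≡.sym (toℕ-injective 0≡k)))))
    listed⇒extremal {ρ} (inj₂ (inj₁ ρ≐)) = rigid⇒extremal {l = penultimate} (-1≤1 , ≤-refl) pair-adm (≉-resp (pair-left penultimate last j≢p) 1≉0) rigid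
        (≐-trans ρ≐ (≐-sym (binomial-Ray (*-identityʳ _))))
      where
      scaled : ∀ {i j} → toℕ i ℕ.≤ toℕ j → 0# ≤ - 1# * (α i - α j)
      scaled {i} {j} i≤j = 0≤-resp-≈ (solve 2 (λ i j → j :- i := :- con (+ 1) :* (i :- j)) refl (α i) (α j)) (≤-elim (monotone i j i≤j))
      open End {z = 1#} {D = - 1#} {p = last} {j = penultimate}
        (λ {x} (_ , x≤1) → 0≤-resp-≈ (solve 2 (λ x o → o :- x := :- con (+ 1) :* (x :- o)) refl x 1#) (≤-elim x≤1))
        (0<-resp-≈ (solve 2 (λ i j → j :- i := :- con (+ 1) :* (i :- j)) refl (α penultimate) (α last)) (<-elim (increasing penultimate last penultimate<last)))
        (λ k → scaled (≤fromℕ k)) (λ k k≢last → scaled (≢last⇒≤penultimate k≢last))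
    listed⇒extremal {ρ} (inj₂ (inj₂ (i , c₋ , c₊ , 0<c₋ , 0<c₊ , lower , upper , ρ≐))) =
      rigid⇒extremal {l = left i} z∈X (T-adm z) T≉0 (rigid z) (≐-trans ρ≐ (≐-sym (trinomial-Ray i 0<c₋ 0<c₊ zC≈Z)))
      where
      outside : ∀ k → k ≢ middle i → α k ≤ α (left i) ⊎ α (right i) ≤ α k
      outside k k≢p with <-cmp k (middle i)
      ... | tri< k<p _ _ = inj₁ (monotone k (left i) (≡.subst (toℕ k ℕ.≤_) (≡.trans (toℕ-inject₁ i) (≡.sym (toℕ-left i))) (ℕ.≤-pred k<p)))
      ... | tri≈ _ k≡p _ = contradiction k≡p k≢p
      ... | tri> _ _ p<k = inj₂ (monotone (right i) k (≡.subst (λ m → suc m ℕ.≤ toℕ k) (toℕ-middle i) p<k))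
      open Interior (left<middle i) (middle<right i) outside
      Z = ln (Tri.ratio i c₋ c₊)
      -- The zero of the trinomial; the bounds on `Z` place it in `X`.
      z = Z / Tri.C i
      zC≈Z : z * Tri.C i ≈ Z
      zC≈Z = /-elim (Tri.C≉0 i)
      z∈X : z ∈ X
      z∈X =
        ≤-intro refl (0≤-cancelˡ (Tri.0<C i) (0≤-resp-≈ (trans (+-congʳ (sym zC≈Z))
          (solve 3 (λ z p r → z :* (p :- r) :- (r :- p) := (p :- r) :* (z :- :- con (+ 1))) refl z (α (right i)) (α (left i)))) (≤-elim lower))) ,
        ≤-intro refl (0≤-cancelˡ (Tri.0<C i) (0≤-resp-≈ (trans (+-congˡ (-‿cong (sym zC≈Z)))
          (solve 3 (λ z p r → (p :- r) :- z :* (p :- r) := (p :- r) :* (con (+ 1) :- z)) refl z (α (right i)) (α (left i)))) (≤-elim upper)))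

    characterisation : ∀ ρ → IsExtremalRay (SAGE (Icc (- 1#) 1#) α) ρ ⇔ Listed ρ
    characterisation ρ = mk⇔ extremal⇒listed listed⇒extremal

theorem6p6 :
  ExcludedMiddle 0ℓ →
  (R : CompleteOrderedField) →
  let open CompleteOrderedField R
      open Analysis R
  in
  (n : ℕ) (α : Vector ℝ (3 +ℕ n)) →
  (∀ i j → i <ꟳ j → α i < α j) →
  let X    = Icc (- 1#) 1#
      α₁   = α zero
      α₂   = α (suc zero)
      αₘ₋₁ = α (inject₁ (fromℕ (sucℕ n)))
      αₘ   = α (fromℕ (sucℕ (sucℕ n)))
  in
  (ρ : Pred (ℝ → ℝ) 0ℓ) →
  IsExtremalRay (SAGE X α) ρ ⇔
  ( (ρ ≐ Ray (λ x → exp (α₂ * x) - exp (α₁ - α₂) * exp (α₁ * x)))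
  ⊎ (ρ ≐ Ray (λ x → exp (αₘ₋₁ * x) - exp (αₘ₋₁ - αₘ) * exp (αₘ * x)))
  ⊎ (∃[ i ] ∃[ c₋ ] ∃[ c₊ ]
      let α₋ = α (inject₁ (inject₁ i))
          α₀ = α (suc (inject₁ i))
          α₊ = α (suc (suc i))
          λ₋ = (α₊ - α₀) / (α₊ - α₋)
          λ₊ = (α₀ - α₋) / (α₊ - α₋)
          c₀ = - ((c₋ / λ₋) ** λ₋ * (c₊ / λ₊) ** λ₊)
      in
        0# < c₋
      × 0# < c₊
      × α₋ - α₊ ≤ ln ((c₋ * λ₊) / (c₊ * λ₋))
      × ln ((c₋ * λ₊) / (c₊ * λ₋)) ≤ α₊ - α₋
      × (ρ ≐ Ray (λ x → c₋ * exp (α₋ * x) + c₀ * exp (α₀ * x) + c₊ * exp (α₊ * x)))))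
theorem6p6 em R n α increasing ρ = RealAnalysis.Characterisation.characterisation em R n α increasing ρ
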